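{- Let $B$ be a constant. For instances $\psi: M\to S_m$ of HomExtSym with $M\le G\le S_n$ and $|G|\le B$, the set $\mathrm{HExt}_G(\psi)$ can be efficiently enumerated.
   Context: Permutation groups are given by lists of generators (at most $2n$ for a subgroup of $S_n$), and homomorphisms by their values on generators. An instance of HomExtSym is a permutation group $G\le S_n$, a subgroup $M\le G$ and a homomorphism $\psi: M\to S_m$. The set of solutions is $\mathrm{HExt}_G(\psi)=\{\varphi\in\operatorname{Hom}(G,S_m):\varphi|_M=\psi\}$. A set $\mathcal S$ can be efficiently enumerated if an algorithm lists the elements of $\mathcal S$ at $\mathrm{poly}(n,m)$ marginal cost, where the marginal cost of the $i$-th element is the time spent between producing the $(i-1)$-st and the $i$-th elements. -}

module Defs where

open import Algebra.Bundles using (Group)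
open import Algebra.Morphism.Bundles using (GroupHomomorphism)
open import Data.Fin.Base using (Fin; toℕ)
open import Data.Fin.Permutation using (Permutation′; _⟨$⟩ʳ_; _∘ₚ_; _≈_; id; flip; inverseˡ; inverseʳ)
open import Data.List.Base using (List; []; _∷_; map; foldr; tabulate; catMaybes)
open import Data.List.Relation.Unary.All using (All)
open import Data.List.Relation.Unary.Enumerates.Setoid using (IsEnumeration)
open import Data.List.Relation.Unary.Unique.Setoid using (Unique)
open import Data.Maybe.Base using (Maybe; just; nothing)
open import Data.Nat.Base using (ℕ; zero; suc; _+_; _*_; _^_; _≤_)
open import Data.Product.Base using (Σ; Σ-syntax; ∃-syntax; _×_; _,_; proj₁; proj₂)
open import Data.Vec.Base as Vec using (Vec; lookup)
open import Data.Vec.Functional using (Vector)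
open import Function.Base using (_on_)
open import Function.Bundles using (Bijection)
open import Level using (0ℓ)
open import Relation.Binary.Bundles using (Setoid)
open import Relation.Binary.PropositionalEquality as ≡ using (_≡_; refl; cong; trans; sym)

-- Permutations are compared pointwise, and π ∘ₚ ρ applies π first.

Sym : ℕ → Group 0ℓ 0ℓ
Sym n = record
  { Carrier = Permutation′ n
  ; _≈_     = _≈_
  ; _∙_     = _∘ₚ_
  ; ε       = id
  ; _⁻¹     = flip
  ; isGroup = record
    { isMonoid = record
      { isSemigroup = record
        { isMagma = record
          { isEquivalence = record
            { refl  = λ _ → refl
            ; sym   = λ p i → sym (p i)
            ; trans = λ p q i → trans (p i) (q i)
            }
          ; ∙-cong = λ {_} {_} {ρ} p q i → trans (cong (ρ ⟨$⟩ʳ_) (p i)) (q _)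
          }
        ; assoc = λ _ _ _ _ → refl
        }
      ; identity = (λ _ _ → refl) , (λ _ _ → refl)
      }
    ; inverse = (λ π _ → inverseʳ π) , (λ π _ → inverseˡ π)
    ; ⁻¹-cong = λ {π} {ρ} p i →
        trans (cong (flip π ⟨$⟩ʳ_) (sym (trans (p _) (inverseʳ ρ)))) (inverseˡ π)
    }
  }

data _∈⟨_⟩ {n k} : Permutation′ n → Vector (Permutation′ n) k → Set where
  gen  : ∀ {S} i → S i ∈⟨ S ⟩
  unit : ∀ {S} → id ∈⟨ S ⟩
  mul  : ∀ {S π ρ} → π ∈⟨ S ⟩ → ρ ∈⟨ S ⟩ → (π ∘ₚ ρ) ∈⟨ S ⟩
  inv  : ∀ {S π} → π ∈⟨ S ⟩ → flip π ∈⟨ S ⟩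
  resp : ∀ {S π ρ} → π ≈ ρ → π ∈⟨ S ⟩ → ρ ∈⟨ S ⟩

⟨_⟩ : ∀ {n k} → Vector (Permutation′ n) k → Group 0ℓ 0ℓ
⟨_⟩ {n} S = record
  { Carrier = Σ[ π ∈ Permutation′ n ] π ∈⟨ S ⟩
  ; _≈_     = _≈_ on proj₁
  ; _∙_     = λ (π , p) (ρ , q) → (π ∘ₚ ρ) , mul p q
  ; ε       = id , unit
  ; _⁻¹     = λ (π , p) → flip π , inv p
  ; isGroup = record
    { isMonoid = record
      { isSemigroup = record
        { isMagma = record
          { isEquivalence = record
            { refl  = λ {x} → S.refl {proj₁ x}
            ; sym   = λ {x} {y} → S.sym {proj₁ x} {proj₁ y}
            ; trans = λ {x} {y} {z} → S.trans {proj₁ x} {proj₁ y} {proj₁ z}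
            }
          ; ∙-cong = λ {x} {y} {u} {v} →
              S.∙-cong {proj₁ x} {proj₁ y} {proj₁ u} {proj₁ v}
          }
        ; assoc = λ x y z → S.assoc (proj₁ x) (proj₁ y) (proj₁ z)
        }
      ; identity = (λ x → S.identityˡ (proj₁ x)) , (λ x → S.identityʳ (proj₁ x))
      }
    ; inverse = (λ x → S.inverseˡ (proj₁ x)) , (λ x → S.inverseʳ (proj₁ x))
    ; ⁻¹-cong = λ {x} {y} → S.⁻¹-cong {proj₁ x} {proj₁ y}
    }
  }
  where module S = Group (Sym n)

Hom : Group 0ℓ 0ℓ → Group 0ℓ 0ℓ → Set
Hom G H = GroupHomomorphism (Group.rawGroup G) (Group.rawGroup H)

open GroupHomomorphism public using (⟦_⟧)

HasOrder : Group 0ℓ 0ℓ → ℕ → Set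
HasOrder G k = Bijection (≡.setoid (Fin k)) (Group.setoid G)

OrderAtMost : ℕ → Group 0ℓ 0ℓ → Set
OrderAtMost B G = ∃[ k ] HasOrder G k × k ≤ B

record HomExtSym (n m : ℕ) : Set where
  field
    {#G #M} : ℕ
    gensG   : Vector (Permutation′ n) #G
    gensM   : Vector (Permutation′ n) #M
    #G≤2n   : #G ≤ 2 * n
    #M≤2n   : #M ≤ 2 * n
    M≤G     : ∀ {π} → π ∈⟨ gensM ⟩ → π ∈⟨ gensG ⟩
    ψ       : Hom ⟨ gensM ⟩ (Sym m)

  G M : Group 0ℓ 0ℓ
  G = ⟨ gensG ⟩
  M = ⟨ gensM ⟩

  ι : Group.Carrier M → Group.Carrier G
  ι (π , p) = π , M≤G p

  HExt : Set
  HExt = Σ[ φ ∈ Hom G (Sym m) ] (∀ x → ⟦ φ ⟧ (ι x) ≈ ⟦ ψ ⟧ x)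

  HExt-setoid : Setoid 0ℓ 0ℓ
  HExt-setoid = record
    { Carrier       = HExt
    ; _≈_           = λ (φ , _) (χ , _) → ∀ x → ⟦ φ ⟧ x ≈ ⟦ χ ⟧ x
    ; isEquivalence = record
      { refl  = λ _ _ → refl
      ; sym   = λ p x i → sym (p x i)
      ; trans = λ p q x i → trans (p x i) (q x i)
      }
    }

-- An environment machine for a call-by-value functional language over
-- binary trees, with an instruction that emits a value as output.  Time is
-- the number of machine transitions.  Values are immutable and shared, so a
-- transition only moves a bounded number of pointers, the bound depending
-- on the program alone; hence the time is polynomially related to the time
-- on a random access or Turing machine.
--
-- Exp v is the type of expressions with v free variables (de Bruijn
-- indices, the most recently bound variable being zero).

data Exp (v : ℕ) : Set where
  var    : Fin v → Exp v
  nil    : Exp v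
  cons   : Fin v → Fin v → Exp v
  -- case on nil, or on cons a b; the latter branch binds b as 0 and a as 1
  match  : Fin v → Exp v → Exp (2 + v) → Exp v
  -- recursive function: in the body, 0 is the argument, 1 the function
  fun    : Exp (2 + v) → Exp v
  app    : Fin v → Fin v → Exp v
  let′   : Exp v → Exp (1 + v) → Exp v
  output : Fin v → Exp v

data Value : Set where
  nil  : Value
  cons : Value → Value → Value
  clo  : ∀ {v} → Exp (2 + v) → Vec Value v → Value

Env : ℕ → Set
Env = Vec Value

record Frame : Set where
  constructor frame
  field
    {vars} : ℕ
    body   : Exp (1 + vars)
    env    : Env vars

data State : Set where
  eval : ∀ {v} → Exp v → Env v → List Frame → State
  ret  : Value → List Frame → State

-- An event is what a single transition emits, if anything.
Event : Set
Event = Maybe Value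

data Outcome : Set where
  halt  : Outcome
  stuck : Outcome
  next  : Event → State → Outcome

match-step : ∀ {v} → Value → Exp v → Exp (2 + v) → Env v → List Frame → Outcome
match-step nil        e₁ e₂ ρ K = next nothing (eval e₁ ρ K)
match-step (cons a b) e₁ e₂ ρ K = next nothing (eval e₂ (b Vec.∷ a Vec.∷ ρ) K)
match-step (clo _ _)  e₁ e₂ ρ K = stuck

app-step : Value → Value → List Frame → Outcome
app-step (clo e ρ) a K = next nothing (eval e (a Vec.∷ clo e ρ Vec.∷ ρ) K)
app-step _         a K = stuck

step : State → Outcome
step (eval (var x)         ρ K) = next nothing (ret (lookup ρ x) K)
step (eval nil             ρ K) = next nothing (ret nil K)
step (eval (cons x y)      ρ K) = next nothing (ret (cons (lookup ρ x) (lookup ρ y)) K)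
step (eval (match x e₁ e₂) ρ K) = match-step (lookup ρ x) e₁ e₂ ρ K
step (eval (fun e)         ρ K) = next nothing (ret (clo e ρ) K)
step (eval (app x y)       ρ K) = app-step (lookup ρ x) (lookup ρ y) K
step (eval (let′ e₁ e₂)    ρ K) = next nothing (eval e₁ ρ (frame e₂ ρ ∷ K))
step (eval (output x)      ρ K) = next (just (lookup ρ x)) (ret nil K)
step (ret a (frame e ρ ∷ K))    = next nothing (eval e (a Vec.∷ ρ) K)
step (ret a [])                 = halt

-- s ⇝ t: the computation from s halts, and t lists the events of all of its
-- transitions in order.
data _⇝_ : State → List Event → Set where
  done : ∀ {s} → step s ≡ halt → s ⇝ []
  _∷_  : ∀ {s s′ ev t} → step s ≡ next ev s′ → s′ ⇝ t → s ⇝ (ev ∷ t)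

-- A program is an expression whose only variable is the input.
Program : Set
Program = Exp 1

start : Program → Value → State
start P a = eval P (a Vec.∷ Vec.[]) []

outputs : List Event → List Value
outputs = catMaybes

-- The times from the start to the first output, between consecutive
-- outputs, and from the last output (or the start) to halting; the first
-- argument is the time already spent since the previous output.
costs-from : ℕ → List Event → List ℕ
costs-from k []            = k ∷ []
costs-from k (nothing ∷ t) = costs-from (suc k) t
costs-from k (just _  ∷ t) = suc k ∷ costs-from 0 t

marginalCosts : List Event → List ℕ
marginalCosts = costs-from 0

-- Numbers are in unary, which is harmless for bounds polynomial in n and m.
codeℕ : ℕ → Value
codeℕ zero    = nil
codeℕ (suc k) = cons nil (codeℕ k)

codeList : List Value → Value
codeList = foldr cons nil

codePerm : ∀ {n} → Permutation′ n → Value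
codePerm π = codeList (tabulate λ i → codeℕ (toℕ (π ⟨$⟩ʳ i)))

codePerms : ∀ {n k} → Vector (Permutation′ n) k → Value
codePerms S = codeList (tabulate λ i → codePerm (S i))

codeHom : ∀ {n m k} {S : Vector (Permutation′ n) k} → Hom ⟨ S ⟩ (Sym m) → Value
codeHom {S = S} φ = codePerms λ i → ⟦ φ ⟧ (S i , gen i)

codeInstance : ∀ {n m} → HomExtSym n m → Value
codeInstance {n} {m} I =
  codeList (codeℕ n ∷ codeℕ m ∷ codePerms gensG ∷ codePerms gensM ∷ codeHom ψ ∷ [])
  where open HomExtSym I

-- P, run on I, lists every element of HExt exactly once and then halts, all
-- marginal costs being at most d.
record Enumerates (P : Program) {n m} (I : HomExtSym n m) (d : ℕ) : Set where
  open HomExtSym I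
  field
    trace     : List Event
    run       : start P (codeInstance I) ⇝ trace
    solutions : List HExt
    complete  : IsEnumeration HExt-setoid solutions
    unique    : Unique HExt-setoid solutions
    listed    : outputs trace ≡ map (λ (φ , _) → codeHom φ) solutions
    cheap     : All (_≤ d) (marginalCosts trace)

-- For the instances in the class 𝓒, one program enumerates HExt at
-- poly(n, m) marginal cost.
EfficientlyEnumerable : (∀ {n m} → HomExtSym n m → Set) → Set
EfficientlyEnumerable 𝓒 =
  Σ[ P ∈ Program ] ∃[ c ] ∃[ e ]
    (∀ {n m} (I : HomExtSym n m) → 𝓒 I → Enumerates P I (c * (1 + n + m) ^ e))

-- An extension of ψ to G is a G-action on [m] that restricts to the given
-- M-action, hence a tiling of [m] by orbits.  An orbit with base point p is the
-- map e ↦ p · e from G to [m], and as |G| is bounded there are only polynomially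
-- many such maps.  Depth first search tiles [m] orbit by orbit, each time
-- covering the first remaining point; its delay is polynomial if dead ends are
-- never entered.
--
-- So one has to decide whether the M-set R of the remaining points carries a
-- compatible G-action.  Up to isomorphism a G-orbit is given by its kernel, a map
-- G → G, so there is a bounded number of types.  If R carries an action with an
-- orbit of a given type, then after removing from R any block of that type, what
-- is left still carries an action, since finite M-sets may be cancelled:
-- A ⊔ T ≅ B ⊔ T implies A ≅ B.  Hence it suffices to try all numbers of removals
-- for each type, one type after the other, and to remove blocks greedily.
module Submission where

open import Algebra.Bundles using (Group)
open import Algebra.Morphism.Bundles using (GroupHomomorphism)
open import Data.Bool.Base using (Bool; true; false; if_then_else_; not; _∧_; _∨_)
open import Data.Empty using (⊥-elim)
open import Data.Fin.Base as Fin using (Fin; zero; suc; toℕ)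
open import Data.Fin.Permutation using (Permutation′; permutation; _⟨$⟩ʳ_; _⟨$⟩ˡ_; inverseʳ; inverseˡ; _∘ₚ_; flip) renaming (id to idₚ)
import Data.Fin.Properties as Fin
open import Data.List.Base as List hiding (lookup; allFin; tabulate; find)
import Data.List.Membership.DecPropositional as DecMembership
open import Data.List.Membership.Propositional using (_∈_; find; lose)
open import Data.List.Membership.Propositional.Properties
open import Data.List.Properties
open import Data.List.Relation.Unary.All as All using (All; []; _∷_)
import Data.List.Relation.Unary.All.Properties as All
open import Data.List.Relation.Unary.AllPairs as AllPairs using (AllPairs; []; _∷_)
import Data.List.Relation.Unary.AllPairs.Properties as AllPairs
open import Data.List.Relation.Unary.Any as Any using (Any; here; there)
import Data.List.Relation.Unary.Any.Properties as Any
open import Data.List.Relation.Unary.Enumerates.Setoid using (IsEnumeration)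
open import Data.List.Relation.Unary.Unique.Propositional using (Unique)
import Data.List.Relation.Unary.Unique.Propositional.Properties as Unique
import Data.List.Relation.Unary.Unique.Setoid as Setoid
open import Data.Maybe.Base using (Maybe; just; nothing)
open import Data.Nat.Base hiding (_/_)
open import Data.Nat.Properties hiding (_≟_)
open import Data.Nat.Tactic.RingSolver using (solve-∀)
open import Data.Product.Base using (Σ-syntax; ∃-syntax; _×_; _,_; proj₁; proj₂)
open import Data.Unit.Base using (⊤; tt)
open import Data.Vec.Base as Vec using (Vec; lookup; tabulate)
import Data.Vec.Properties as Vec
open import Function.Base using (_∘_; id)
open import Function.Bundles using (Bijection)
open import Relation.Binary.PropositionalEquality hiding (resp)
open import Relation.Nullary
open import Relation.Nullary.Decidable using (map′; _×-dec_; _→-dec_; ¬?; decidable-stable)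
open import Relation.Nullary.Reflects using (det)
open import Defs

-- Polynomials

-- The removed block need not be an orbit of the action assumed to exist, so that action cannot
-- simply be restricted. Let `a` be the block and `b` an orbit with the same kernel. A point outside
-- `a` is moved along `lookup b e ↦ lookup a e` for as long as it lies in `b`. This step is
-- injective, so the walk leaves `b`; it yields a bijection between the complements of `a` and `b`
-- that commutes with `M`, and the action is conjugated by it. No new kernels arise, so an exhausted
-- type does not come back and a single pass through the types decides the question. With t types
-- the pass ends with (m+1)^t candidates.
--
-- Each block is based at the first remaining point. A homomorphism therefore has exactly one
-- tiling, and nothing is listed twice.
--
-- All of this has to become machine code with proven bounds. Every program is built together with
-- its meaning, its time and the size of its result. Loops whose length depends on `B` only are
-- unrolled, so that their bounds are composed polynomials; loops of variable length need control
-- over the growth of their state.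

data Poly : Set where
  X           : Poly
  con         : ℕ → Poly
  -- Bounds are syntax, so that monotonicity holds by construction. Composition occurs because
  -- results are passed on as inputs.
  _⊕_ _⊗_ _⊚_ : Poly → Poly → Poly

infixl 6 _⊕_
infixl 7 _⊗_
infixr 8 _⊚_

_at_ : Poly → ℕ → ℕ
X       at n = n
con c   at n = c
(p ⊕ q) at n = p at n + q at n
(p ⊗ q) at n = p at n * q at n
(p ⊚ q) at n = p at (q at n)

infix 9 _at_

at-mono : ∀ p {i j} → i ≤ j → p at i ≤ p at j
at-mono X       i≤j = i≤j
at-mono (con c) i≤j = ≤-refl
at-mono (p ⊕ q) i≤j = +-mono-≤ (at-mono p i≤j) (at-mono q i≤j)
at-mono (p ⊗ q) i≤j = *-mono-≤ (at-mono p i≤j) (at-mono q i≤j)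
at-mono (p ⊚ q) i≤j = at-mono p (at-mono q i≤j)

*-^ : ∀ a b e → (a * b) ^ e ≡ a ^ e * b ^ e
*-^ a b zero    = refl
*-^ a b (suc e) = trans (cong (a * b *_) (*-^ a b e)) ([m*n]*[o*p]≡[m*o]*[n*p] a b (a ^ e) (b ^ e))

-- Opaque, since the constants are too large to be computed.
opaque
  at-majorant : ∀ p → ∃[ c ] ∃[ e ] (∀ n → p at n ≤ c * suc n ^ e)
  at-majorant X       = 1 , 1 , λ n → ≤-trans (n≤1+n n) (≤-reflexive (sym (trans (*-identityˡ _) (*-identityʳ _))))
  at-majorant (con c) = c , 0 , λ n → ≤-reflexive (sym (*-identityʳ c))
  at-majorant (p ⊕ q) with at-majorant p | at-majorant q
  ... | c , e , p≤ | d , f , q≤ = c + d , e + f , λ n → begin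
      p at n + q at n                          ≤⟨ +-mono-≤ (p≤ n) (q≤ n) ⟩
      c * suc n ^ e + d * suc n ^ f            ≤⟨ +-mono-≤ (*-monoʳ-≤ c (^-monoʳ-≤ (suc n) (m≤m+n e f)))
        (*-monoʳ-≤ d (^-monoʳ-≤ (suc n) (m≤n+m f e))) ⟩
      c * suc n ^ (e + f) + d * suc n ^ (e + f) ≡⟨ *-distribʳ-+ (suc n ^ (e + f)) c d ⟨
      (c + d) * suc n ^ (e + f)                ∎
    where open ≤-Reasoning
  at-majorant (p ⊗ q) with at-majorant p | at-majorant q
  ... | c , e , p≤ | d , f , q≤ = c * d , e + f , λ n → begin
      p at n * q at n                      ≤⟨ *-mono-≤ (p≤ n) (q≤ n) ⟩
      c * suc n ^ e * (d * suc n ^ f)      ≡⟨ [m*n]*[o*p]≡[m*o]*[n*p] c (suc n ^ e) d (suc n ^ f) ⟩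
      c * d * (suc n ^ e * suc n ^ f)      ≡⟨ cong (c * d *_) (^-distribˡ-+-* (suc n) e f) ⟨
      c * d * suc n ^ (e + f)              ∎
    where open ≤-Reasoning
  at-majorant (p ⊚ q) with at-majorant p | at-majorant q
  ... | c , e , p≤ | d , f , q≤ = c * suc d ^ e , f * e , λ n → begin
      p at (q at n)                        ≤⟨ p≤ (q at n) ⟩
      c * suc (q at n) ^ e                 ≤⟨ *-monoʳ-≤ c (^-monoˡ-≤ e (s≤s (q≤ n))) ⟩
      -- The summand 1 is absorbed, as 1 ≤ `suc n ^ f`.
      c * (1 + d * suc n ^ f) ^ e          ≤⟨ *-monoʳ-≤ c
        (^-monoˡ-≤ e (+-monoˡ-≤ (d * suc n ^ f) (m^n>0 (suc n) f))) ⟩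
      c * (suc d * suc n ^ f) ^ e          ≡⟨ cong (c *_) (*-^ (suc d) (suc n ^ f) e) ⟩
      c * (suc d ^ e * (suc n ^ f) ^ e)    ≡⟨ *-assoc c _ _ ⟨
      c * suc d ^ e * (suc n ^ f) ^ e      ≡⟨ cong (c * suc d ^ e *_) (^-*-assoc (suc n) f e) ⟩
      c * suc d ^ e * suc n ^ (f * e)      ∎
    where open ≤-Reasoning

-- Running times of expressions

size : Value → ℕ
size nil        = 1
size (cons a b) = suc (size a + size b)
size (clo _ _)  = 1

pad : ℕ → List Event → List Event
pad zero    t = t
pad (suc k) t = nothing ∷ pad k t

pad-+ : ∀ j k t → pad (j + k) t ≡ pad j (pad k t)
pad-+ zero    k t = refl
pad-+ (suc j) k t = cong (nothing ∷_) (pad-+ j k t)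

reshape : ∀ {s t u} → t ≡ u → s ⇝ t → s ⇝ u
reshape refl h = h

-- Continuation form: any halting computation from the returned value, on any stack, extends
-- backwards by `time` silent transitions. Runs are thus chained without mention of the frames in
-- between.
record Runs {v} (e : Exp v) (ρ : Env v) (a : Value) (b : ℕ) : Set where
  constructor runs-in
  field
    time   : ℕ
    time≤b : time ≤ b
    advance : ∀ {K t} → ret a K ⇝ t → eval e ρ K ⇝ pad time t

open Runs public

runs-≤ : ∀ {v} {e : Exp v} {ρ a b c} → b ≤ c → Runs e ρ a b → Runs e ρ a c
runs-≤ b≤c (runs-in k k≤b r) = runs-in k (≤-trans k≤b b≤c) r

runs-var : ∀ {v} {x} {ρ : Env v} {a} → lookup ρ x ≡ a → Runs (var x) ρ a 1
runs-var refl = runs-in 1 ≤-refl (refl ∷_)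

runs-nil : ∀ {v} {ρ : Env v} → Runs nil ρ nil 1
runs-nil = runs-in 1 ≤-refl (refl ∷_)

runs-cons : ∀ {v} {x y} {ρ : Env v} {a b} → lookup ρ x ≡ a → lookup ρ y ≡ b →
            Runs (cons x y) ρ (cons a b) 1
runs-cons refl refl = runs-in 1 ≤-refl (refl ∷_)

runs-fun : ∀ {v} {e} {ρ : Env v} → Runs (fun e) ρ (clo e ρ) 1
runs-fun = runs-in 1 ≤-refl (refl ∷_)

runs-≡ : ∀ {v} {e : Exp v} {ρ a b c} → a ≡ b → Runs e ρ a c → Runs e ρ b c
runs-≡ refl r = r

-- The 2 counts pushing and popping the frame.
runs-let : ∀ {v} {e₁ e₂} {ρ : Env v} {a b c d} → Runs e₁ ρ a c → Runs e₂ (a Vec.∷ ρ) b d →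
           Runs (let′ e₁ e₂) ρ b (2 + (c + d))
runs-let (runs-in j j≤c r) (runs-in k k≤d s) = runs-in (suc (j + suc k))
  (s≤s (≤-trans (+-mono-≤ j≤c (s≤s k≤d)) (≤-reflexive (+-suc _ _))))
  λ {_} {t} h → refl ∷ reshape (sym (pad-+ j (suc k) t)) (r (refl ∷ s h))

runs-match-nil : ∀ {v} {x e₁ e₂} {ρ : Env v} {b c} → lookup ρ x ≡ nil → Runs e₁ ρ b c →
                 Runs (match x e₁ e₂) ρ b (suc c)
runs-match-nil {x = x} {e₁} {e₂} {ρ} eq (runs-in k k≤c r) = runs-in (suc k) (s≤s k≤c)
  λ {K} h → cong (λ a → match-step a e₁ e₂ ρ K) eq ∷ r h

runs-match-cons : ∀ {v} {x e₁ e₂} {ρ : Env v} {a₁ a₂ b c} → lookup ρ x ≡ cons a₁ a₂ →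
                  Runs e₂ (a₂ Vec.∷ a₁ Vec.∷ ρ) b c → Runs (match x e₁ e₂) ρ b (suc c)
runs-match-cons {x = x} {e₁} {e₂} {ρ} eq (runs-in k k≤c r) = runs-in (suc k) (s≤s k≤c)
  λ {K} h → cong (λ a → match-step a e₁ e₂ ρ K) eq ∷ r h

runs-app : ∀ {v w} {x y} {ρ : Env v} {e} {σ : Env w} {a b c} → lookup ρ x ≡ clo e σ → lookup ρ y ≡ a →
           Runs e (a Vec.∷ clo e σ Vec.∷ σ) b c → Runs (app x y) ρ b (suc c)
runs-app eq₁ eq₂ (runs-in k k≤c r) = runs-in (suc k) (s≤s k≤c)
  λ {K} h → cong₂ (λ a b → app-step a b K) eq₁ eq₂ ∷ r h

-- Typed programs with meanings and bounds

para : ∀ {A B : Set} → (B → List A → A → B) → B → List A → B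
para f z []       = z
para f z (x ∷ xs) = f (para f z xs) xs x

-- A value may range over a type that depends on the instance i : I at hand.
module Computation (I : Set) where

  record Ty : Set₁ where
    field
      El   : I → Set
      code : ∀ i → El i → Value

  open Ty public

  infixr 6 _⊗ₜ_

  anyₜ oneₜ natₜ boolₜ : Ty
  anyₜ  = record { El = λ _ → Value ; code = λ _ a → a }
  oneₜ = record { El = λ _ → ⊤ ; code = λ _ _ → nil }

  list : Ty → Ty
  list τ = record { El = λ i → List (El τ i) ; code = λ i as → codeList (map (code τ i) as) }

  _⊗ₜ_ : Ty → Ty → Ty
  σ ⊗ₜ τ = record { El = λ i → El σ i × El τ i ; code = λ i (a , b) → cons (code σ i a) (code τ i b) }

  natₜ = record { El = λ _ → ℕ ; code = λ _ → codeℕ }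

  boolₜ = record { El = λ _ → Bool ; code = λ { _ true → cons nil nil ; _ false → nil } }

  -- As the one element is represented by the code of f i, programs that read it
  -- denote functions of i alone.
  the : (τ : Ty) → (∀ i → El τ i) → Ty
  the τ f = record { El = λ _ → ⊤ ; code = λ i _ → code τ i (f i) }

  Ctx : Set₁
  Ctx = List Ty

  Args : Ctx → I → Set
  Args []      i = ⊤
  Args (τ ∷ Γ) i = El τ i × Args Γ i

  Loc : Ctx → ℕ → Set
  Loc []      w = ⊤
  Loc (_ ∷ Γ) w = Fin w × Loc Γ w

  Agree : ∀ Γ i → Args Γ i → ∀ {w} → Loc Γ w → Env w → Set
  Agree []      i ρ       r       σ = ⊤
  Agree (τ ∷ Γ) i (a , ρ) (x , r) σ = lookup σ x ≡ code τ i a × Agree Γ i ρ r σ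

  shift : ∀ Γ {w} → Loc Γ w → Loc Γ (suc w)
  shift []      r       = tt
  shift (_ ∷ Γ) (x , r) = suc x , shift Γ r

  agree-shift : ∀ Γ i {ρ w} {r : Loc Γ w} {σ a} → Agree Γ i ρ r σ → Agree Γ i ρ (shift Γ r) (a Vec.∷ σ)
  agree-shift []      i ag       = tt
  agree-shift (τ ∷ Γ) i (eq , ag) = eq , agree-shift Γ i ag

  sizes : ∀ Γ i → Args Γ i → ℕ
  sizes []      i ρ       = 0
  sizes (τ ∷ Γ) i (a , ρ) = size (code τ i a) + sizes Γ i ρ

  -- A program for den is given for every placement of the arguments in an
  -- environment, which makes weakening trivial.
  record Comp (Γ : Ctx) (τ : Ty) : Set₁ where
    field
      den   : ∀ i → Args Γ i → El τ i
      prog  : ∀ {w} → Loc Γ w → Exp w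
      bound : Poly
      -- Not a consequence of the time bound: values are shared, so each `cons x x` doubles the size
      -- in one transition.
      small : ∀ i ρ → size (code τ i (den i ρ)) ≤ bound at sizes Γ i ρ
      runs  : ∀ i ρ {w} (r : Loc Γ w) {σ} → Agree Γ i ρ r σ →
              Runs (prog r) σ (code τ i (den i ρ)) (bound at sizes Γ i ρ)

  open Comp public

  private variable
    Γ       : Ctx
    σ τ υ κ : Ty

  -- A type is only a reading of values. Where two readings have the same code the program is kept,
  -- so such conversions take no time.
  recode : (t : Comp Γ τ) (f : ∀ i → Args Γ i → El υ i) →
           (∀ i ρ → code τ i (den t i ρ) ≡ code υ i (f i ρ)) → Comp Γ υ
  recode t f eq = record
    { den   = f
    ; prog  = prog t
    ; bound = bound t
    ; small = λ i ρ → subst (λ a → size a ≤ _) (eq i ρ) (small t i ρ)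
    ; runs  = λ i ρ r ag → subst (λ a → Runs _ _ a _) (eq i ρ) (runs t i ρ r ag)
    }

  -- Lets later statements speak of the intended function instead of the way the program computes
  -- it.
  override : (t : Comp Γ τ) (f : ∀ i → Args Γ i → El τ i) → (∀ i ρ → den t i ρ ≡ f i ρ) → Comp Γ τ
  override {τ = τ} t f eq = recode t f λ i ρ → cong (code τ i) (eq i ρ)

  v0 : Comp (τ ∷ Γ) τ
  v0 = record
    { den   = λ i → proj₁
    ; prog  = λ r → var (proj₁ r)
    ; bound = con 1 ⊕ X
    ; small = λ i ρ → ≤-trans (m≤m+n _ _) (n≤1+n _)
    ; runs  = λ i ρ r ag → runs-≤ (m≤m+n 1 _) (runs-var (proj₁ ag))
    }

  rename : ∀ {Δ} (f : ∀ i → Args Γ i → Args Δ i) (g : ∀ {w} → Loc Γ w → Loc Δ w) →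
           (∀ i ρ {w} (r : Loc Γ w) {σ} → Agree Γ i ρ r σ → Agree Δ i (f i ρ) (g r) σ) →
           (∀ i ρ → sizes Δ i (f i ρ) ≤ sizes Γ i ρ) → Comp Δ τ → Comp Γ τ
  rename f g agree sizes≤ t = record
    { den   = λ i ρ → den t i (f i ρ)
    ; prog  = λ r → prog t (g r)
    ; bound = bound t
    ; small = λ i ρ → ≤-trans (small t i _) (at-mono (bound t) (sizes≤ i ρ))
    ; runs  = λ i ρ r ag → runs-≤ (at-mono (bound t) (sizes≤ i ρ)) (runs t i _ _ (agree i ρ r ag))
    }

  wk : Comp Γ τ → Comp (σ ∷ Γ) τ
  wk = rename (λ i → proj₂) proj₂ (λ i ρ r → proj₂) λ i ρ → m≤n+m _ _

  wk₁₂ : Comp (σ ∷ Γ) τ → Comp (σ ∷ υ ∷ κ ∷ Γ) τ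
  wk₁₂ {σ = σ} {υ = υ} {κ = κ} = rename (λ i (a , _ , _ , ρ) → a , ρ) (λ (x , _ , _ , r) → x , r)
    (λ i ρ r (e , _ , _ , ag) → e , ag)
    λ i (a , b , c , ρ) → +-monoʳ-≤ (size (code σ i a))
      (≤-trans (m≤n+m _ (size (code κ i c))) (m≤n+m _ (size (code υ i b))))

  letT : Comp Γ σ → Comp (σ ∷ Γ) τ → Comp Γ τ
  letT {Γ} t u = record
    { den   = λ i ρ → den u i (den t i ρ , ρ)
    ; prog  = λ r → let′ (prog t r) (prog u (zero , shift Γ r))
    ; bound = con 2 ⊕ (bound t ⊕ bound u ⊚ (bound t ⊕ X))
    ; small = λ i ρ → ≤-trans (small u i _) (≤-trans (at-mono (bound u) (+-monoˡ-≤ _ (small t i ρ)))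
                        (≤-trans (m≤n+m _ (bound t at sizes Γ i ρ)) (m≤n+m _ 2)))
    ; runs  = λ i ρ r ag → runs-≤
      (+-monoʳ-≤ 2 (+-monoʳ-≤ (bound t at sizes Γ i ρ) (at-mono (bound u) (+-monoˡ-≤ _ (small t i ρ)))))
                (runs-let (runs t i ρ r ag) (runs u i _ _ (refl , agree-shift Γ i ag)))
    }

  nilT : (f : ∀ i → El τ i) → (∀ i → nil ≡ code τ i (f i)) → Comp Γ τ
  nilT {τ} f eq = record
    { den   = λ i _ → f i
    ; prog  = λ r → nil
    ; bound = con 1
    ; small = λ i ρ → ≤-reflexive (cong size (sym (eq i)))
    ; runs  = λ i ρ r ag → subst (λ a → Runs _ _ a _) (eq i) runs-nil
    }

  consV : Comp (υ ∷ σ ∷ Γ) (σ ⊗ₜ υ)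
  consV {υ} {σ} {Γ} = record
    { den   = λ i (b , a , _) → a , b
    ; prog  = λ r → cons (proj₁ (proj₂ r)) (proj₁ r)
    ; bound = con 1 ⊕ X
    ; small = λ i (b , a , _) → s≤s (≤-trans (≤-reflexive (+-comm _ (size (code υ i b))))
      (+-monoʳ-≤ (size (code υ i b)) (m≤m+n _ _)))
    ; runs  = λ i ρ r (e₁ , e₂ , _) → runs-≤ (m≤m+n 1 _) (runs-cons e₂ e₁)
    }

  pairT : Comp Γ σ → Comp Γ τ → Comp Γ (σ ⊗ₜ τ)
  pairT t u = letT t (letT (wk u) consV)

  infixr 5 _∷ₜ_

  _∷ₜ_ : Comp Γ σ → Comp Γ (list σ) → Comp Γ (list σ)
  t ∷ₜ u = recode (pairT t u) (λ i ρ → den t i ρ ∷ den u i ρ) λ _ _ → refl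

  []ₜ : Comp Γ (list σ)
  []ₜ = nilT (λ _ → []) λ _ → refl

  trueT falseT : Comp Γ boolₜ
  falseT = nilT (λ _ → false) λ _ → refl
  trueT  = recode (pairT {σ = oneₜ} {τ = oneₜ} (nilT _ λ _ → refl) (nilT _ λ _ → refl)) (λ _ _ → true) λ _ _ → refl

  -- One treatment of `match` for lists, booleans and pairs: a view tells whether the code is `nil`
  -- or a `cons` of two coded parts.
  View : Ty → Ty → Ty → Set
  View τ σ υ = ∀ i → El τ i → Maybe (El σ i × El υ i)

  codeView : ∀ {σ υ} i → Maybe (El σ i × El υ i) → Value
  codeView             i nothing        = nil
  codeView {σ} {υ} i (just (a , b)) = cons (code σ i a) (code υ i b)

  select : ∀ {A B C : Set} → Maybe (A × B) → C → (A → B → C) → C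
  select nothing        z s = z
  select (just (a , b)) z s = s a b

  module _ (view : View τ σ υ) (ok : ∀ i a → code τ i a ≡ codeView {σ} {υ} i (view i a))
           (t : Comp (υ ∷ σ ∷ τ ∷ Γ) κ) (z : Comp (τ ∷ Γ) κ) where

    private
      den′ : ∀ i → Args (τ ∷ Γ) i → El κ i
      den′ i ρ = select (view i (proj₁ ρ)) (den z i ρ) λ a b → den t i (b , a , ρ)

      bound′ : Poly
      -- The matched value stays in the context, so adding its two parts at most doubles the size.
      bound′ = con 1 ⊕ (bound z ⊕ bound t ⊚ (X ⊕ X))

      view-sizes : ∀ i ρ {a b} → view i (proj₁ ρ) ≡ just (a , b) →
                   sizes (υ ∷ σ ∷ τ ∷ Γ) i (b , a , ρ) ≤ sizes (τ ∷ Γ) i ρ + sizes (τ ∷ Γ) i ρ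
      view-sizes i ρ {a} {b} eq = begin
        size (code υ i b) + (size (code σ i a) + N) ≡⟨ +-assoc (size (code υ i b)) _ N ⟨
        size (code υ i b) + size (code σ i a) + N   ≡⟨ cong (_+ N) (+-comm (size (code υ i b)) _) ⟩
        size (code σ i a) + size (code υ i b) + N   ≤⟨ +-monoˡ-≤ N (n≤1+n (size (code σ i a) + size (code υ i b))) ⟩
        size (cons (code σ i a) (code υ i b)) + N   ≡⟨ cong (λ c → size c + N)
          (trans (ok i (proj₁ ρ)) (cong (codeView {σ} {υ} i) eq)) ⟨
        size (code τ i (proj₁ ρ)) + N               ≤⟨ +-monoˡ-≤ N
          (m≤m+n (size (code τ i (proj₁ ρ))) (sizes Γ i (proj₂ ρ))) ⟩
        N + N                                       ∎
        where open ≤-Reasoning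
              N = sizes (τ ∷ Γ) i ρ

      small′ : ∀ i ρ → size (code κ i (den′ i ρ)) ≤ bound′ at sizes (τ ∷ Γ) i ρ
      small′ i ρ with view i (proj₁ ρ) | view-sizes i ρ
      ... | nothing      | _  = ≤-trans (small z i ρ) (≤-trans (m≤m+n _ _) (n≤1+n _))
      ... | just (a , b) | le = ≤-trans (small t i _) (≤-trans (at-mono (bound t) (le refl))
          (≤-trans (m≤n+m _ _) (n≤1+n _)))

      runs′ : ∀ i ρ {w} (r : Loc (τ ∷ Γ) w) {σ} → Agree (τ ∷ Γ) i ρ r σ →
              Runs (match (proj₁ r) (prog z r) (prog t (zero , suc zero , shift (τ ∷ Γ) (shift (τ ∷ Γ) r))))
                   σ (code κ i (den′ i ρ)) (bound′ at sizes (τ ∷ Γ) i ρ)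
      runs′ i ρ r ag with view i (proj₁ ρ) | view-sizes i ρ | ok i (proj₁ ρ)
      ... | nothing      | _  | eq = runs-≤ (s≤s (m≤m+n _ _)) (runs-match-nil (trans (proj₁ ag) eq) (runs z i ρ r ag))
      ... | just (a , b) | le | eq = runs-≤ (s≤s (≤-trans (at-mono (bound t) (le refl)) (m≤n+m _ _)))
        (runs-match-cons (trans (proj₁ ag) eq)
          (runs t i _ _ (refl , refl , agree-shift (τ ∷ Γ) i {r = shift (τ ∷ Γ) r}
            (agree-shift (τ ∷ Γ) i {r = r} ag))))

    matchV : Comp (τ ∷ Γ) κ
    matchV = record { den = den′ ; prog = _ ; bound = bound′ ; small = small′ ; runs = runs′ }

  matchT : (view : View τ σ υ) (ok : ∀ i a → code τ i a ≡ codeView {σ} {υ} i (view i a)) →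
           Comp Γ τ → Comp Γ κ → Comp (υ ∷ σ ∷ τ ∷ Γ) κ → Comp Γ κ
  matchT view ok t z s = letT t (matchV view ok s (wk z))

  caseT : Comp Γ (list σ) → Comp Γ κ → Comp (list σ ∷ σ ∷ list σ ∷ Γ) κ → Comp Γ κ
  caseT {σ = σ} = matchT (λ i → λ { [] → nothing ; (a ∷ as) → just (a , as) }) λ { i [] → refl ; i (a ∷ as) → refl }

  ifT : Comp Γ boolₜ → Comp Γ κ → Comp Γ κ → Comp Γ κ
  ifT b t u = matchT {σ = oneₜ} {υ = oneₜ} (λ i → λ { true → just (tt , tt) ; false → nothing })
    (λ { i true → refl ; i false → refl }) b u (wk (wk (wk t)))

  -- The `nil` branch is never taken but needs a result, and `σ` may have no element; hence the
  -- detour through `anyₜ`.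
  fstT : Comp Γ (σ ⊗ₜ τ) → Comp Γ σ
  fstT {σ = σ} {τ} t = recode (matchT {κ = anyₜ} (λ i → just) (λ _ _ → refl) t (nilT _ λ _ → refl)
    (recode (wk v0) (λ i ρ → code σ i (proj₁ (proj₂ ρ))) λ _ _ → refl)) (λ i ρ → proj₁ (den t i ρ)) λ _ _ → refl

  sndT : Comp Γ (σ ⊗ₜ τ) → Comp Γ τ
  sndT {σ = σ} {τ} t = recode (matchT {κ = anyₜ} (λ i → just) (λ _ _ → refl) t (nilT _ λ _ → refl)
    (recode v0 (λ i ρ → code τ i (proj₁ ρ)) λ _ _ → refl)) (λ i ρ → proj₂ (den t i ρ)) λ _ _ → refl

  theT : ∀ {f} → Comp Γ (the τ f) → Comp Γ τ
  theT {f = f} t = recode t (λ i _ → f i) λ _ _ → refl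

  -- Q bounds the growth of the accumulator in one step, so that the sizes of
  -- all accumulators are polynomially bounded.
  module _ (s : Comp (τ ∷ list σ ∷ σ ∷ Γ) τ) (Q : Poly)
           (grow : ∀ i ρ acc as a → size (code τ i (den s i (acc , as , a , ρ))) ≤
                                    size (code τ i acc) + Q at sizes (list σ ∷ σ ∷ Γ) i (as , a , ρ)) where

    private
      foldBody : ∀ {w} → Loc Γ w → Exp (4 + w)
      -- Here 0 is the remaining list, 1 the function, 2 the start value and 3 the whole list. The
      -- `match` adds tail and head, the `let′` the accumulator, which makes seven shifts for `Γ`.
      foldBody r = match zero (var (suc (suc zero))) (let′ (app (suc (suc (suc zero))) zero)
        (prog s (zero , suc zero , suc (suc zero) , shift Γ
          (shift Γ (shift Γ (shift Γ (shift Γ (shift Γ (shift Γ r)))))))))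

      module _ (i : I) (ρ : Args Γ i) (z : El τ i) (S : ℕ) where

        N q W b : ℕ
        N = sizes Γ i ρ
        q = Q at (S + N)
        W = size (code τ i z) + S * q
        b = bound s at (W + (S + N))

        result : List (El σ i) → El τ i
        result = para (λ acc as a → den s i (acc , as , a , ρ)) z

        ∣_∣ : List (El σ i) → ℕ
        ∣ as ∣ = size (code (list σ) i as)

        entry≤ : ∀ a as → ∣ a ∷ as ∣ ≤ S → sizes (list σ ∷ σ ∷ Γ) i (as , a , ρ) ≤ S + N
        entry≤ a as le = ≤-trans (≤-reflexive (sym (+-assoc ∣ as ∣ _ N)))
          (+-monoˡ-≤ N (≤-trans (≤-reflexive (+-comm ∣ as ∣ (size (code σ i a)))) (≤-trans (n≤1+n _) le)))

        tail≤ : ∀ a as → ∣ a ∷ as ∣ ≤ S → ∣ as ∣ ≤ S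
        tail≤ a as le = ≤-trans (m≤n+m _ (size (code σ i a))) (≤-trans (n≤1+n _) le)

        -- The size of the list also bounds the number of steps, each of which adds at most `q`.
        result≤ : ∀ as → ∣ as ∣ ≤ S → size (code τ i (result as)) ≤ size (code τ i z) + ∣ as ∣ * q
        result≤ []       le = m≤m+n _ _
        result≤ (a ∷ as) le = begin
          size (code τ i (result (a ∷ as)))     ≤⟨ grow i ρ _ as a ⟩
          size (code τ i (result as)) + _       ≤⟨ +-mono-≤ (result≤ as (tail≤ a as le))
            (at-mono Q (entry≤ a as le)) ⟩
          size (code τ i z) + ∣ as ∣ * q + q    ≡⟨ trans (+-assoc (size (code τ i z)) _ q)
            (cong (size (code τ i z) +_) (+-comm _ q)) ⟩
          size (code τ i z) + suc ∣ as ∣ * q    ≤⟨ +-monoʳ-≤ (size (code τ i z))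
            (*-monoˡ-≤ q (s≤s (m≤n+m ∣ as ∣ (size (code σ i a))))) ⟩
          size (code τ i z) + ∣ a ∷ as ∣ * q    ∎
          where open ≤-Reasoning

        result≤W : ∀ as → ∣ as ∣ ≤ S → size (code τ i (result as)) ≤ W
        result≤W as le = ≤-trans (result≤ as le) (+-monoʳ-≤ _ (*-monoˡ-≤ q le))

        -- Besides the step itself an element costs 4 transitions: `match`, `app` and two for
        -- `let′`. The end of the list costs 2.
        body-runs : ∀ {w} {r : Loc Γ w} {env c} → Agree Γ i ρ r env → ∀ as → ∣ as ∣ ≤ S →
          let e = clo (foldBody r) (code τ i z Vec.∷ c Vec.∷ env) in
          Runs (foldBody r) (code (list σ) i as Vec.∷ e Vec.∷ code τ i z Vec.∷ c Vec.∷ env)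
               (code τ i (result as)) (2 + ∣ as ∣ * (4 + b))
        body-runs ag []       le = runs-≤ (s≤s (s≤s z≤n)) (runs-match-nil refl (runs-var refl))
        body-runs ag (a ∷ as) le = runs-≤ bound≤ (runs-match-cons refl (runs-let
          (runs-app refl refl (body-runs ag as (tail≤ a as le)))
          (runs-≤ (at-mono (bound s) (+-mono-≤ (result≤W as (tail≤ a as le)) (entry≤ a as le)))
            (runs s i (result as , as , a , ρ) _ (refl , refl , refl ,
              agree-shift Γ i (agree-shift Γ i (agree-shift Γ i
                (agree-shift Γ i (agree-shift Γ i (agree-shift Γ i (agree-shift Γ i ag)))))))))))
          where
          bound≤ : suc (2 + (suc (2 + ∣ as ∣ * (4 + b)) + b)) ≤ 2 + ∣ a ∷ as ∣ * (4 + b)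
          bound≤ = begin
            suc (2 + (suc (2 + ∣ as ∣ * (4 + b)) + b)) ≡⟨ solve-∀′ (∣ as ∣) b ⟩
            2 + (suc ∣ as ∣) * (4 + b)                  ≤⟨ +-monoʳ-≤ 2
              (*-monoˡ-≤ (4 + b) (s≤s (m≤n+m ∣ as ∣ (size (code σ i a))))) ⟩
            2 + ∣ a ∷ as ∣ * (4 + b)                    ∎
            where
            open ≤-Reasoning
            solve-∀′ : ∀ l b → suc (2 + (suc (2 + l * (4 + b)) + b)) ≡ 2 + suc l * (4 + b)
            solve-∀′ = solve-∀

      W-poly : Poly → Poly → Poly
      W-poly T Z = Z ⊕ T ⊗ Q ⊚ (T ⊕ X)

    foldT : Comp Γ (list σ) → Comp Γ τ → Comp Γ τ
    foldT t z = record
      { den   = λ i ρ → result i ρ (den z i ρ) 0 (den t i ρ)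
      ; prog  = λ r → let′ (prog t r) (let′ (prog z (shift Γ r))
                            (let′ (fun (foldBody r)) (app zero (suc (suc zero)))))
      ; bound = time-poly ⊕ W-poly T Z
      ; small = λ i ρ → ≤-trans (result≤W i ρ (den z i ρ) (T at sizes Γ i ρ) (den t i ρ) (small t i ρ))
                  (≤-trans (+-monoˡ-≤ _ (small z i ρ)) (m≤n+m _ (time-poly at sizes Γ i ρ)))
      ; runs  = λ i ρ r ag → runs-≤ (≤-trans (time≤ i ρ) (m≤m+n _ _))
                  (runs-let (runs t i ρ r ag) (runs-let (runs z i ρ _ (agree-shift Γ i ag)) (runs-let
                    runs-fun
                    (runs-app refl refl (body-runs i ρ (den z i ρ) (T at sizes Γ i ρ) ag (den t i ρ)
                      (small t i ρ))))))
      }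
      where
      T Z time-poly : Poly
      T = bound t
      Z = bound z
      time-poly = con 10 ⊕ (T ⊕ (Z ⊕ T ⊗ (con 4 ⊕ bound s ⊚ (W-poly T Z ⊕ (T ⊕ X)))))
      time≤ : ∀ i ρ → 2 + (T at sizes Γ i ρ + (2 + (Z at sizes Γ i ρ + (2 + (1 + suc (2 +
                 ∣_∣ i ρ (den z i ρ) (T at sizes Γ i ρ) (den t i ρ) *
                   (4 + b i ρ (den z i ρ) (T at sizes Γ i ρ)))))))) ≤
              time-poly at sizes Γ i ρ
      time≤ i ρ = ≤-trans (≤-reflexive (arith (T at sizes Γ i ρ) (Z at sizes Γ i ρ) _))
        (+-monoʳ-≤ 10 (+-monoʳ-≤ (T at sizes Γ i ρ) (+-monoʳ-≤ (Z at sizes Γ i ρ)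
          (*-mono-≤ (small t i ρ) (+-monoʳ-≤ 4 (at-mono (bound s) (+-monoˡ-≤ _ (+-monoˡ-≤ _ (small z i ρ)))))))))
        where
        arith : ∀ t z u → 2 + (t + (2 + (z + (2 + (1 + suc (2 + u)))))) ≡ 10 + (t + (z + u))
        arith = solve-∀

-- Programs for list functions

iter : ∀ {A : Set} → (A → A) → A → ℕ → A
iter f z zero    = z
iter f z (suc n) = f (iter f z n)

drop-suc : ∀ {A : Set} n (xs : List A) → drop 1 (drop n xs) ≡ drop (suc n) xs
drop-suc zero    []       = refl
drop-suc zero    (x ∷ xs) = refl
drop-suc (suc n) []       = refl
drop-suc (suc n) (x ∷ xs) = drop-suc n xs

iter-tail : ∀ {A : Set} (xs : List A) n → iter (drop 1) xs n ≡ drop n xs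
iter-tail xs zero    = refl
iter-tail xs (suc n) = trans (cong (drop 1) (iter-tail xs n)) (drop-suc n xs)

head₀ : List Value → Value
head₀ []      = nil
head₀ (a ∷ _) = a

head₀-drop : ∀ {A : Set} {k} (c : A → Value) (v : Vec A k) i →
             head₀ (drop (toℕ i) (map c (Vec.toList v))) ≡ c (Vec.lookup v i)
head₀-drop c (a Vec.∷ v) zero    = refl
head₀-drop c (a Vec.∷ v) (suc i) = head₀-drop c v i

prepend : ∀ {A : Set} {j} → List A → List (Vec A j) → List (Vec A (suc j))
prepend xs vs = concatMap (λ v → map (Vec._∷ v) xs) vs

vectors : ∀ {A : Set} → List A → ∀ k → List (Vec A k)
vectors xs zero    = Vec.[] ∷ []
vectors xs (suc k) = prepend xs (vectors xs k)

-- Idle once the counter is 0: the program performs a constant number of rounds, while the length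
-- varies with the instance.
vectorsStep : ∀ {A : Set} → List A → ℕ × List (List A) → ℕ × List (List A)
vectorsStep xs (zero  , vs) = zero , vs
vectorsStep xs (suc k , vs) = k , concatMap (λ v → map (_∷ v) xs) vs

repeatedly : ∀ {A : Set} → ℕ → (A → A) → A → A
repeatedly zero    f a = a
repeatedly (suc n) f a = repeatedly n f (f a)

repeatedly-fixed : ∀ {A : Set} n {f : A → A} {a} → f a ≡ a → repeatedly n f a ≡ a
repeatedly-fixed zero    eq = refl
repeatedly-fixed (suc n) {f} eq = trans (cong (repeatedly n f) eq) (repeatedly-fixed n eq)

repeatedly-cong : ∀ {A : Set} n {f g : A → A} → (∀ a → f a ≡ g a) → ∀ a → repeatedly n f a ≡ repeatedly n g a
repeatedly-cong zero    eq a = refl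
repeatedly-cong (suc n) {f} {g} eq a = trans (cong (repeatedly n f) (eq a)) (repeatedly-cong n eq (g a))

toList-vectors : ∀ {A : Set} (xs : List A) k →
  map Vec.toList (vectors xs (suc k)) ≡ concatMap (λ v → map (_∷ v) xs) (map Vec.toList (vectors xs k))
toList-vectors xs k = begin
  map Vec.toList (concatMap (λ v → map (Vec._∷ v) xs) (vectors xs k))
    ≡⟨ map-concatMap Vec.toList _ (vectors xs k) ⟩
  concatMap (λ v → map Vec.toList (map (Vec._∷ v) xs)) (vectors xs k)
    ≡⟨ concatMap-cong (λ v → sym (map-∘ xs)) (vectors xs k) ⟩
  concatMap (λ v → map (_∷ Vec.toList v) xs) (vectors xs k)
    ≡⟨ concatMap-map (λ v → map (_∷ v) xs) Vec.toList (vectors xs k) ⟨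
  concatMap (λ v → map (_∷ v) xs) (map Vec.toList (vectors xs k)) ∎
  where open ≡-Reasoning

repeatedly-vectors : ∀ {A : Set} (xs : List A) c j k → k ≤ c →
  repeatedly c (vectorsStep xs) (k , map Vec.toList (vectors xs j)) ≡ (0 , map Vec.toList (vectors xs (k + j)))
repeatedly-vectors xs c       j zero    le = repeatedly-fixed c refl
repeatedly-vectors xs (suc c) j (suc k) (s≤s le) = trans
  (cong (λ vs → repeatedly c (vectorsStep xs) (k , vs)) (sym (toList-vectors xs j)))
  (trans (repeatedly-vectors xs c (suc j) k le) (cong (λ l → 0 , map Vec.toList (vectors xs l)) (+-suc k j)))

concatMap-if : ∀ {A : Set} {P : A → Set} (P? : ∀ a → Dec (P a)) (b : A → Bool) → (∀ a → b a ≡ does (P? a)) →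
               ∀ xs → concatMap (λ a → if b a then a ∷ [] else []) xs ≡ filter P? xs
concatMap-if P? b eq []       = refl
concatMap-if P? b eq (x ∷ xs) rewrite eq x with does (P? x)
... | true  = cong (x ∷_) (concatMap-if P? b eq xs)
... | false = concatMap-if P? b eq xs

lookup-ext : ∀ {A : Set} {k} {u v : Vec A k} → (∀ i → Vec.lookup u i ≡ Vec.lookup v i) → u ≡ v
lookup-ext {u = u} {v} eq = trans (sym (Vec.tabulate∘lookup u)) (trans (Vec.tabulate-cong eq) (Vec.tabulate∘lookup v))

module Combinators (I : Set) where
  open Computation I public

  private variable
    Γ       : Ctx
    σ τ υ κ : Ty
    k l     : I → ℕ

  v1 : Comp (σ ∷ τ ∷ Γ) τ
  v1 = wk v0

  v2 : Comp (σ ∷ υ ∷ τ ∷ Γ) τ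
  v2 = wk v1

  v3 : Comp (κ ∷ σ ∷ υ ∷ τ ∷ Γ) τ
  v3 = wk v2

  fin : (I → ℕ) → Ty
  fin k = record { El = λ i → Fin (k i) ; code = λ _ a → codeℕ (toℕ a) }

  vec : (I → ℕ) → Ty → Ty
  vec k τ = record { El = λ i → Vec (El τ i) (k i) ; code = λ i v → code (list τ) i (Vec.toList v) }

  size-++ : ∀ {A : Set} (c : A → Value) xs ys →
            size (codeList (map c (xs ++ ys))) ≤ size (codeList (map c ys)) + size (codeList (map c xs))
  size-++ c []       ys = m≤m+n _ _
  size-++ c (x ∷ xs) ys = ≤-trans (s≤s (+-monoʳ-≤ (size (c x)) (size-++ c xs ys)))
    (≤-reflexive (trans (cong suc (trans (sym (+-assoc (size (c x)) Y S))
      (trans (cong (_+ S) (+-comm (size (c x)) Y)) (+-assoc Y _ S))))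
                 (sym (+-suc Y (size (c x) + S)))))
    where Y = size (codeList (map c ys))
          S = size (codeList (map c xs))

  iteT : Comp Γ boolₜ → Comp Γ κ → Comp Γ κ → Comp Γ κ
  iteT b t u = override (ifT b t u) (λ i ρ → if den b i ρ then den t i ρ else den u i ρ) eq
    where
    eq : ∀ i ρ → den (ifT b t u) i ρ ≡ (if den b i ρ then den t i ρ else den u i ρ)
    eq i ρ with den b i ρ
    ... | true  = refl
    ... | false = refl

  infixr 5 _++ₜ_

  _++ₜ_ : Comp Γ (list σ) → Comp Γ (list σ) → Comp Γ (list σ)
  _++ₜ_ {σ = σ} t u = override (foldT (v2 ∷ₜ v0) (con 1 ⊕ X) grow t u) (λ i ρ → den t i ρ ++ den u i ρ) λ i ρ →
    eq (den t i ρ)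
    where
    grow : ∀ i ρ (acc as : List (El σ i)) a → _
    grow i ρ acc as a = ≤-trans (≤-reflexive (trans (cong suc (+-comm (size (code σ i a)) A)) (sym (+-suc A _))))
      (+-monoʳ-≤ A (s≤s (≤-trans (m≤m+n (size (code σ i a)) _) (m≤n+m _ (size (code (list σ) i as))))))
      where A = size (code (list σ) i acc)
    eq : ∀ {A : Set} (xs : List A) {ys} → para (λ acc _ a → a ∷ acc) ys xs ≡ xs ++ ys
    eq []       = refl
    eq (x ∷ xs) = cong (x ∷_) (eq xs)

  forT : Comp Γ (list σ) → Comp (σ ∷ Γ) (list τ) → Comp Γ (list τ)
  forT {Γ} {σ} {τ} t s = override (foldT (wk (wk s) ++ₜ v0) (bound s) grow t []ₜ)
    (λ i ρ → concatMap (λ a → den s i (a , ρ)) (den t i ρ)) λ i ρ → eq (λ a → den s i (a , ρ)) (den t i ρ)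
    where
    grow : ∀ i ρ acc (as : List (El σ i)) a → size (code (list τ) i (den s i (a , ρ) ++ acc)) ≤
             size (code (list τ) i acc) + bound s at sizes (list σ ∷ σ ∷ Γ) i (as , a , ρ)
    grow i ρ acc as a = ≤-trans (size-++ (code τ i) (den s i (a , ρ)) acc)
      (+-monoʳ-≤ _ (≤-trans (small s i (a , ρ)) (at-mono (bound s) (m≤n+m _ (size (code (list σ) i as))))))
    eq : ∀ {A B : Set} (f : A → List B) xs → para (λ acc _ a → f a ++ acc) [] xs ≡ concatMap f xs
    eq f []       = refl
    eq f (x ∷ xs) = cong (f x ++_) (eq f xs)

  mapT : Comp Γ (list σ) → Comp (σ ∷ Γ) τ → Comp Γ (list τ)
  mapT t s = override (forT t (s ∷ₜ []ₜ)) (λ i ρ → map (λ a → den s i (a , ρ)) (den t i ρ))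
    λ i ρ → eq (λ a → den s i (a , ρ)) (den t i ρ)
    where
    eq : ∀ {A B : Set} (f : A → B) xs → concatMap (λ a → f a ∷ []) xs ≡ map f xs
    eq f []       = refl
    eq f (x ∷ xs) = cong (f x ∷_) (eq f xs)

  -- As a value a unary numeral already is a list of `nil`s, so folding over lists also gives
  -- recursion on numbers.
  natList : Comp Γ natₜ → Comp Γ (list oneₜ)
  natList t = recode t (λ i ρ → replicate (den t i ρ) tt) λ i ρ → eq i (den t i ρ)
    where
    eq : ∀ i n → codeℕ n ≡ code (list oneₜ) i (replicate n tt)
    eq i zero    = refl
    eq i (suc n) = cong (cons nil) (eq i n)

  lengthT : Comp Γ (list oneₜ) → Comp Γ natₜ
  lengthT t = recode t (λ i ρ → length (den t i ρ)) λ i ρ → eq i (den t i ρ)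
    where
    eq : ∀ i l → code (list oneₜ) i l ≡ codeℕ (length l)
    eq i []      = refl
    eq i (_ ∷ l) = cong (cons nil) (eq i l)

  sucT : Comp Γ natₜ → Comp Γ natₜ
  sucT t = override (lengthT (nilT (λ _ → tt) (λ _ → refl) ∷ₜ natList t)) (λ i ρ → suc (den t i ρ))
    λ i ρ → cong suc (length-replicate (den t i ρ))

  -- The number of rounds depends on the input. Since no round enlarges the state, its size stays
  -- bounded throughout.
  iterT : (s : Comp (τ ∷ Γ) τ) → (∀ i ρ a → size (code τ i (den s i (a , ρ))) ≤ size (code τ i a)) →
          Comp Γ natₜ → Comp Γ τ → Comp Γ τ
  iterT s shrink n z = override (foldT (wk₁₂ s) (con 0) (λ i ρ a _ _ → ≤-trans (shrink i ρ a) (m≤m+n _ 0))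
    (natList n) z)
    (λ i ρ → iter (λ a → den s i (a , ρ)) (den z i ρ) (den n i ρ)) λ i ρ → eq (λ a → den s i (a , ρ)) (den n i ρ)
    where
    eq : ∀ {A : Set} f {z : A} n → para (λ acc _ _ → f acc) z (replicate n tt) ≡ iter f z n
    eq f zero    = refl
    eq f (suc n) = cong f (eq f n)

  dropT : Comp Γ natₜ → Comp Γ (list σ) → Comp Γ (list σ)
  dropT {σ = σ} n t = override (iterT tailT shrink n t) (λ i ρ → drop (den n i ρ) (den t i ρ))
    λ i ρ → iter-tail (den t i ρ) (den n i ρ)
    where
    tailT : ∀ {Γ} → Comp (list σ ∷ Γ) (list σ)
    tailT = override (caseT v0 []ₜ v0) (λ i ρ → drop 1 (proj₁ ρ)) λ { i ([] , _) → refl ; i (_ ∷ _ , _) → refl }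
    shrink : ∀ i ρ as → size (code (list σ) i (drop 1 as)) ≤ size (code (list σ) i as)
    shrink i ρ []       = ≤-refl
    shrink i ρ (a ∷ as) = ≤-trans (m≤n+m _ _) (n≤1+n _)

  nullT : Comp Γ (list σ) → Comp Γ boolₜ
  nullT t = override (caseT t trueT falseT) (λ i ρ → null (den t i ρ)) λ i ρ → eq i ρ
    where
    eq : ∀ i ρ → den (caseT t trueT falseT) i ρ ≡ null (den t i ρ)
    eq i ρ with den t i ρ
    ... | []    = refl
    ... | _ ∷ _ = refl

  monusT : Comp Γ natₜ → Comp Γ natₜ → Comp Γ natₜ
  monusT t u = override (lengthT (dropT u (natList t))) (λ i ρ → den t i ρ ∸ den u i ρ)
    λ i ρ → trans (length-drop (den u i ρ) (replicate (den t i ρ) tt))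
      (cong (_∸ den u i ρ) (length-replicate (den t i ρ)))

  size-codeℕ : ∀ n → size (codeℕ n) ≡ suc (n + n)
  size-codeℕ zero    = refl
  size-codeℕ (suc n) = cong (λ l → suc (suc l)) (trans (size-codeℕ n) (sym (+-suc n n)))

  -- The fold also sees the tail, whose length `l` reveals the position: the entry there is
  -- `t ∸ suc l`.
  upToT : Comp Γ natₜ → Comp Γ (list natₜ)
  upToT {Γ} t = override (foldT (monusT (wk (wk (wk t))) (sucT (lengthT v1)) ∷ₜ v0) (con 1 ⊕ bound t) grow
    (natList t) []ₜ)
    (λ i ρ → upTo (den t i ρ)) λ i ρ → trans (eq (den t i ρ) (den t i ρ) ≤-refl)
      (cong (λ d → applyUpTo (d +_) (den t i ρ)) (n∸n≡0 (den t i ρ)))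
    where
    grow : ∀ i ρ (acc : List ℕ) (as : List ⊤) (a : ⊤) → _
    grow i ρ acc as a = ≤-trans (≤-reflexive (trans (cong suc (+-comm _ A)) (sym (+-suc A _)))) (+-monoʳ-≤ A (s≤s
      (≤-trans (subst₂ _≤_ (sym (size-codeℕ (den t i ρ ∸ suc (length as)))) (sym (size-codeℕ (den t i ρ)))
                  (s≤s (+-mono-≤ (m∸n≤m (den t i ρ) (suc (length as))) (m∸n≤m (den t i ρ) (suc (length as))))))
               (≤-trans (small t i ρ)
                 (at-mono (bound t) (≤-trans (m≤n+m _ 1) (m≤n+m _ (size (code (list oneₜ) i as)))))))))
      where A = size (code (list natₜ) i acc)
    eq : ∀ m j → j ≤ m → para (λ acc as _ → (m ∸ suc (length as)) ∷ acc) [] (replicate j tt) ≡ applyUpTo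
      ((m ∸ j) +_) j
    eq m zero    le = refl
    eq m (suc j) le = cong₂ _∷_ (trans (cong (λ l → m ∸ suc l) (length-replicate j)) (sym (+-identityʳ (m ∸ suc j))))
      (trans (eq m j (<⇒≤ le)) (applyUpTo-cong j λ x → trans (cong (_+ x) (+-∸-assoc 1 le))
        (sym (+-suc (m ∸ suc j) x))))
      where
      applyUpTo-cong : ∀ {f g : ℕ → ℕ} n → (∀ x → f x ≡ g x) → applyUpTo f n ≡ applyUpTo g n
      applyUpTo-cong zero    eq = refl
      applyUpTo-cong (suc n) eq = cong₂ _∷_ (eq 0) (applyUpTo-cong n (eq ∘ suc))

  tabulate-toℕ : ∀ {f : ℕ → ℕ} n → applyUpTo f n ≡ List.tabulate {n = n} (f ∘ toℕ)
  tabulate-toℕ zero    = refl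
  tabulate-toℕ (suc n) = cong (_ ∷_) (tabulate-toℕ n)

  allFinT : (t : Comp Γ natₜ) → (∀ i ρ → den t i ρ ≡ k i) → Comp Γ (list (fin k))
  allFinT {k = k} t eq = recode (upToT t) (λ i ρ → List.allFin (k i)) λ i ρ → cong codeList (trans
    (cong (map codeℕ) (trans (cong upTo (eq i ρ)) (trans (tabulate-toℕ (k i)) (sym (map-tabulate id toℕ)))))
      (sym (map-∘ (List.allFin (k i)))))

  recodeList : Comp Γ (list σ) → Comp Γ (list anyₜ)
  recodeList {σ = σ} t = recode t (λ i ρ → map (code σ i) (den t i ρ)) λ i ρ → cong codeList
    (sym (map-id (map (code σ i) (den t i ρ))))

  head₀T : Comp Γ (list anyₜ) → Comp Γ anyₜ
  head₀T t = override (caseT t (nilT (λ _ → nil) λ _ → refl) v1) (λ i ρ → head₀ (den t i ρ)) eq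
    where
    eq : ∀ i ρ → den (caseT t (nilT (λ _ → nil) λ _ → refl) v1) i ρ ≡ head₀ (den t i ρ)
    eq i ρ with den t i ρ
    ... | []    = refl
    ... | _ ∷ _ = refl

  headT : (t : Comp Γ (list σ)) (f : ∀ i → Args Γ i → El σ i) → (∀ i ρ → ∃[ as ] den t i ρ ≡ f i ρ ∷ as) → Comp Γ σ
  headT {σ = σ} t f eq = recode (head₀T (recodeList t)) f λ i ρ → cong (λ as → head₀ (map (code σ i) as))
    (proj₂ (eq i ρ))

  toListT : Comp Γ (vec k τ) → Comp Γ (list τ)
  toListT t = recode t (λ i ρ → Vec.toList (den t i ρ)) λ _ _ → refl

  toℕT : Comp Γ (fin k) → Comp Γ natₜ
  toℕT t = recode t (λ i ρ → toℕ (den t i ρ)) λ _ _ → refl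

  lookupT : Comp Γ (vec k τ) → Comp Γ (fin k) → Comp Γ τ
  lookupT {τ = τ} t n = recode (head₀T (dropT (toℕT n) (recodeList (toListT t))))
    (λ i ρ → Vec.lookup (den t i ρ) (den n i ρ)) λ i ρ → head₀-drop (code τ i) (den t i ρ) (den n i ρ)

  mapVecT : Comp Γ (vec k σ) → Comp (σ ∷ Γ) τ → Comp Γ (vec k τ)
  mapVecT {τ = τ} t s = recode (mapT (toListT t) s) (λ i ρ → Vec.map (λ a → den s i (a , ρ)) (den t i ρ))
    λ i ρ → cong (code (list τ) i) (sym (Vec.toList-map _ (den t i ρ)))

  lenT : Comp Γ (list σ) → Comp Γ natₜ
  lenT t = override (lengthT (mapT t (nilT (λ _ → tt) λ _ → refl))) (λ i ρ → length (den t i ρ)) λ i ρ →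
    length-map _ (den t i ρ)

  indicesT : Comp Γ (vec k τ) → Comp Γ (list (fin k))
  indicesT t = allFinT (lenT (toListT t)) λ i ρ → Vec.length-toList (den t i ρ)

  -- The count is a constant of the program, and the rounds become nested `let′`s. Each round may
  -- enlarge the state polynomially, since finitely many polynomials are composed.
  repeatT : ℕ → Comp (τ ∷ Γ) τ → Comp Γ τ → Comp Γ τ
  repeatT {τ} {Γ} n s t = override (go n t) (λ i ρ → repeatedly n (λ a → den s i (a , ρ)) (den t i ρ)) λ i → eq n i t
    where
    go : ℕ → Comp Γ τ → Comp Γ τ
    go zero    t = t
    go (suc n) t = go n (letT t s)
    eq : ∀ n i t ρ → den (go n t) i ρ ≡ repeatedly n (λ a → den s i (a , ρ)) (den t i ρ)
    eq zero    i t ρ = refl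
    eq (suc n) i t ρ = eq n i (letT t s) ρ

  vectorsT : (c : ℕ) (xs : Comp Γ (list σ)) (n : Comp Γ natₜ) →
             (∀ i ρ → den n i ρ ≡ k i) → (∀ i → k i ≤ c) → Comp Γ (list (vec k σ))
  vectorsT {Γ} {σ} {k} c xs n eq k≤c = recode allVectors (λ i ρ → vectors (den xs i ρ) (k i)) λ i ρ → cong codeList
    (trans (cong (map (code (list σ) i)) (eq′ i ρ)) (sym (map-∘ (vectors (den xs i ρ) (k i)))))
    where
    round : Comp (natₜ ⊗ₜ list (list σ) ∷ Γ) (natₜ ⊗ₜ list (list σ))
    round = override (caseT (natList (fstT v0)) v0
        (pairT (lengthT v0) (forT (sndT v3) (mapT (wk (wk (wk (wk (wk xs))))) (v0 ∷ₜ v1)))))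
      (λ i (s , ρ) → vectorsStep (den xs i ρ) s)
      λ { i ((zero , vs) , ρ) → refl
        ; i ((suc n , vs) , ρ) → cong (_, concatMap (λ v → map (_∷ v) (den xs i ρ)) vs) (length-replicate n) }
    allVectors : Comp Γ (list (list σ))
    allVectors = sndT (repeatT c round (pairT n ([]ₜ ∷ₜ []ₜ)))
    eq′ : ∀ i ρ → den allVectors i ρ ≡ map Vec.toList (vectors (den xs i ρ) (k i))
    eq′ i ρ = cong proj₂ (trans (cong (λ l → repeatedly c (vectorsStep (den xs i ρ)) (l , [] ∷ [])) (eq i ρ))
      (trans (repeatedly-vectors (den xs i ρ) c 0 (k i) (k≤c i))
             (cong (λ l → 0 , map Vec.toList (vectors (den xs i ρ) l)) (+-identityʳ (k i)))))

  -- Programs that decide properties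

  Property : Ctx → Set₁
  Property Γ = ∀ i → Args Γ i → Set

  -- The property is kept apart from the test, so that it can be exchanged for an equivalent one
  -- while the program stays the same.
  record Decides (Γ : Ctx) (P : Property Γ) : Set₁ where
    field
      test     : Comp Γ boolₜ
      reflects : ∀ i ρ → Reflects (P i ρ) (den test i ρ)

    decide : ∀ i ρ → Dec (P i ρ)
    decide i ρ = den test i ρ because reflects i ρ

  open Decides public

  decidesBy : {P : Property Γ} (t : Comp Γ boolₜ) (d : ∀ i ρ → Dec (P i ρ)) →
    (∀ i ρ → den t i ρ ≡ does (d i ρ)) → Decides Γ P
  decidesBy t d eq = record { test = t ; reflects = λ i ρ → subst (Reflects _) (sym (eq i ρ)) (proof (d i ρ)) }

  mapD : {P Q : Property Γ} → (∀ i ρ → P i ρ → Q i ρ) → (∀ i ρ → Q i ρ → P i ρ) → Decides Γ P → Decides Γ Q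
  mapD f g D = decidesBy (test D) (λ i ρ → map′ (f i ρ) (g i ρ) (decide D i ρ)) λ _ _ → refl

  nullD : (t : Comp Γ (list σ)) → Decides Γ (λ i ρ → den t i ρ ≡ [])
  nullD t = decidesBy (nullT t) (λ i ρ → null? (den t i ρ)) λ i ρ → eq (den t i ρ)
    where
    null? : ∀ {A : Set} (as : List A) → Dec (as ≡ [])
    null? []      = yes refl
    null? (_ ∷ _) = no λ ()
    eq : ∀ {A : Set} (as : List A) → null as ≡ does (null? as)
    eq []      = refl
    eq (_ ∷ _) = refl

  infixr 2 _×D_ _→D_

  _×D_ : {P Q : Property Γ} → Decides Γ P → Decides Γ Q → Decides Γ (λ i ρ → P i ρ × Q i ρ)
  D ×D E = decidesBy (iteT (test D) (test E) falseT) (λ i ρ → decide D i ρ ×-dec decide E i ρ)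
    λ i ρ → eq (den (test D) i ρ)
    where
    eq : ∀ b {c} → (if b then c else false) ≡ (b ∧ c)
    eq true  = refl
    eq false = refl

  ¬D : {P : Property Γ} → Decides Γ P → Decides Γ (λ i ρ → ¬ P i ρ)
  ¬D D = decidesBy (iteT (test D) falseT trueT) (λ i ρ → ¬? (decide D i ρ)) λ i ρ → eq (den (test D) i ρ)
    where
    eq : ∀ b → (if b then false else true) ≡ not b
    eq true  = refl
    eq false = refl

  _→D_ : {P Q : Property Γ} → Decides Γ P → Decides Γ Q → Decides Γ (λ i ρ → P i ρ → Q i ρ)
  D →D E = decidesBy (iteT (test D) (test E) trueT) (λ i ρ → decide D i ρ →-dec decide E i ρ)
    λ i ρ → eq (den (test D) i ρ)
    where
    eq : ∀ b {c} → (if b then c else true) ≡ not b ∨ c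
    eq true  = refl
    eq false = refl

  -- Equality holds just when both truncated differences vanish.
  natD : (t u : Comp Γ natₜ) → Decides Γ (λ i ρ → den t i ρ ≡ den u i ρ)
  natD t u = mapD (λ i ρ (p , q) → ≤-antisym (∸≡0 (den t i ρ) (den u i ρ) p) (∸≡0 (den u i ρ) (den t i ρ) q))
    (λ i ρ eq → nil≡ (den t i ρ) (den u i ρ) eq , nil≡ (den u i ρ) (den t i ρ) (sym eq))
    (nullD (natList (monusT t u)) ×D nullD (natList (monusT u t)))
    where
    ∸≡0 : ∀ m n → replicate (m ∸ n) tt ≡ [] → m ≤ n
    ∸≡0 m n eq = m∸n≡0⇒m≤n (trans (sym (length-replicate (m ∸ n))) (cong length eq))
    nil≡ : ∀ m n → m ≡ n → replicate (m ∸ n) tt ≡ []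
    nil≡ m _ refl = cong (λ l → replicate l tt) (n∸n≡0 m)

  finD : (t u : Comp Γ (fin k)) → Decides Γ (λ i ρ → den t i ρ ≡ den u i ρ)
  finD t u = mapD (λ _ _ → Fin.toℕ-injective) (λ _ _ → cong toℕ) (natD (toℕT t) (toℕT u))

  filterT : {P : Property (σ ∷ Γ)} (t : Comp Γ (list σ)) → Decides (σ ∷ Γ) P → (P? : ∀ i ρ → Dec (P i ρ)) → Comp
    Γ (list σ)
  filterT t D P? = override (forT t (iteT (test D) (v0 ∷ₜ []ₜ) []ₜ))
    (λ i ρ → filter (λ a → P? i (a , ρ)) (den t i ρ))
    λ i ρ → concatMap-if (λ a → P? i (a , ρ)) _ (λ a → det (reflects D i (a , ρ)) (proof (P? i (a , ρ)))) (den t i ρ)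

  -- Tests whether the list of counterexamples is empty; decidability removes the double negation.
  allD : {P : Property (σ ∷ Γ)} (t : Comp Γ (list σ)) → Decides (σ ∷ Γ) P → Decides Γ
    (λ i ρ → All (λ a → P i (a , ρ)) (den t i ρ))
  allD {σ} {Γ} {P} t D = mapD (λ i ρ → to i ρ (den t i ρ)) (λ i ρ → from i ρ (den t i ρ))
    (nullD (filterT t (¬D D) (decide (¬D D))))
    where
    to : ∀ i ρ as → filter (λ a → decide (¬D D) i (a , ρ)) as ≡ [] → All (λ a → P i (a , ρ)) as
    to i ρ as eq = All.tabulate λ {a} a∈as → decidable-stable (decide D i (a , ρ)) λ ¬p →
      Any.¬Any[] (subst (a ∈_) eq (∈-filter⁺ (λ a → decide (¬D D) i (a , ρ)) a∈as ¬p))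
    from : ∀ i ρ as → All (λ a → P i (a , ρ)) as → filter (λ a → decide (¬D D) i (a , ρ)) as ≡ []
    from i ρ as ps = filter-none (λ a → decide (¬D D) i (a , ρ)) (All.map (λ p ¬p → ¬p p) ps)

  ∀D : {P : Property (fin k ∷ Γ)} (t : Comp Γ (list (fin k))) → (∀ i ρ → den t i ρ ≡ List.allFin (k i)) →
    Decides (fin k ∷ Γ) P →
       Decides Γ (λ i ρ → ∀ a → P i (a , ρ))
  ∀D t eq D = mapD (λ i ρ ps a → All.lookup ps (subst (a ∈_) (sym (eq i ρ)) (∈-allFin a)))
    (λ i ρ ps → All.universal ps _) (allD t D)

  ∃D : {P : Property (σ ∷ Γ)} (t : Comp Γ (list σ)) → Decides (σ ∷ Γ) P → Decides Γ
    (λ i ρ → Any (λ a → P i (a , ρ)) (den t i ρ))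
  ∃D {σ} {Γ} {P} t D = mapD (λ i ρ → ¬All¬⇒Any i ρ (den t i ρ)) (λ i ρ any all → All.All¬⇒¬Any all any)
    (¬D (allD t (¬D D)))
    where
    ¬All¬⇒Any : ∀ i ρ as → ¬ All (λ a → ¬ P i (a , ρ)) as → Any (λ a → P i (a , ρ)) as
    ¬All¬⇒Any i ρ as ¬all = decidable-stable (Any.any? (λ a → decide D i (a , ρ)) as) λ ¬any → ¬all
      (All.¬Any⇒All¬ as ¬any)

  vecD : (t u : Comp Γ (vec k (fin l))) → Decides Γ (λ i ρ → den t i ρ ≡ den u i ρ)
  vecD t u = mapD (λ i ρ → lookup-ext) (λ i ρ eq a → cong (λ v → Vec.lookup v a) eq)
    (∀D (indicesT t) (λ _ _ → refl) (finD (lookupT (wk t) v0) (lookupT (wk u) v0)))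

-- Depth first search with polynomial delay

costs-from-pad : ∀ j k t → costs-from j (pad k t) ≡ costs-from (j + k) t
costs-from-pad j zero    t = cong (λ l → costs-from l t) (sym (+-identityʳ j))
costs-from-pad j (suc k) t = trans (costs-from-pad (suc j) k t) (cong (λ l → costs-from l t) (sym (+-suc j k)))

costs-from-≤ : ∀ {d j k} t → j ≤ k → All (_≤ d) (costs-from k t) → All (_≤ d) (costs-from j t)
costs-from-≤ []            j≤k (k≤d ∷ []) = ≤-trans j≤k k≤d ∷ []
costs-from-≤ (nothing ∷ t) j≤k ps         = costs-from-≤ t (s≤s j≤k) ps
costs-from-≤ (just _ ∷ t)  j≤k (k≤d ∷ ps) = ≤-trans (s≤s j≤k) k≤d ∷ ps

outputs-pad : ∀ k t → outputs (pad k t) ≡ outputs t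
outputs-pad zero    t = refl
outputs-pad (suc k) t = outputs-pad k t

pad-++ : ∀ k t u → pad k t ++ u ≡ pad k (t ++ u)
pad-++ zero    t u = refl
pad-++ (suc k) t u = cong (nothing ∷_) (pad-++ k t u)

-- The first output of t comes within a transitions, at most b follow the
-- last, and at most m separate two.
record Paced (m a b : ℕ) (t : List Event) : Set where
  constructor paced-by
  field
    pace : ∀ {d j} t′ → m ≤ d → j + a ≤ d → All (_≤ d) (costs-from b t′) → All (_≤ d) (costs-from j (t ++ t′))

paced-++ : ∀ {d a b a′ b′ t u} → b + a′ ≤ d → Paced d a b t → Paced d a′ b′ u → Paced d a b′ (t ++ u)
paced-++ {t = t} {u} le (paced-by p) (paced-by q) = paced-by λ {_} {j} t′ m≤d j+a≤d ps →
  subst (λ w → All _ (costs-from j w)) (sym (++-assoc t u t′)) (p (u ++ t′) m≤d j+a≤d (q t′ m≤d (≤-trans le m≤d) ps))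

paced-pad : ∀ {d a b t} k → Paced d a b t → Paced d (k + a) b (pad k t)
paced-pad {a = a} {t = t} k (paced-by p) = paced-by λ {_} {j} t′ m≤d le ps →
  subst (All _) (sym (trans (cong (costs-from j) (pad-++ k t t′)) (costs-from-pad j k (t ++ t′))))
    (p t′ m≤d (≤-trans (≤-reflexive (+-assoc j k a)) le) ps)

paced-++-pad : ∀ {d a b t} k → Paced d a b t → Paced d a (b + k) (t ++ pad k [])
paced-++-pad {b = b} {t} k (paced-by p) = paced-by λ {_} {j} t′ m≤d le ps →
  subst (λ w → All _ (costs-from j w)) (sym (trans (++-assoc t (pad k []) t′) (cong (t ++_) (pad-++ k [] t′))))
    (p (pad k t′) m≤d le (subst (All _) (sym (costs-from-pad b k t′)) ps))

-- No trace without outputs satisfies `Paced`, because the time spent before it would run on into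
-- what follows. So `Emits` only describes parts that output something, and this is where the
-- absence of dead ends enters.
record Emits {v} (e : Exp v) (ρ : Env v) (vs : List Value) (a b d : ℕ) : Set where
  constructor emitting
  field
    trace : List Event
    emits : ∀ {K t} → ret nil K ⇝ t → eval e ρ K ⇝ (trace ++ t)
    lists : outputs trace ≡ vs
    paced : Paced d a b trace

emits-≤ : ∀ {v} {e : Exp v} {ρ vs a b a′ b′ d} → a ≤ a′ → b ≤ b′ → Emits e ρ vs a b d → Emits e ρ vs a′ b′ d
emits-≤ a≤ b≤ (emitting t r l (paced-by p)) = emitting t r l (paced-by λ {_} {j} t′ m≤d le ps →
  p t′ m≤d (≤-trans (+-monoʳ-≤ j a≤) le) (costs-from-≤ t′ b≤ ps))

emits-output : ∀ {v} {x} {ρ : Env v} {a d} → lookup ρ x ≡ a → Emits (output x) ρ (a ∷ []) 1 0 d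
emits-output refl = emitting (just _ ∷ []) (refl ∷_) refl (paced-by λ {_} {j} _ _ le ps → ≤-trans
  (≤-reflexive (+-comm 1 j)) le ∷ ps)

emits-step : ∀ {v w} {e : Exp v} {ρ} {f : Exp w} {σ vs a b d} →
  (∀ {K} → step (eval f σ K) ≡ next nothing (eval e ρ K)) →
             Emits e ρ vs a b d → Emits f σ vs (suc a) b d
emits-step eq (emitting t r l p) = emitting (nothing ∷ t) (λ h → eq ∷ r h) l (paced-pad 1 p)

emits-let : ∀ {v} {e₁ e₂} {ρ : Env v} {c k vs a b d} → Runs e₁ ρ c k → Emits e₂ (c Vec.∷ ρ) vs a b d →
            Emits (let′ e₁ e₂) ρ vs (2 + (k + a)) b d
emits-let {k = k} {a = a} (runs-in j j≤k r) (emitting t s l p) = emits-≤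
            (≤-trans (≤-reflexive (sym (+-assoc 2 j a))) (s≤s (s≤s (+-monoˡ-≤ a j≤k)))) ≤-refl
  (emitting (pad (2 + j) t)
    (λ {K} {u} h → refl ∷ reshape (trans (sym (pad-suc j (t ++ u))) (sym (pad-++ (suc j) t u))) (r (refl ∷ s h)))
    (trans (outputs-pad (2 + j) t) l) (paced-pad (2 + j) p))
  where
  pad-suc : ∀ j t → nothing ∷ pad j t ≡ pad j (nothing ∷ t)
  pad-suc zero    t = refl
  pad-suc (suc j) t = cong (nothing ∷_) (pad-suc j t)

emits-match-nil : ∀ {v} {x e₁ e₂} {ρ : Env v} {vs a b d} → lookup ρ x ≡ nil → Emits e₁ ρ vs a b d →
                  Emits (match x e₁ e₂) ρ vs (suc a) b d
emits-match-nil {e₁ = e₁} {e₂} {ρ} eq = emits-step λ {K} → cong (λ a → match-step a e₁ e₂ ρ K) eq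

emits-match-cons : ∀ {v} {x e₁ e₂} {ρ : Env v} {a₁ a₂ vs a b d} → lookup ρ x ≡ cons a₁ a₂ →
                   Emits e₂ (a₂ Vec.∷ a₁ Vec.∷ ρ) vs a b d → Emits (match x e₁ e₂) ρ vs (suc a) b d
emits-match-cons {e₁ = e₁} {e₂} {ρ} eq = emits-step λ {K} → cong (λ a → match-step a e₁ e₂ ρ K) eq

emits-app : ∀ {v w} {x y} {ρ : Env v} {e} {σ : Env w} {c vs a b d} → lookup ρ x ≡ clo e σ → lookup ρ y ≡ c →
            Emits e (c Vec.∷ clo e σ Vec.∷ σ) vs a b d → Emits (app x y) ρ vs (suc a) b d
emits-app eq₁ eq₂ = emits-step λ {K} → cong₂ (λ a b → app-step a b K) eq₁ eq₂

-- The trail of the first part, the popping of the frame and the lead of the second part form a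
-- single gap.
emits-seq : ∀ {v} {e₁ e₂} {ρ : Env v} {vs ws a b a′ b′ d} → b + suc a′ ≤ d →
            Emits e₁ ρ vs a b d → Emits e₂ (nil Vec.∷ ρ) ws a′ b′ d → Emits (let′ e₁ e₂) ρ (vs ++ ws) (suc a) b′ d
emits-seq le (emitting t r l p) (emitting u s m q) = emitting (nothing ∷ t ++ nothing ∷ u)
  (λ {K} {w} h → refl ∷ reshape (sym (++-assoc t (nothing ∷ u) w)) (r (refl ∷ s h)))
  (trans (catMaybes-++ t (nothing ∷ u)) (cong₂ _++_ l m))
  (paced-pad 1 (paced-++ {t = t} {nothing ∷ u} le p (paced-pad {t = u} 1 q)))

emits-seq-silent : ∀ {v} {e₁ e₂} {ρ : Env v} {vs a b k d} → Emits e₁ ρ vs a b d → Runs e₂ (nil Vec.∷ ρ) nil k →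
                   Emits (let′ e₁ e₂) ρ vs (suc a) (b + suc k) d
emits-seq-silent {b = b} {k} (emitting t r l p) (runs-in j j≤k s) = emits-≤ ≤-refl (+-monoʳ-≤ b (s≤s j≤k))
  (emitting (nothing ∷ t ++ pad (suc j) [])
    (λ {K} {w} h → refl ∷ reshape (trans (cong (t ++_) (sym (pad-++ (suc j) [] w))) (sym (++-assoc t _ w)))
      (r (refl ∷ s h)))
    (trans (catMaybes-++ t (pad (suc j) [])) (trans (cong (outputs t ++_) (outputs-pad (suc j) []))
      (trans (++-identityʳ _) l)))
    (paced-pad 1 (paced-++-pad {t = t} (suc j) p)))

-- Enumerators and the search procedure

module Enumeration (I : Set) where
  open Combinators I public

  private variable
    Γ     : Ctx
    σ τ κ : Ty

  -- The `j` is time already spent in silence, which is what allows preprocessing to be put in front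
  -- by `letE`.
  record Enumerator (Γ : Ctx) (outs : ∀ i → Args Γ i → List Value) : Set₁ where
    field
      prog  : ∀ {w} → Loc Γ w → Exp w
      bound : Poly
      runs  : ∀ i ρ {w} (r : Loc Γ w) {σ} → Agree Γ i ρ r σ → Σ[ t ∈ List Event ]
              eval (prog r) σ [] ⇝ t × outputs t ≡ outs i ρ ×
                (∀ j → All (_≤ j + bound at sizes Γ i ρ) (costs-from j t))

  letE : (t : Comp Γ τ) {outs : ∀ i → Args (τ ∷ Γ) i → List Value} → Enumerator (τ ∷ Γ) outs →
         Enumerator Γ (λ i ρ → outs i (den t i ρ , ρ))
  letE {Γ} {τ} t E = record
    { prog  = λ r → let′ (prog t r) (E.prog (zero , shift Γ r))
    ; bound = con 2 ⊕ (bound t ⊕ E.bound ⊚ (bound t ⊕ X))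
    ; runs  = λ i ρ r ag → runs′ i ρ (runs t i ρ r ag) (E.runs i _ _ (refl , agree-shift Γ i ag))
    }
    where
    module E = Enumerator E
    runs′ : ∀ i ρ {w e₁ e₂} {σ : Env w} {a vs} → Runs e₁ σ a (bound t at sizes Γ i ρ) →
      (Σ[ u ∈ List Event ] eval e₂ (a Vec.∷ σ) [] ⇝ u × outputs u ≡ vs ×
        (∀ j → All (_≤ j + E.bound at sizes (τ ∷ Γ) i (den t i ρ , ρ)) (costs-from j u))) →
      Σ[ u ∈ List Event ] eval (let′ e₁ e₂) σ [] ⇝ u × outputs u ≡ vs ×
        (∀ j → All (_≤ j + (con 2 ⊕ (bound t ⊕ E.bound ⊚ (bound t ⊕ X))) at sizes Γ i ρ) (costs-from j u))
    runs′ i ρ (runs-in k k≤ r) (u , h , eq , cheap) = pad (suc k) (nothing ∷ u) , refl ∷ r (refl ∷ h) ,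
      trans (outputs-pad (suc k) (nothing ∷ u)) eq ,
      λ j → subst (All _) (sym (costs-from-pad j (suc k) (nothing ∷ u)))
        (All.map (λ le → ≤-trans le (≤-trans (≤-reflexive (arith j k _)) (+-monoʳ-≤ j (+-monoʳ-≤ 2
          (+-mono-≤ k≤ (at-mono E.bound (+-monoˡ-≤ _ (small t i ρ)))))))) (cheap (suc (j + suc k))))
      where
      arith : ∀ j k b → suc (j + suc k) + b ≡ j + (2 + (k + b))
      arith = solve-∀

  module _ (leaf : Comp (σ ∷ Γ) boolₜ) (kids : Comp (σ ∷ Γ) (list σ)) (render : Comp (σ ∷ Γ) τ) where

    module _ (Z : ℕ) (i : I) (ρ : Args Γ i) where

      -- Node h s ls: the leaves below s are ls, and no node of the tree,
      -- whose height is at most h, is a dead end.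
      data Node : ℕ → El σ i → List (El σ i) → Set
      data Nodes (h : ℕ) : List (El σ i) → List (El σ i) → Set

      data Node where
        tip    : ∀ {h s} → size (code σ i s) ≤ Z → den leaf i (s , ρ) ≡ true → Node h s (s ∷ [])
        branch : ∀ {h s c cs ls} → size (code σ i s) ≤ Z → den leaf i (s , ρ) ≡ false →
                 den kids i (s , ρ) ≡ c ∷ cs → Nodes h (c ∷ cs) ls → Node (suc h) s ls

      data Nodes h where
        []  : Nodes h [] []
        _∷_ : ∀ {s ss ls ls′} → Node h s ls → Nodes h ss ls′ → Nodes h (s ∷ ss) (ls ++ ls′)

    private
      shifts : ∀ k {w} → Loc Γ w → Loc Γ (k + w)
      shifts zero    r = r
      shifts (suc k) r = shift Γ (shifts k r)

      agree-shifts : ∀ {i ρ w} {r : Loc Γ w} {env k} (vs : Vec Value k) → Agree Γ i ρ r env →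
                     Agree Γ i ρ (shifts k r) (vs Vec.++ env)
      agree-shifts Vec.[]       ag = ag
      agree-shifts (v Vec.∷ vs) ag = agree-shift Γ _ (agree-shifts vs ag)

      #1 : ∀ {w} → Fin (2 + w)
      #1 = suc zero

      #2 : ∀ {w} → Fin (3 + w)
      #2 = suc #1

      #4 : ∀ {w} → Fin (5 + w)
      #4 = suc (suc #2)

      visitNode : ∀ {w} → Loc Γ w → Exp (4 + w)
      visitNode r = let′ (prog leaf (#1 , shifts 4 r)) (match zero
        (let′ (prog kids (#2 , shifts 5 r)) (app (suc #4) zero))
        (let′ (prog render (#4 , shifts 7 r)) (output zero)))

      -- A single closure walks along a list of siblings and calls itself on the children of each.
      -- In `visitNode` the variables are tail, node, list and closure.
      visit : ∀ {w} → Loc Γ w → Exp (2 + w)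
      visit r = match zero nil (let′ (visitNode r) (app #4 #1))

      module _ (Z : ℕ) (i : I) (ρ : Args Γ i) {w} (r : Loc Γ w) (env : Env w) (ag : Agree Γ i ρ r env) (d : ℕ) where

        T : ℕ
        T = (bound leaf ⊕ bound kids ⊕ bound render) at (Z + sizes Γ i ρ)

        visitor : Value
        visitor = clo (visit r) env

        codes : List (El σ i) → Value
        codes = code (list σ) i

        rendered : El σ i → Value
        rendered s = code τ i (den render i (s , ρ))

        run : ∀ {κ} {w′} {env′ : Env w′} (t : Comp (σ ∷ Γ) κ) → bound t at (Z + sizes Γ i ρ) ≤ T → ∀ {s} → size
          (code σ i s) ≤ Z →
              ∀ {r′} → Agree (σ ∷ Γ) i (s , ρ) r′ env′ → Runs (prog t r′) env′ (code κ i (den t i (s , ρ))) T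
        run t le s≤Z ag = runs-≤ (≤-trans (at-mono (bound t) (+-monoˡ-≤ _ s≤Z)) le) (runs t i _ _ ag)

        leaf≤T : bound leaf at (Z + sizes Γ i ρ) ≤ T
        leaf≤T = ≤-trans (m≤m+n _ _) (m≤m+n _ _)

        kids≤T : bound kids at (Z + sizes Γ i ρ) ≤ T
        kids≤T = ≤-trans (m≤n+m _ (bound leaf at (Z + sizes Γ i ρ))) (m≤m+n _ _)

        render≤T : bound render at (Z + sizes Γ i ρ) ≤ T
        render≤T = m≤n+m _ ((bound leaf ⊕ bound kids) at (Z + sizes Γ i ρ))

        lead : ℕ → ℕ
        lead h = suc h * (2 * T + 8)

        -- On the way down a level costs at most two subprograms and 8 transitions, on the way up 4.
        -- The delay pays for climbing from one leaf and descending to the next.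
        delay : ℕ → ℕ
        delay h = suc h * (2 * T + 12)

        delay-step : ∀ h → delay (suc h) ≤ d → delay h ≤ d
        delay-step h = ≤-trans (m≤n+m (delay h) (2 * T + 12))

        seq≤ : ∀ h → delay h ≤ d → h * 4 + suc (suc (lead h)) ≤ d
        seq≤ h = ≤-trans (≤-trans (m≤m+n _ 2) (≤-reflexive (arith h T)))
          where
          arith : ∀ h t → h * 4 + suc (suc (suc h * (2 * t + 8))) + 2 ≡ suc h * (2 * t + 12)
          arith = solve-∀

        node-emits : ∀ {h s ls} as a → delay h ≤ d → Node Z i ρ h s ls →
          Emits (visitNode r) (as Vec.∷ code σ i s Vec.∷ a Vec.∷ visitor Vec.∷ env)
                (map rendered ls) (h * (2 * T + 8) + (2 * T + 6)) (h * 4) d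
        nodes-emits : ∀ {h c cs ls} → delay h ≤ d → Nodes Z i ρ h (c ∷ cs) ls →
          Emits (visit r) (codes (c ∷ cs) Vec.∷ visitor Vec.∷ env) (map rendered ls) (lead h) (suc h * 4) d

        node-emits {h} {s} as a le (tip s≤Z eq) = emits-≤
          (≤-trans (≤-reflexive (arith T)) (m≤n+m _ (h * (2 * T + 8)))) z≤n
          (emits-let (run leaf leaf≤T s≤Z (refl , agree-shifts
                       (as Vec.∷ code σ i s Vec.∷ a Vec.∷ visitor Vec.∷ Vec.[]) ag))
            (emits-match-cons (cong (code boolₜ i) eq)
              (emits-let (run render render≤T s≤Z (refl , agree-shifts
                           (nil Vec.∷ nil Vec.∷ code boolₜ i (den leaf i (s , ρ)) Vec.∷ as Vec.∷ code σ i s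
                           Vec.∷ a Vec.∷ visitor Vec.∷ Vec.[]) ag))
                (emits-output refl))))
          where
          arith : ∀ t → 2 + (t + suc (2 + (t + 1))) ≡ 2 * t + 6
          arith = solve-∀
        node-emits {suc h} {s} as a le (branch {c = c} {cs} s≤Z eq eq′ ns) = emits-≤ (≤-reflexive (arith h T)) ≤-refl
          (emits-let (run leaf leaf≤T s≤Z (refl , agree-shifts
                       (as Vec.∷ code σ i s Vec.∷ a Vec.∷ visitor Vec.∷ Vec.[]) ag))
            (emits-match-nil (cong (code boolₜ i) eq)
              (emits-let (runs-≡ (cong codes eq′) (run kids kids≤T s≤Z
                           (refl , agree-shifts (code boolₜ i (den leaf i (s , ρ)) Vec.∷ as Vec.∷ code σ i s
                           Vec.∷ a Vec.∷ visitor Vec.∷ Vec.[]) ag)))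
                (emits-app refl refl (nodes-emits (delay-step h le) ns)))))
          where
          arith : ∀ h t → 2 + (t + suc (2 + (t + suc (suc h * (2 * t + 8))))) ≡ suc h * (2 * t + 8) + (2 * t + 6)
          arith = solve-∀

        -- After the last sibling only the call on the empty tail remains. It is silent and, with
        -- the frame, lengthens the trail by 4.
        nodes-emits {h} {c} le (_∷_ {ls = ls} n []) = subst (λ vs → Emits _ _ (map rendered vs) _ _ _)
          (sym (++-identityʳ ls)) (emits-≤
          (≤-reflexive (arith h T)) (≤-reflexive (+-comm (h * 4) 4))
          (emits-match-cons refl (emits-seq-silent (node-emits _ _ le n)
            (runs-app refl refl (runs-match-nil refl runs-nil)))))
          where
          arith : ∀ h t → suc (suc (h * (2 * t + 8) + (2 * t + 6))) ≡ suc h * (2 * t + 8)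
          arith = solve-∀
        nodes-emits {h} {c} le (_∷_ {ls = ls} {ls′} n ns@(_ ∷ _)) = subst (λ vs → Emits _ _ vs _ _ _)
          (sym (map-++ rendered ls ls′)) (emits-≤
          (≤-reflexive (arith h T)) ≤-refl
          (emits-match-cons refl (emits-seq (seq≤ h le) (node-emits _ _ le n)
            (emits-app refl refl (nodes-emits le ns)))))
          where
          arith : ∀ h t → suc (suc (h * (2 * t + 8) + (2 * t + 6))) ≡ suc h * (2 * t + 8)
          arith = solve-∀

    searchE : (init : Comp Γ (list σ)) (Z H : Poly) (leaves : ∀ i → Args Γ i → List (El σ i)) →
              (∀ i ρ → Nodes (Z at sizes Γ i ρ) i ρ (H at sizes Γ i ρ) (den init i ρ) (leaves i ρ)) →
              Enumerator Γ (λ i ρ → map (λ s → code τ i (den render i (s , ρ))) (leaves i ρ))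
    searchE init Z H leaves nodes = record
      { prog  = λ r → let′ (prog init r) (let′ (fun (visit (shift Γ r))) (app zero #1))
      ; bound = Bnd
      ; runs  = λ i ρ r ag → runs′ i ρ r _ ag (nodes i ρ) (runs init i ρ r ag)
      }
      where
      T-poly D Bnd : Poly
      T-poly = (bound leaf ⊕ bound kids ⊕ bound render) ⊚ (Z ⊕ X)
      D = (con 1 ⊕ H) ⊗ (con 2 ⊗ T-poly ⊕ con 12)
      Bnd = con 10 ⊕ (bound init ⊕ D)
      runs′ : ∀ i ρ {w} (r : Loc Γ w) env → Agree Γ i ρ r env → ∀ {ss ls} → Nodes (Z at sizes Γ i ρ) i ρ
        (H at sizes Γ i ρ) ss ls →
        Runs (prog init r) env (code (list σ) i ss) (bound init at sizes Γ i ρ) →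
        Σ[ t ∈ List Event ] eval (let′ (prog init r) (let′ (fun (visit (shift Γ r))) (app zero #1))) env [] ⇝ t ×
          outputs t ≡ map (λ s → code τ i (den render i (s , ρ))) ls ×
          (∀ j → All (_≤ j + Bnd at sizes Γ i ρ) (costs-from j t))
      -- Without solutions nothing is output, and the whole run is a single gap.
      runs′ i ρ r env ag [] R = _ , advance R′ (done refl) , outputs-pad (time R′) [] , λ j →
          subst (All _) (sym (costs-from-pad j (time R′) [])) (+-monoʳ-≤ j (≤-trans (time≤b R′)
            (≤-trans (≤-reflexive (arith (bound init at sizes Γ i ρ)))
              (+-mono-≤ {8} {10} (m≤m+n 8 2) (m≤m+n _ (D at sizes Γ i ρ))))) ∷ [])
        where
        R′ = runs-let R (runs-let runs-fun (runs-app refl refl (runs-match-nil {e₁ = nil} refl runs-nil)))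
        arith : ∀ b → 2 + (b + (2 + (1 + 3))) ≡ 8 + b
        arith = solve-∀
      runs′ i ρ r env ag ns@(_ ∷ _) R = Emits.trace E , reshape (++-identityʳ (Emits.trace E))
        (Emits.emits E (done refl)) ,
          Emits.lists E ,
          λ j → subst (λ t → All (_≤ j + Bnd at N) (costs-from j t)) (++-identityʳ (Emits.trace E))
            (Paced.pace (Emits.paced E) [] (≤-trans D≤ (m≤n+m _ j))
                  (+-monoʳ-≤ j lead≤) (≤-trans trail≤ (m≤n+m _ j) ∷ []))
        where
        N B L : ℕ
        N = sizes Γ i ρ
        B = bound init at N
        L = suc (H at N) * (2 * T-poly at N + 8)
        D≤ : D at N ≤ Bnd at N
        D≤ = m≤n+m _ (10 + B)
        E = emits-let R (emits-let runs-fun (emits-app refl refl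
          (nodes-emits (Z at N) i ρ (shift Γ r) _ (agree-shift Γ i ag) (D at N) ≤-refl ns)))
        trail≤ : suc (H at N) * 4 ≤ Bnd at N
        trail≤ = ≤-trans (*-monoʳ-≤ (suc (H at N)) (≤-trans (s≤s (s≤s (s≤s (s≤s z≤n))))
          (m≤n+m 12 (2 * T-poly at N)))) D≤
        lead≤ : 2 + (B + (2 + (1 + suc L))) ≤ Bnd at N
        lead≤ = ≤-trans (≤-reflexive (arith B L)) (+-mono-≤ {6} {10} (s≤s (s≤s (s≤s (s≤s (s≤s (s≤s z≤n))))))
          (+-monoʳ-≤ B (*-monoʳ-≤ (suc (H at N)) (+-monoʳ-≤ (2 * T-poly at N) (m≤m+n 8 4)))))
          where
          arith : ∀ b l → 2 + (b + (2 + (1 + suc l))) ≡ 6 + (b + l)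
          arith = solve-∀

-- Actions as tilings by orbits

vectors-complete : ∀ {A : Set} {xs : List A} → (∀ x → x ∈ xs) → ∀ {k} (v : Vec A k) → v ∈ vectors xs k
vectors-complete all Vec.[]       = here refl
vectors-complete all (x Vec.∷ v) = ∈-concatMap⁺ _ (lose (vectors-complete all v) (∈-map⁺ (Vec._∷ v) (all x)))

vectors-unique : ∀ {A : Set} {xs : List A} → Unique xs → ∀ k → Unique (vectors xs k)
vectors-unique uniq zero    = [] ∷ []
vectors-unique {xs = xs} uniq (suc k) = AllPairs.concat⁺
  (All.map⁺ (All.universal (λ v → Unique.map⁺ Vec.∷-injectiveˡ uniq) _))
  (AllPairs.map⁺ (AllPairs.map
    (λ v≢w → All.map⁺ (All.universal (λ x → All.map⁺ (All.universal (λ y eq → v≢w (Vec.∷-injectiveʳ eq)) xs))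
    xs)) (vectors-unique uniq k)))

iter-suc : ∀ {A : Set} (f : A → A) z n → iter f (f z) n ≡ iter f z (suc n)
iter-suc f z zero    = refl
iter-suc f z (suc n) = cong f (iter-suc f z n)

headOr : ∀ {A : Set} → A → List A → A
headOr d []      = d
headOr d (x ∷ _) = x

-- The group as a multiplication table on `Fin k`; `given` pairs each generator of the subgroup with
-- the table of its prescribed permutation.
record Problem : Set where
  infixl 7 _·_
  field
    k m : ℕ
    e₀  : Fin k
    _·_ : Fin k → Fin k → Fin k
    _⁻¹ : Fin k → Fin k
    ·-assoc     : ∀ e f g → e · f · g ≡ e · (f · g)
    ·-identityˡ : ∀ e → e₀ · e ≡ e
    ·-identityʳ : ∀ e → e · e₀ ≡ e
    ·-inverseˡ  : ∀ e → e ⁻¹ · e ≡ e₀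
    ·-inverseʳ  : ∀ e → e · e ⁻¹ ≡ e₀
    given       : List (Fin k × Vec (Fin m) m)
    given-injective : ∀ {h s} → (h , s) ∈ given → ∀ {p q} → lookup s p ≡ lookup s q → p ≡ q

module Tilings (𝓟 : Problem) where
  open Problem 𝓟
  open DecMembership (Fin._≟_ {m}) using (_∈?_)

  Pt Elt Block Kernel : Set
  Pt     = Fin m
  Elt    = Fin k
  Block  = Vec Pt k
  Kernel = Vec Elt k

  -- A block is an orbit of an action together with a base point p, given by
  -- the map that sends e to p · e.
  record Valid (R : List Pt) (a : Block) : Set where
    constructor valid
    field
      within      : ∀ e → lookup a e ∈ R
      -- Makes the right action `lookup a e ↦ lookup a (e · g)` well defined on the block.
      consistent  : ∀ e f → lookup a e ≡ lookup a f → ∀ g → lookup a (e · g) ≡ lookup a (f · g)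
      equivariant : All (λ (h , s) → ∀ e → lookup a (e · h) ≡ lookup s (lookup a e)) given

  open Valid

  opaque
    valid? : ∀ R a → Dec (Valid R a)
    valid? R a = map′ (λ (p , q , r) → valid p q r) (λ (valid p q r) → p , q , r)
      (Fin.all? (λ e → lookup a e ∈? R) ×-dec
      Fin.all? (λ e → Fin.all? λ f → (lookup a e Fin.≟ lookup a f) →-dec Fin.all? λ g → lookup a (e · g) Fin.≟
        lookup a (f · g)) ×-dec
      All.all? (λ (h , s) → Fin.all? λ e → lookup a (e · h) Fin.≟ lookup s (lookup a e)) given)

  -- A type is an equivalence relation on the elements. It is represented by any map `T` that
  -- induces it, so several kernels may stand for one type.
  SameKernel : Block → Kernel → Set
  SameKernel a T = ∀ e f → (lookup a e ≡ lookup a f → lookup T e ≡ lookup T f) ×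
                           (lookup T e ≡ lookup T f → lookup a e ≡ lookup a f)

  opaque
    sameKernel? : ∀ a T → Dec (SameKernel a T)
    sameKernel? a T = Fin.all? λ e → Fin.all? λ f →
      ((lookup a e Fin.≟ lookup a f) →-dec (lookup T e Fin.≟ lookup T f)) ×-dec
      ((lookup T e Fin.≟ lookup T f) →-dec (lookup a e Fin.≟ lookup a f))

  Outside : Block → Pt → Set
  Outside a p = ∀ e → lookup a e ≢ p

  opaque
    outside? : ∀ a p → Dec (Outside a p)
    outside? a p = Fin.all? λ e → ¬? (lookup a e Fin.≟ p)

  infixl 6 _∖_

  opaque
    _∖_ : List Pt → Block → List Pt
    R ∖ a = filter (outside? a) R

    ∖-filter : ∀ R a → R ∖ a ≡ filter (outside? a) R
    ∖-filter R a = refl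

    ∈-∖⁺ : ∀ {R a p} → p ∈ R → Outside a p → p ∈ R ∖ a
    ∈-∖⁺ {a = a} = ∈-filter⁺ (outside? a)

    ∈-∖⁻ : ∀ R {a p} → p ∈ R ∖ a → p ∈ R × Outside a p
    ∈-∖⁻ R {a} = ∈-filter⁻ (outside? a) {xs = R}

    length-∖ : ∀ {R a p} → p ∈ R → ∀ e → lookup a e ≡ p → length (R ∖ a) < length R
    length-∖ {R} {a} p∈R e eq = filter-notAll (outside? a) R (Any.map (λ { refl out → out e eq }) p∈R)

    length-∖-≤ : ∀ R a → length (R ∖ a) ≤ length R
    length-∖-≤ R a = length-filter (outside? a) R

  blocks : List Block
  blocks = vectors (List.allFin m) k

  kernels : List Kernel
  kernels = vectors (List.allFin k) k

  removeFirst : List Pt → List Block → List Pt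
  removeFirst R []      = R
  removeFirst R (a ∷ _) = R ∖ a

  -- By cancellation any block of the type will do, so the first one is taken. If there is none,
  -- nothing changes.
  remove : Kernel → List Pt → List Pt
  remove T R = removeFirst R (filter (λ a → valid? R a ×-dec sameKernel? a T) blocks)

  -- The number of orbits of type `T` is unknown, but it is at most `m`, as every block contains a
  -- point.
  removals : Kernel → List Pt → List (List Pt)
  removals T R = map (iter (remove T) R) (upTo (suc m))

  -- Each kernel multiplies the number of candidates by `suc m`. This stays polynomial because the
  -- number of kernels is bounded.
  reach : List Kernel → List (List Pt) → List (List Pt)
  reach []       S = S
  reach (T ∷ Ts) S = reach Ts (concatMap (removals T) S)

  Extends : List Pt → Set
  Extends R = Any (_≡ []) (reach kernels (R ∷ []))

  opaque
    extends? : ∀ R → Dec (Extends R)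
    extends? R = Any.any? (λ { [] → yes refl ; (_ ∷ _) → no λ () }) (reach kernels (R ∷ []))

  -- Actions on sets of points and their gluing

  record Action (R : List Pt) (θ : Pt → Elt → Pt) : Set where
    field
      -- The map `θ` is defined everywhere but constrained on `R` only, so it can be kept unchanged
      -- on invariant subsets.
      closed   : ∀ {p} → p ∈ R → ∀ e → θ p e ∈ R
      identity : ∀ {p} → p ∈ R → θ p e₀ ≡ p
      compose  : ∀ {p} → p ∈ R → ∀ e f → θ p (e · f) ≡ θ (θ p e) f
      extends  : ∀ {p} → p ∈ R → ∀ {h s} → (h , s) ∈ given → θ p h ≡ lookup s p

  open Action

  inside : ∀ {a p} → ¬ Outside a p → ∃[ e ] lookup a e ≡ p
  inside {a} {p} ¬out with Fin.any? (λ e → lookup a e Fin.≟ p)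
  ... | yes found = found
  ... | no ¬found = contradiction (λ e eq → ¬found (e , eq)) ¬out

  orbit : (Pt → Elt → Pt) → Pt → Block
  orbit θ p = tabulate (θ p)

  lookup-orbit : ∀ θ p e → lookup (orbit θ p) e ≡ θ p e
  lookup-orbit θ p = Vec.lookup∘tabulate (θ p)

  orbit-valid : ∀ {R θ p} → Action R θ → p ∈ R → Valid R (orbit θ p)
  orbit-valid {R} {θ} {p} A p∈R = valid
    (λ e → subst (_∈ R) (sym (lookup-orbit θ p e)) (closed A p∈R e))
    (λ e f eq g → begin
      lookup (orbit θ p) (e · g) ≡⟨ trans (lookup-orbit θ p (e · g)) (compose A p∈R e g) ⟩
      θ (θ p e) g                ≡⟨ cong (λ q → θ q g) (trans (sym (lookup-orbit θ p e))
        (trans eq (lookup-orbit θ p f))) ⟩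
      θ (θ p f) g                ≡⟨ trans (lookup-orbit θ p (f · g)) (compose A p∈R f g) ⟨
      lookup (orbit θ p) (f · g) ∎)
    (All.tabulate λ {(h , s)} hs∈ e → begin
      lookup (orbit θ p) (e · h)      ≡⟨ trans (lookup-orbit θ p (e · h)) (compose A p∈R e h) ⟩
      θ (θ p e) h                     ≡⟨ extends A (closed A p∈R e) hs∈ ⟩
      lookup s (θ p e)                ≡⟨ cong (lookup s) (lookup-orbit θ p e) ⟨
      lookup s (lookup (orbit θ p) e) ∎)
    where open ≡-Reasoning

  -- If `e` moved `q` into the orbit, `e ⁻¹` would move it back inside, so `q` would be in the orbit
  -- as well.
  action-∖ : ∀ {R θ p} → Action R θ → p ∈ R → Action (R ∖ orbit θ p) θ
  action-∖ {R} {θ} {p} A p∈R = record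
    { closed   = λ {q} q∈ e → let (q∈R , out) = ∈-∖⁻ R q∈ in ∈-∖⁺ (closed A q∈R e) λ f eq → out (f · e ⁻¹) (begin
        lookup (orbit θ p) (f · e ⁻¹) ≡⟨ trans (lookup-orbit θ p (f · e ⁻¹)) (compose A p∈R f (e ⁻¹)) ⟩
        θ (θ p f) (e ⁻¹)              ≡⟨ cong (λ r → θ r (e ⁻¹)) (trans (sym (lookup-orbit θ p f)) eq) ⟩
        θ (θ q e) (e ⁻¹)              ≡⟨ compose A q∈R e (e ⁻¹) ⟨
        θ q (e · e ⁻¹)                ≡⟨ cong (θ q) (·-inverseʳ e) ⟩
        θ q e₀                        ≡⟨ identity A q∈R ⟩
        q                             ∎)
    ; identity = λ q∈ → identity A (proj₁ (∈-∖⁻ R q∈))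
    ; compose  = λ q∈ → compose A (proj₁ (∈-∖⁻ R q∈))
    ; extends  = λ q∈ → extends A (proj₁ (∈-∖⁻ R q∈))
    }
    where open ≡-Reasoning

  -- Acts through the block on its points and through `θ` elsewhere. The form, a first hit with a
  -- default, is the one that `actT` computes.
  adjoin : Block → (Pt → Elt → Pt) → Pt → Elt → Pt
  adjoin a θ p f = headOr (θ p f) (map (λ e → lookup a (e · f)) (filter (λ e → lookup a e Fin.≟ p) (List.allFin k)))

  -- Which `e` represents the point is immaterial by `consistent`.
  adjoin-on : ∀ {R a θ} → Valid R a → ∀ e {p} → lookup a e ≡ p → ∀ f → adjoin a θ p f ≡ lookup a (e · f)
  adjoin-on {a = a} (valid _ wd _) e {p} eq f
    with filter (λ e → lookup a e Fin.≟ p) (List.allFin k)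
       | ∈-filter⁺ (λ e → lookup a e Fin.≟ p) (∈-allFin e) eq
       | (λ {e} → ∈-filter⁻ (λ e → lookup a e Fin.≟ p) {v = e} {xs = List.allFin k})
  ... | e′ ∷ _ | _ | elem = wd e′ e (trans (proj₂ (elem (here refl))) (sym eq)) f

  adjoin-off : ∀ {a θ p} → Outside a p → ∀ f → adjoin a θ p f ≡ θ p f
  adjoin-off {a} {θ} {p} out f = cong (λ es → headOr (θ p f) (map (λ e → lookup a (e · f)) es))
    (filter-none (λ e → lookup a e Fin.≟ p) (All.universal out (List.allFin k)))

  data Position (R : List Pt) (a : Block) (p : Pt) : Set where
    on  : ∀ e → lookup a e ≡ p → Position R a p
    off : p ∈ R ∖ a → Outside a p → Position R a p

  position : ∀ {R} a {p} → p ∈ R → Position R a p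
  position a {p} p∈R with outside? a p
  ... | yes out = off (∈-∖⁺ p∈R out) out
  ... | no ¬out = let (e , eq) = inside {a} ¬out in on e eq

  adjoin-action : ∀ {R a θ} → Valid R a → Action (R ∖ a) θ → Action R (adjoin a θ)
  adjoin-action {R} {a} {θ} V@(valid in-R wd equi) A = record
    { closed   = closed′ ; identity = identity′ ; compose = compose′ ; extends = extends′ }
    where
    open ≡-Reasoning
    closed′ : ∀ {p} → p ∈ R → ∀ e → adjoin a θ p e ∈ R
    closed′ {p} p∈R e with position a p∈R
    ... | on f eq    = subst (_∈ R) (sym (adjoin-on {R} {θ = θ} V f eq e)) (in-R (f · e))
    ... | off p∈ out = subst (_∈ R) (sym (adjoin-off {a} {θ} out e)) (proj₁ (∈-∖⁻ R (closed A p∈ e)))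
    identity′ : ∀ {p} → p ∈ R → adjoin a θ p e₀ ≡ p
    identity′ {p} p∈R with position a p∈R
    ... | on f eq    = trans (adjoin-on {R} {θ = θ} V f eq e₀) (trans (cong (lookup a) (·-identityʳ f)) eq)
    ... | off p∈ out = trans (adjoin-off {a} {θ} out e₀) (identity A p∈)
    compose′ : ∀ {p} → p ∈ R → ∀ e f → adjoin a θ p (e · f) ≡ adjoin a θ (adjoin a θ p e) f
    compose′ {p} p∈R e f with position a p∈R
    ... | on g eq    = begin
      adjoin a θ p (e · f)             ≡⟨ adjoin-on {R} {θ = θ} V g eq (e · f) ⟩
      lookup a (g · (e · f))           ≡⟨ cong (lookup a) (·-assoc g e f) ⟨
      lookup a (g · e · f)             ≡⟨ adjoin-on {R} {θ = θ} V (g · e) (sym (adjoin-on {R} {θ = θ} V g eq e)) f ⟨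
      adjoin a θ (adjoin a θ p e) f    ∎
    ... | off p∈ out = begin
      adjoin a θ p (e · f)             ≡⟨ adjoin-off {a} {θ} out (e · f) ⟩
      θ p (e · f)                      ≡⟨ compose A p∈ e f ⟩
      θ (θ p e) f                      ≡⟨ adjoin-off {a} {θ} (proj₂ (∈-∖⁻ R (closed A p∈ e))) f ⟨
      adjoin a θ (θ p e) f             ≡⟨ cong (λ q → adjoin a θ q f) (adjoin-off {a} {θ} out e) ⟨
      adjoin a θ (adjoin a θ p e) f    ∎
    extends′ : ∀ {p} → p ∈ R → ∀ {h s} → (h , s) ∈ given → adjoin a θ p h ≡ lookup s p
    extends′ {p} p∈R {h} {s} hs∈ with position a p∈R
    ... | on g eq    = trans (adjoin-on {R} {θ = θ} V g eq h) (trans (All.lookup equi hs∈ g) (cong (lookup s) eq))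
    ... | off p∈ out = trans (adjoin-off {a} {θ} out h) (extends A p∈ hs∈)

  remove-sound : ∀ T R {θ} → Action (remove T R) θ → ∃[ θ′ ] Action R θ′
  remove-sound T R A with filter (λ a → valid? R a ×-dec sameKernel? a T) blocks
    | (λ {a} → ∈-filter⁻ (λ a → valid? R a ×-dec sameKernel? a T) {v = a} {xs = blocks})
  ... | []    | _    = _ , A
  ... | a ∷ _ | elem = _ , adjoin-action (proj₁ (proj₂ (elem (here refl)))) A

  iter-remove-sound : ∀ T R j {θ} → Action (iter (remove T) R j) θ → ∃[ θ′ ] Action R θ′
  iter-remove-sound T R zero    A = _ , A
  iter-remove-sound T R (suc j) A = iter-remove-sound T R j (proj₂ (remove-sound T (iter (remove T) R j) A))

  action-[] : ∀ θ → Action [] θ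
  action-[] θ = record { closed = λ () ; identity = λ () ; compose = λ () ; extends = λ () }

  removals-sound : ∀ T R → Any (λ R′ → ∃[ θ ] Action R′ θ) (removals T R) → ∃[ θ ] Action R θ
  removals-sound T R any with find any
  ... | R′ , R′∈ , θ , A with ∈-map⁻ (iter (remove T) R) {xs = upTo (suc m)} R′∈
  ...   | j , _ , refl = iter-remove-sound T R j A

  reach-sound : ∀ Ts S → Any (_≡ []) (reach Ts S) → Any (λ R → ∃[ θ ] Action R θ) S
  reach-sound []       S any = Any.map (λ { refl → _ , action-[] λ p _ → p }) any
  reach-sound (T ∷ Ts) S any = Any.map (removals-sound T _)
    (Any.concatMap⁻ (removals T) (reach-sound Ts _ any))

  -- The empty set carries an action, and the removed blocks are glued back one by one.
  Extends-sound : ∀ {R} → Extends R → ∃[ θ ] Action R θ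
  Extends-sound ext with reach-sound kernels _ ext
  ... | here found = found

  -- Cancellation of isomorphic blocks

  record Linked (a b : Block) : Set where
    constructor linked
    field
      -- Equivalently, `lookup b e ↦ lookup a e` is a well-defined bijection between the two blocks.
      iff : ∀ e f → (lookup a e ≡ lookup a f → lookup b e ≡ lookup b f) ×
                    (lookup b e ≡ lookup b f → lookup a e ≡ lookup a f)

  open Linked

  linked-sym : ∀ {a b} → Linked a b → Linked b a
  linked-sym link = linked λ e f → proj₂ (iff link e f) , proj₁ (iff link e f)

  -- Following the steps b e ↦ a e from a point outside a, one arrives at a
  -- point outside b.
  data Chase (a b : Block) : Pt → Pt → Set where
    stop : ∀ {p} → Chase a b p p
    jump : ∀ {p q} e → lookup b e ≡ p → Chase a b (lookup a e) q → Chase a b p q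

  chase-trans : ∀ {a b p q r} → Chase a b p q → Chase a b q r → Chase a b p r
  chase-trans stop          d = d
  chase-trans (jump e eq c) d = jump e eq (chase-trans c d)

  chase-reverse : ∀ {a b p q} → Chase a b p q → Chase b a q p
  chase-reverse stop          = stop
  chase-reverse (jump e eq c) = chase-trans (chase-reverse c)
    (jump e refl (subst (λ p → Chase _ _ p _) (sym eq) stop))

  -- Linked blocks leave only one possible jump from a point of `b`, and outside `b` there is none.
  chase-deterministic : ∀ {a b p q r} → Linked a b → Chase a b p q → Chase a b p r → Outside b q → Outside b r → q ≡ r
  chase-deterministic link stop          stop            oq or = refl
  chase-deterministic link stop          (jump e eq _)   oq or = contradiction eq (oq e)
  chase-deterministic link (jump e eq _) stop            oq or = contradiction eq (or e)
  chase-deterministic link (jump e eq c) (jump f eq′ c′) oq or = chase-deterministic link c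
    (subst (λ p → Chase _ _ p _) (proj₂ (iff link f e) (trans eq′ (sym eq))) c′) oq or

  chase-∈ : ∀ {R a b p q} → Valid R a → Chase a b p q → p ∈ R → q ∈ R
  chase-∈ V stop         p∈R = p∈R
  chase-∈ V (jump e _ c) p∈R = chase-∈ V c (within V e)

  -- By equivariance of both blocks, `s` takes a jump by `e` to a jump by `e · h`.
  chase-given : ∀ {R a b p q h s} → Valid R a → Valid R b → (h , s) ∈ given → Chase a b p q → Chase a b
    (lookup s p) (lookup s q)
  chase-given V W hs∈ stop = stop
  chase-given {h = h} {s} V W hs∈ (jump e eq c) = jump (e · h)
    (trans (All.lookup (equivariant W) hs∈ e) (cong (lookup s) eq))
    (subst (λ p → Chase _ _ p _) (sym (All.lookup (equivariant V) hs∈ e)) (chase-given V W hs∈ c))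

  -- If `lookup s p` is the point of the block at `e`, then injectivity of `s` makes `p` the point
  -- at `e · h ⁻¹`.
  outside-given : ∀ {R a p h s} → Valid R a → (h , s) ∈ given → Outside a p → Outside a (lookup s p)
  outside-given {a = a} {p} {h} {s} V hs∈ out e eq = out (e · h ⁻¹) (given-injective hs∈ (begin
    lookup s (lookup a (e · h ⁻¹)) ≡⟨ All.lookup (equivariant V) hs∈ (e · h ⁻¹) ⟨
    lookup a (e · h ⁻¹ · h)        ≡⟨ cong (lookup a) (trans (·-assoc e (h ⁻¹) h)
      (trans (cong (e ·_) (·-inverseˡ h)) (·-identityʳ e))) ⟩
    lookup a e                     ≡⟨ eq ⟩
    lookup s p                     ∎))
    where open ≡-Reasoning

  module _ (a b : Block) where

    private
      hop : Pt → Pt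
      hop p with Fin.any? (λ e → lookup b e Fin.≟ p)
      ... | yes (e , _) = lookup a e
      ... | no  _       = p

      hop-chase : ∀ p → Chase a b p (hop p)
      hop-chase p with Fin.any? (λ e → lookup b e Fin.≟ p)
      ... | yes (e , eq) = jump e eq stop
      ... | no  _        = stop

      hop-inside : ∀ p → ¬ Outside b p → ∃[ e ] lookup b e ≡ p × lookup a e ≡ hop p
      hop-inside p ¬out with Fin.any? (λ e → lookup b e Fin.≟ p)
      ... | yes (e , eq) = e , eq , refl
      ... | no  ¬found   = contradiction (λ e eq → ¬found (e , eq)) ¬out

      hops : Pt → ℕ → Pt
      hops = iter hop

      hops-chase : ∀ p n → Chase a b p (hops p n)
      hops-chase p zero    = stop
      hops-chase p (suc n) = chase-trans (hops-chase p n) (hop-chase _)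

      -- A hop is injective on `b`, so a repetition can be pulled back to the start `p`. Then `p` is
      -- the target of a hop, hence in `a`.
      hops-acyclic : Linked a b → ∀ {p} → Outside a p → ∀ i n → (∀ j → j ≤ i + n → ¬ Outside b (hops p j)) →
        hops p i ≢ hops p (i + suc n)
      hops-acyclic link {p} out zero    n inb eq =
        let (e , _ , eq′) = hop-inside (hops p n) (inb n ≤-refl) in out e (trans eq′ (sym eq))
      hops-acyclic link {p} out (suc i) n inb eq =
        let (e , eb , ea) = hop-inside (hops p i) (inb i (m≤n⇒m≤1+n (m≤m+n i n)))
            (f , fb , fa) = hop-inside (hops p (i + suc n)) (inb (i + suc n) (≤-reflexive (+-suc i n)))
        in hops-acyclic link out i n (λ j le → inb j (m≤n⇒m≤1+n le))
             (trans (sym eb) (trans (proj₁ (iff link e f) (trans ea (trans eq (sym fa)))) fb))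

    chase : Pt → Pt
    chase p with Fin.any? (λ (i : Fin (suc m)) → outside? b (hops p (toℕ i)))
    ... | yes (i , _) = hops p (toℕ i)
    ... | no  _       = p

    chase-chase : ∀ p → Chase a b p (chase p)
    chase-chase p with Fin.any? (λ (i : Fin (suc m)) → outside? b (hops p (toℕ i)))
    ... | yes (i , _) = hops-chase p (toℕ i)
    ... | no  _       = stop

    -- If the points after 0 to `m` hops all lay in `b`, two of them would coincide, against
    -- acyclicity. So the fallback of `chase` does not occur for `p` outside `a`.
    chase-outside : Linked a b → ∀ {p} → Outside a p → Outside b (chase p)
    chase-outside link {p} out with Fin.any? (λ (i : Fin (suc m)) → outside? b (hops p (toℕ i)))
    ... | yes (_ , out′) = out′
    ... | no  ¬found with Fin.pigeonhole (n<1+n m) (λ i → hops p (toℕ i))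
    ...   | i , j , i<j , eq = ⊥-elim (hops-acyclic link out (toℕ i) (toℕ j ∸ suc (toℕ i))
              (λ l le out′ → ¬found (Fin.fromℕ< (l<m l le) , subst (λ n → Outside b (hops p n))
                (sym (Fin.toℕ-fromℕ< (l<m l le))) out′))
              (trans eq (cong (hops p) (sym (trans (+-suc (toℕ i) _) (m+[n∸m]≡n i<j))))))
      where
      l<m : ∀ l → l ≤ toℕ i + (toℕ j ∸ suc (toℕ i)) → l < suc m
      l<m l le = ≤-trans (s≤s le) (≤-trans (≤-reflexive (m+[n∸m]≡n i<j)) (≤-trans (Fin.toℕ≤pred[n] j) (n≤1+n m)))

  -- Read backwards, the chase runs from `b` to `a`; determinism identifies it with the one that
  -- `chase b a` finds.
  chase-inverse : ∀ {a b p} → Linked a b → Outside a p → chase b a (chase a b p) ≡ p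
  chase-inverse {a} {b} {p} link out = chase-deterministic (linked-sym link) (chase-chase b a (chase a b p))
    (chase-reverse (chase-chase a b p)) (chase-outside b a (linked-sym link) (chase-outside a b link out)) out

  -- Cancellation: as the blocks a and b are isomorphic, their complements
  -- are, compatibly with the given permutations.
  module _ {R θ p a} (A : Action R θ) (p∈R : p ∈ R) (V : Valid R a) (link : Linked a (orbit θ p)) where

    private
      b : Block
      b = orbit θ p

      W : Valid R b
      W = orbit-valid A p∈R

      B : Action (R ∖ b) θ
      B = action-∖ A p∈R

      c d : Pt → Pt
      c = chase a b
      d = chase b a

      c-∈ : ∀ {q} → q ∈ R ∖ a → c q ∈ R ∖ b
      c-∈ q∈ = let (q∈R , out) = ∈-∖⁻ R q∈ in ∈-∖⁺ (chase-∈ V (chase-chase a b _) q∈R) (chase-outside a b link out)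

      d-∈ : ∀ {q} → q ∈ R ∖ b → d q ∈ R ∖ a
      d-∈ q∈ = let (q∈R , out) = ∈-∖⁻ R q∈ in ∈-∖⁺ (chase-∈ W (chase-chase b a _) q∈R)
                     (chase-outside b a (linked-sym link) out)

      dc : ∀ {q} → q ∈ R ∖ a → d (c q) ≡ q
      dc q∈ = chase-inverse link (proj₂ (∈-∖⁻ R q∈))

      cd : ∀ {q} → q ∈ R ∖ b → c (d q) ≡ q
      cd q∈ = chase-inverse (linked-sym link) (proj₂ (∈-∖⁻ R q∈))

      d-given : ∀ {q h s} → q ∈ R ∖ b → (h , s) ∈ given → d (lookup s q) ≡ lookup s (d q)
      d-given {q} q∈ hs∈ = chase-deterministic (linked-sym link) (chase-chase b a _)
        (chase-given W V hs∈ (chase-chase b a q))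
        (chase-outside b a (linked-sym link) (outside-given W hs∈ out))
          (outside-given V hs∈ (chase-outside b a (linked-sym link) out))
        where out = proj₂ (∈-∖⁻ R q∈)

    -- The action on the complement of `b`, conjugated by the bijection `c` from the complement of
    -- `a`, with inverse `d`.
    transported : Pt → Elt → Pt
    transported q e = d (θ (c q) e)

    transported-action : Action (R ∖ a) transported
    transported-action = record
      { closed   = λ q∈ e → d-∈ (closed B (c-∈ q∈) e)
      ; identity = λ q∈ → trans (cong d (identity B (c-∈ q∈))) (dc q∈)
      ; compose  = λ q∈ e f → cong d (trans (compose B (c-∈ q∈) e f)
        (cong (λ r → θ r f) (sym (cd (closed B (c-∈ q∈) e)))))
      ; extends  = λ {q} q∈ {s = s} hs∈ → trans (cong d (extends B (c-∈ q∈) hs∈))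
        (trans (d-given (c-∈ q∈) hs∈) (cong (lookup s) (dc q∈)))
      }

    -- Conjugation by a bijection preserves kernels. Hence the transported action has no kernels
    -- that `θ` did not have.
    transported-kernel : ∀ {q} → q ∈ R ∖ a → ∃[ r ] r ∈ R × Linked (orbit transported q) (orbit θ r)
    transported-kernel {q} q∈ = c q , proj₁ (∈-∖⁻ R (c-∈ q∈)) , linked λ e f →
      (λ eq → begin
        lookup (orbit θ (c q)) e      ≡⟨ lookup-orbit θ (c q) e ⟩
        θ (c q) e                     ≡⟨ cd (closed B (c-∈ q∈) e) ⟨
        c (transported q e)           ≡⟨ cong c (trans (sym (lookup-orbit transported q e))
          (trans eq (lookup-orbit transported q f))) ⟩
        c (transported q f)           ≡⟨ cd (closed B (c-∈ q∈) f) ⟩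
        θ (c q) f                     ≡⟨ lookup-orbit θ (c q) f ⟨
        lookup (orbit θ (c q)) f      ∎) ,
      (λ eq → begin
        lookup (orbit transported q) e ≡⟨ lookup-orbit transported q e ⟩
        d (θ (c q) e)                  ≡⟨ cong d (trans (sym (lookup-orbit θ (c q) e))
          (trans eq (lookup-orbit θ (c q) f))) ⟩
        d (θ (c q) f)                  ≡⟨ lookup-orbit transported q f ⟨
        lookup (orbit transported q) f ∎)
      where open ≡-Reasoning

  -- Completeness of the greedy test

  kernel-of : ∀ a → Any (SameKernel a) kernels
  kernel-of a = lose (vectors-complete ∈-allFin (tabulate (rep ∘ lookup a))) λ e f →
    (λ eq → trans (Vec.lookup∘tabulate _ e) (trans (cong rep eq) (sym (Vec.lookup∘tabulate _ f)))) ,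
    (λ eq → trans (sym (rep-correct e))
      (trans (cong (lookup a) (trans (sym (Vec.lookup∘tabulate _ e)) (trans eq (Vec.lookup∘tabulate _ f))))
      (rep-correct f)))
    where
    -- One chosen element per class; the map from `e` to the representative of its class has the
    -- kernel of `a`.
    rep : Pt → Elt
    rep p with Fin.any? (λ e → lookup a e Fin.≟ p)
    ... | yes (e , _) = e
    ... | no  _       = e₀
    rep-correct : ∀ e → lookup a (rep (lookup a e)) ≡ lookup a e
    rep-correct e with Fin.any? (λ f → lookup a f Fin.≟ lookup a e)
    ... | yes (f , eq) = eq
    ... | no  ¬found   = contradiction (e , refl) ¬found

  -- Invariant of the pass: the types still to be treated account for the orbits of all base points.
  Covered : List Kernel → List Pt → (Pt → Elt → Pt) → Set
  Covered Ts R θ = ∀ {p} → p ∈ R → Any (SameKernel (orbit θ p)) Ts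

  sameKernel-linked : ∀ {a b T} → Linked a b → SameKernel b T → SameKernel a T
  sameKernel-linked link same e f = proj₁ (same e f) ∘ proj₁ (iff link e f) , proj₂ (iff link e f) ∘ proj₂ (same e f)

  -- The orbit of `p` itself qualifies, so some block `a` is found. It has the kernel of that orbit,
  -- and cancellation moves the action to the complement of `a`.
  remove-step : ∀ {T Ts R θ p} → Action R θ → Covered Ts R θ → p ∈ R → SameKernel (orbit θ p) T →
    length (remove T R) < length R × ∃[ θ′ ] Action (remove T R) θ′ × Covered Ts (remove T R) θ′
  remove-step {T} {Ts} {R} {θ} {p} A cov p∈R same
    with filter (λ a → valid? R a ×-dec sameKernel? a T) blocks
       | (λ {a} → ∈-filter⁻ (λ a → valid? R a ×-dec sameKernel? a T) {v = a} {xs = blocks})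
       | ∈-filter⁺ (λ a → valid? R a ×-dec sameKernel? a T) (vectors-complete ∈-allFin (orbit θ p))
         (orbit-valid A p∈R , same)
  ... | a ∷ _ | elem | _ = length-∖ (within V e₀) e₀ refl , transported A p∈R V link , transported-action A p∈R
      V link ,
          λ q∈ → let (r , r∈R , link′) = transported-kernel A p∈R V link q∈ in Any.map
                       (λ {T} → sameKernel-linked {T = T} link′) (cov r∈R)
    where
    V = proj₁ (proj₂ (elem (here refl)))
    same′ = proj₂ (proj₂ (elem (here refl)))
    link : Linked a (orbit θ p)
    link = linked λ e f → proj₂ (same e f) ∘ proj₁ (same′ e f) , proj₂ (same′ e f) ∘ proj₁ (same e f)

  -- Every removal shortens `R`. Once no base point has kernel `T`, the remaining kernels cover.
  drain : ∀ n {T Ts R θ} → length R ≤ n → Action R θ → Covered (T ∷ Ts) R θ →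
    ∃[ j ] j ≤ n × ∃[ θ′ ] length (iter (remove T) R j) ≤ length R × Action (iter (remove T) R j) θ′ × Covered
      Ts (iter (remove T) R j) θ′
  drain n {T} {Ts} {R} {θ} le A cov with Any.any? (λ p → sameKernel? (orbit θ p) T) R
  ... | no ¬any = 0 , z≤n , θ , ≤-refl , A , λ p∈R → Any.tail (λ same → ¬any (lose p∈R same)) (cov p∈R)
  drain zero {R = []} le A cov | yes ()
  drain (suc n) {T} {Ts} {R} le A cov | yes any =
    let (p , p∈R , same) = find any
        (shorter , θ′ , A′ , cov′) = remove-step A cov p∈R same
        (j , j≤n , θ″ , le″ , A″ , cov″) = drain n {T} {Ts} (≤-pred (≤-trans shorter le)) A′ cov′
        eq = iter-suc (remove T) R j
    in suc j , s≤s j≤n , θ″ , subst (λ S → length S ≤ length R) eq (≤-trans le″ (<⇒≤ shorter)) ,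
       subst (λ S → Action S θ″) eq A″ , subst (λ S → Covered Ts S θ″) eq cov″

  reach-complete : ∀ Ts {S R θ} → length R ≤ m → Action R θ → Covered Ts R θ → R ∈ S → Any (_≡ []) (reach Ts S)
  reach-complete []       {R = []}    le A cov R∈S = Any.map sym R∈S
  -- With no kernels left, a remaining point would have an orbit of no type.
  reach-complete []       {R = _ ∷ _} le A cov R∈S with () ← cov (here refl)
  reach-complete (T ∷ Ts) {R = R} le A cov R∈S =
    let (j , j≤m , θ′ , le′ , A′ , cov′) = drain m le A cov
    in reach-complete Ts (≤-trans le′ le) A′ cov′
         (∈-concatMap⁺ (removals T) (lose R∈S (∈-map⁺ (iter (remove T) R) (∈-upTo⁺ (s≤s j≤m)))))

  Extends-complete : ∀ {R θ} → length R ≤ m → Action R θ → Extends R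
  Extends-complete {θ = θ} le A = reach-complete kernels le A (λ {p} _ → kernel-of (orbit θ p)) (here refl)

  -- Enumeration of tilings without repetition

  Choice : Pt → List Pt → Block → Set
  -- With base point `x` the block is determined by the action as the orbit of `x`. The last
  -- condition prevents dead ends.
  Choice x R a = Valid R a × lookup a e₀ ≡ x × Extends (R ∖ a)

  opaque
    choice? : ∀ x R a → Dec (Choice x R a)
    choice? x R a = valid? R a ×-dec (lookup a e₀ Fin.≟ x) ×-dec extends? (R ∖ a)

  choices : Pt → List Pt → List Block
  choices x R = filter (choice? x R) blocks

  choice-∈ : ∀ {x R a} → a ∈ choices x R → a ∈ blocks × Choice x R a
  choice-∈ {x} {R} = ∈-filter⁻ (choice? x R) {xs = blocks}

  -- The number `h` is fuel: every block covers at least the first point, so `length R` suffices.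
  tilings : ℕ → List Pt → List (List Block)
  tilings h       []      = [] ∷ []
  tilings zero    (x ∷ R) = []
  tilings (suc h) (x ∷ R) = concatMap (λ a → map (a ∷_) (tilings h ((x ∷ R) ∖ a))) (choices x (x ∷ R))

  act : List Block → Pt → Elt → Pt
  act = foldr adjoin λ p _ → p

  tilings-sound : ∀ h R {L} → L ∈ tilings h R → Action R (act L)
  tilings-sound h       []      (here refl) = action-[] _
  tilings-sound (suc h) (x ∷ R) L∈ with find (Any.concatMap⁻ (λ a → map (a ∷_) (tilings h ((x ∷ R) ∖ a)))
    {xs = choices x (x ∷ R)} L∈)
  ... | a , a∈ , L∈′ with ∈-map⁻ (a ∷_) {xs = tilings h ((x ∷ R) ∖ a)} L∈′
  ...   | L , L∈″ , refl = adjoin-action (proj₁ (proj₂ (choice-∈ a∈))) (tilings-sound h _ L∈″)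

  tilings-empty : ∀ h R → (∀ {θ} → ¬ Action R θ) → tilings h R ≡ []
  tilings-empty h R none = ∉⇒≡[] (tilings h R) λ L∈ → none (tilings-sound h R L∈)
    where
    ∉⇒≡[] : ∀ {A : Set} (as : List A) → (∀ {a} → ¬ a ∈ as) → as ≡ []
    ∉⇒≡[] []      ∉ = refl
    ∉⇒≡[] (a ∷ _) ∉ = contradiction (here refl) ∉

  orbit-choice : ∀ {x R θ} → length (x ∷ R) ≤ m → Action (x ∷ R) θ → orbit θ x ∈ choices x (x ∷ R)
  orbit-choice {x} {R} {θ} le A = ∈-filter⁺ (choice? x (x ∷ R)) (vectors-complete ∈-allFin (orbit θ x))
    (orbit-valid A (here refl) , trans (lookup-orbit θ x e₀) (identity A (here refl)) ,
     Extends-complete (≤-trans (length-∖-≤ (x ∷ R) (orbit θ x)) le) (action-∖ A (here refl)))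

  shorter : ∀ {x R a} h → lookup a e₀ ≡ x → length (x ∷ R) ≤ suc h → length ((x ∷ R) ∖ a) ≤ h
  shorter h eq le = ≤-pred (≤-trans (length-∖ (here refl) e₀ eq) le)

  tilings-complete : ∀ h R {θ} → length R ≤ h → length R ≤ m → Action R θ →
    ∃[ L ] L ∈ tilings h R × (∀ {p} → p ∈ R → ∀ e → act L p e ≡ θ p e)
  tilings-complete h       []      le le′ A = [] , here refl , λ ()
  tilings-complete (suc h) (x ∷ R) {θ} le le′ A =
    let a = orbit θ x
        eq = trans (lookup-orbit θ x e₀) (identity A (here refl))
        (L , L∈ , agree) = tilings-complete h ((x ∷ R) ∖ a) (shorter h eq le)
                             (≤-trans (length-∖-≤ (x ∷ R) a) le′) (action-∖ A (here refl))
    in a ∷ L , ∈-concatMap⁺ (λ a → map (a ∷_) (tilings h ((x ∷ R) ∖ a)))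
          (lose (orbit-choice le′ A) (∈-map⁺ (a ∷_) L∈)) , agree′ a L (orbit-valid A (here refl)) refl agree
    where
    open ≡-Reasoning
    agree′ : ∀ a L → Valid (x ∷ R) a → a ≡ orbit θ x → (∀ {p} → p ∈ (x ∷ R) ∖ a → ∀ e → act L p e ≡ θ p e) →
             ∀ {p} → p ∈ x ∷ R → ∀ e → adjoin a (act L) p e ≡ θ p e
    agree′ a L V refl agree {p} p∈ e with position a p∈
    ... | off p∈′ out = trans (adjoin-off {a} {act L} out e) (agree p∈′ e)
    ... | on f eq     = begin
      adjoin a (act L) p e ≡⟨ adjoin-on {θ = act L} V f eq e ⟩
      lookup a (f · e)     ≡⟨ trans (lookup-orbit θ x (f · e)) (compose A (here refl) f e) ⟩
      θ (θ x f) e          ≡⟨ cong (λ q → θ q e) (trans (sym (lookup-orbit θ x f)) eq) ⟩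
      θ p e                ∎

  Differ : List Pt → List Block → List Block → Set
  Differ R L M = ¬ (∀ {p} → p ∈ R → ∀ e → act L p e ≡ act M p e)

  act-head : ∀ {x R a} L → Choice x R a → ∀ e → act (a ∷ L) x e ≡ lookup a e
  act-head {a = a} L (V , eq , _) e = trans (adjoin-on {θ = act L} V e₀ eq e) (cong (lookup a) (·-identityˡ e))

  -- Tilings with different first blocks already disagree at `x`, where the action is the first
  -- block itself. With equal first blocks the disagreement lies outside that block.
  tilings-separated : ∀ h R → AllPairs (Differ R) (tilings h R)
  tilings-separated h       []      = [] ∷ []
  tilings-separated zero    (x ∷ R) = []
  tilings-separated (suc h) (x ∷ R) = AllPairs.concat⁺
    (All.map⁺ (All.tabulate λ {a} a∈ → AllPairs.map⁺ (AllPairs.map (λ {L} {M} differ same → differ λ p∈ e →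
      let (_ , out) = ∈-∖⁻ (x ∷ R) p∈ in trans (sym (adjoin-off {a} {act L} out e))
            (trans (same (proj₁ (∈-∖⁻ (x ∷ R) p∈)) e) (adjoin-off {a} {act M} out e)))
      (tilings-separated h ((x ∷ R) ∖ a)))))
    (AllPairs.map⁺ (separate (All.tabulate λ a∈ → proj₂ (choice-∈ a∈))
      (Unique.filter⁺ (choice? x (x ∷ R)) (vectors-unique (Unique.allFin⁺ m) k))))
    where
    across : ∀ {a b} → Choice x (x ∷ R) a → Choice x (x ∷ R) b → a ≢ b → ∀ Ls Ms →
             All (λ L → All (Differ (x ∷ R) L) (map (b ∷_) Ms)) (map (a ∷_) Ls)
    across ca cb a≢b Ls Ms = All.map⁺ (All.universal (λ L → All.map⁺ (All.universal (λ M same →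
      a≢b (lookup-ext λ e → trans (sym (act-head L ca e)) (trans (same (here refl) e) (act-head M cb e)))) Ms)) Ls)
    separate : ∀ {as} → All (Choice x (x ∷ R)) as → Unique as →
               AllPairs (λ a b → All (λ L → All (Differ (x ∷ R) L) (map (b ∷_) (tilings h ((x ∷ R) ∖ b))))
                 (map (a ∷_) (tilings h ((x ∷ R) ∖ a)))) as
    separate []        []         = []
    separate (ca ∷ cs) (a≢ ∷ uniq) = All.zipWith (λ (cb , a≢b) → across ca cb a≢b _ _) (cs , a≢) ∷ separate cs uniq

  -- The test is sound, so an action exists, and its orbit of `x` is a choice. This is why the
  -- search meets no dead end.
  choices-nonempty : ∀ {x R} → length (x ∷ R) ≤ m → Extends (x ∷ R) → choices x (x ∷ R) ≢ []
  choices-nonempty {x} {R} le ext eq = let (θ , A) = Extends-sound ext in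
    Any.¬Any[] (subst (orbit θ x ∈_) eq (orbit-choice le A))

-- The elements of G

unique-lookup : ∀ {A : Set} {xs : List A} → Unique xs → ∀ {i j} → List.lookup xs i ≡ List.lookup xs j → i ≡ j
unique-lookup {xs = x ∷ xs} _            {zero}  {zero}  eq = refl
unique-lookup {xs = x ∷ xs} (x≢ ∷ _)     {zero}  {suc j} eq = contradiction eq (All.lookup x≢ (∈-lookup j))
unique-lookup {xs = x ∷ xs} (x≢ ∷ _)     {suc i} {zero}  eq = contradiction (sym eq) (All.lookup x≢ (∈-lookup i))
unique-lookup {xs = x ∷ xs} (_ ∷ unique) {suc i} {suc j} eq = cong suc (unique-lookup unique eq)

filter-singleton : ∀ {k} {P : Fin k → Set} (P? : ∀ i → Dec (P i)) {i} → P i → (∀ {j} → P j → j ≡ i) →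
                   ∃[ js ] (filter P? (List.allFin k) ≡ i ∷ js)
filter-singleton {k} P? {i} p only with filter P? (List.allFin k) | ∈-filter⁺ P? (∈-allFin i) p
  | (λ {j} → ∈-filter⁻ P? {v = j} {xs = List.allFin k})
... | j ∷ js | _ | elem = js , cong (_∷ js) (only (proj₂ (elem (here refl))))

infixl 7 _⊙_

_⊙_ : ∀ {n} → Vec (Fin n) n → Vec (Fin n) n → Vec (Fin n) n
v ⊙ w = Vec.map (lookup w) v

table : ∀ {n} → Permutation′ n → Vec (Fin n) n
table π = Vec.tabulate (π ⟨$⟩ʳ_)

lookup-table : ∀ {n} (π : Permutation′ n) i → lookup (table π) i ≡ π ⟨$⟩ʳ i
lookup-table π = Vec.lookup∘tabulate (π ⟨$⟩ʳ_)

table-∘ : ∀ {n} (π ρ : Permutation′ n) → table (π ∘ₚ ρ) ≡ table π ⊙ table ρ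
table-∘ π ρ = lookup-ext λ i → trans (lookup-table (π ∘ₚ ρ) i)
  (sym (trans (Vec.lookup-map i (lookup (table ρ)) (table π))
    (trans (lookup-table ρ _) (cong (ρ ⟨$⟩ʳ_) (lookup-table π i)))))

table-≈ : ∀ {n} {π ρ : Permutation′ n} → (∀ i → π ⟨$⟩ʳ i ≡ ρ ⟨$⟩ʳ i) → table π ≡ table ρ
table-≈ = Vec.tabulate-cong

≈-table : ∀ {n} {π ρ : Permutation′ n} → table π ≡ table ρ → ∀ i → π ⟨$⟩ʳ i ≡ ρ ⟨$⟩ʳ i
≈-table {π = π} {ρ} eq i = trans (sym (lookup-table π i)) (trans (cong (λ v → lookup v i) eq) (lookup-table ρ i))

⊙-assoc : ∀ {n} (u v w : Vec (Fin n) n) → u ⊙ v ⊙ w ≡ u ⊙ (v ⊙ w)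
⊙-assoc u v w = trans (sym (Vec.map-∘ (lookup w) (lookup v) u))
  (Vec.map-cong (λ i → sym (Vec.lookup-map i (lookup w) v)) u)

⊙-id : ∀ {n} (v : Vec (Fin n) n) → v ⊙ table idₚ ≡ v
⊙-id v = trans (Vec.map-cong (lookup-table idₚ) v) (Vec.map-id v)

⊙-flip : ∀ {n} (v : Vec (Fin n) n) (π : Permutation′ n) → v ⊙ table π ⊙ table (flip π) ≡ v
⊙-flip v π = begin
  v ⊙ table π ⊙ table (flip π)   ≡⟨ ⊙-assoc v (table π) (table (flip π)) ⟩
  v ⊙ (table π ⊙ table (flip π)) ≡⟨ cong (v ⊙_) (table-∘ π (flip π)) ⟨
  v ⊙ table (π ∘ₚ flip π)        ≡⟨ cong (v ⊙_) (table-≈ {π = π ∘ₚ flip π} {idₚ} (λ i → inverseˡ π {i})) ⟩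
  v ⊙ table idₚ                  ≡⟨ ⊙-id v ⟩
  v                              ∎
  where open ≡-Reasoning

module Closure {n : ℕ} where
  open DecMembership (Vec.≡-dec {n = n} (Fin._≟_ {n})) public using (_∈?_)

  opaque
    new? : ∀ (E : List (Vec (Fin n) n)) v → Dec (¬ v ∈ E)
    new? E v = ¬? (v ∈? E)

  candidates : List (Vec (Fin n) n) → List (Vec (Fin n) n) → List (Vec (Fin n) n)
  candidates gens E = concatMap (λ e → filter (new? E) (map (e ⊙_) gens)) E

  addFirst : List (Vec (Fin n) n) → List (Vec (Fin n) n) → List (Vec (Fin n) n)
  addFirst E []      = E
  addFirst E (v ∷ _) = v ∷ E

  -- Adding a single new product keeps the list free of repetitions, and `B` rounds suffice.
  grow : List (Vec (Fin n) n) → List (Vec (Fin n) n) → List (Vec (Fin n) n)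
  grow gens E = addFirst E (candidates gens E)

  generate : ℕ → List (Vec (Fin n) n) → List (Vec (Fin n) n)
  generate c gens = repeatedly c (grow gens) (table idₚ ∷ [])

open Closure

-- The bound on the order is part of the index, so denotations may rely on it; the program sees only
-- the code of the instance.
record Instance (B : ℕ) : Set where
  field
    {n m}    : ℕ
    instance′ : HomExtSym n m
    order    : OrderAtMost B (HomExtSym.G instance′)

  open HomExtSym instance′ public

module Elements {B : ℕ} (x : Instance B) where
  open Instance x
  private module G = Group G

  gens : List (Vec (Fin n) n)
  gens = List.tabulate (λ i → table (gensG i))

  IsElement : Vec (Fin n) n → Set
  IsElement v = ∃[ γ ] table (proj₁ {B = _∈⟨ gensG ⟩} γ) ≡ v

  -- The enumeration of the group assigns an index to every listed table, and distinct tables get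
  -- distinct indices.
  order-bound : ∀ {E} → Unique E → All IsElement E → length E ≤ B
  order-bound {E} unique elems = ≤-trans (Fin.injective⇒≤ {f = f} λ {i} {j} eq → unique-lookup unique
      (trans (sym (proj₂ (elem i))) (trans (table-≈ {π = proj₁ (proj₁ (elem i))} {proj₁ (proj₁ (elem j))} (λ p →
        trans (sym (proj₂ (from i) refl p)) (trans (cong (λ l → proj₁ (Bijection.to bij l) ⟨$⟩ʳ p) eq)
          (proj₂ (from j) refl p)))) (proj₂ (elem j)))))
      (proj₂ (proj₂ order))
    where
    bij = proj₁ (proj₂ order)
    elem : ∀ i → IsElement (List.lookup E i)
    elem i = All.lookup elems (∈-lookup i)
    from : ∀ i → _
    from i = Bijection.surjective bij (proj₁ (elem i))
    f : Fin (length E) → Fin (proj₁ order)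
    f i = proj₁ (from i)

  record Partial (E : List (Vec (Fin n) n)) : Set where
    constructor part
    field
      unique   : Unique E
      elems    : All IsElement E
      identity : table idₚ ∈ E

  Fresh : List (Vec (Fin n) n) → Vec (Fin n) n → Set
  Fresh E v = ¬ v ∈ E × ∃[ e ] ∃[ i ] e ∈ E × v ≡ e ⊙ table (gensG i)

  candidates-fresh : ∀ E → All (Fresh E) (candidates gens E)
  candidates-fresh E = All.tabulate λ {v} v∈ →
    let (e , e∈E , v∈e) = find (∈-concatMap⁻ (λ e → filter (new? E) (map (e ⊙_) gens)) {xs = E} v∈)
        (v∈map , v∉E)   = ∈-filter⁻ (new? E) {xs = map (e ⊙_) gens} v∈e
        (g , g∈ , eq)   = ∈-map⁻ (e ⊙_) {xs = gens} v∈map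
        (i , eq′)       = ∈-tabulate⁻ g∈
    in v∉E , e , i , e∈E , trans eq (cong (e ⊙_) eq′)

  Saturated : List (Vec (Fin n) n) → Set
  Saturated E = candidates gens E ≡ []

  add : ∀ {E v vs} → Partial E → candidates gens E ≡ v ∷ vs → Partial (v ∷ E)
  add {E} (part unique elems identity) eq with subst (All (Fresh E)) eq (candidates-fresh E)
  ... | (v∉E , e , i , e∈E , eq′) ∷ _ = part (All.¬Any⇒All¬ E v∉E ∷ unique)
    ((let (γ , eqγ) = All.lookup elems e∈E in
      (proj₁ γ ∘ₚ gensG i , mul (proj₂ γ) (gen i)) , trans (table-∘ (proj₁ γ) (gensG i))
        (trans (cong (_⊙ table (gensG i)) eqγ) (sym eq′))) ∷ elems)
    (there identity)

  -- A round that is not yet saturated lengthens the list, and the fuel would carry it beyond `B`.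
  saturate : ∀ c {E} → Partial E → B < length E + c →
             Partial (repeatedly c (grow gens) E) × Saturated (repeatedly c (grow gens) E)
  saturate zero    {E} P lt = contradiction (≤-trans (subst (B <_) (+-identityʳ (length E)) lt)
    (order-bound (Partial.unique P) (Partial.elems P))) (<-irrefl refl)
  saturate (suc c) {E} P lt = aux (candidates gens E) refl
    where
    aux : ∀ vs → candidates gens E ≡ vs → Partial (repeatedly c (grow gens) (addFirst E vs)) × Saturated
      (repeatedly c (grow gens) (addFirst E vs))
    aux []       eq = subst (λ F → Partial F × Saturated F) (sym (repeatedly-fixed c (cong (addFirst E) eq))) (P , eq)
    aux (v ∷ vs) eq = saturate c (add P eq) (subst (B <_) (+-suc (length E) c) lt)

  E : List (Vec (Fin n) n)
  E = generate B gens

  abstract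
    saturated : Partial E × Saturated E
    saturated = saturate B (part ([] ∷ []) (((idₚ , unit) , refl) ∷ []) (here refl)) (n<1+n B)

  open Partial (proj₁ saturated)

  closed-gen : ∀ {e} i → e ∈ E → e ⊙ table (gensG i) ∈ E
  closed-gen {e} i e∈E = decidable-stable (e ⊙ table (gensG i) ∈? E) λ v∉E → Any.¬Any[]
    (subst (e ⊙ table (gensG i) ∈_) (proj₂ saturated)
    (∈-concatMap⁺ (λ e → filter (new? E) (map (e ⊙_) gens)) (lose e∈E
      (∈-filter⁺ (new? E) (∈-map⁺ (e ⊙_) (∈-tabulate⁺ {f = λ i → table (gensG i)} i)) v∉E))))

  -- E is finite, so e ⊙ π⁻¹ occurs among the e ⊙ πʲ.
  closed-inv : ∀ π → (∀ {e} → e ∈ E → e ⊙ table π ∈ E) → ∀ {e} → e ∈ E → e ⊙ table (flip π) ∈ E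
  closed-inv π closed {e} e∈E =
    let (i , j , i<j , eq) = Fin.pigeonhole (n<1+n (length E)) (λ i → Any.index (power∈ (toℕ i)))
        d = toℕ j ∸ suc (toℕ i)
    in subst (_∈ E) (cycle (toℕ i) d (begin
         power (toℕ i)                                ≡⟨ Any.lookup-index (power∈ (toℕ i)) ⟩
         List.lookup E (Any.index (power∈ (toℕ i)))   ≡⟨ cong (List.lookup E) eq ⟩
         List.lookup E (Any.index (power∈ (toℕ j)))   ≡⟨ Any.lookup-index (power∈ (toℕ j)) ⟨
         power (toℕ j)                                ≡⟨ cong power (trans (+-suc (toℕ i) d) (m+[n∸m]≡n i<j)) ⟨
         power (toℕ i + suc d)                        ∎)) (power∈ d)
    where
    open ≡-Reasoning
    power : ℕ → Vec (Fin n) n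
    power = iter (_⊙ table π) e
    power∈ : ∀ j → power j ∈ E
    power∈ zero    = e∈E
    power∈ (suc j) = closed (power∈ j)
    -- Undoing `π` in both powers `i` times leaves `e` equal to its power `suc d`; undoing it once
    -- more gives the claim.
    cycle : ∀ i d → power i ≡ power (i + suc d) → power d ≡ e ⊙ table (flip π)
    cycle zero    d eq = trans (sym (⊙-flip (power d) π)) (cong (_⊙ table (flip π)) (sym eq))
    cycle (suc i) d eq = cycle i d (trans (sym (⊙-flip (power i) π))
      (trans (cong (_⊙ table (flip π)) eq) (⊙-flip (power (i + suc d)) π)))

  closed : ∀ {π} → π ∈⟨ gensG ⟩ → ∀ {e} → e ∈ E → e ⊙ table π ∈ E
  closed (gen i)                e∈E = closed-gen i e∈E
  closed unit                   e∈E = subst (_∈ E) (sym (⊙-id _)) e∈E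
  closed (mul {π = π} {ρ} p q)  e∈E = subst (_∈ E) (trans (⊙-assoc _ (table π) (table ρ))
    (cong (_ ⊙_) (sym (table-∘ π ρ)))) (closed q (closed p e∈E))
  closed (inv {π = π} p)        e∈E = closed-inv π (closed p) e∈E
  closed (resp {π = π} {ρ} eq p) e∈E = subst (λ v → _ ⊙ v ∈ E) (table-≈ {π = π} {ρ} eq) (closed p e∈E)

  complete : ∀ {π} → π ∈⟨ gensG ⟩ → table π ∈ E
  complete {π} p = subst (_∈ E) (trans (sym (table-∘ idₚ π)) (table-≈ {π = idₚ ∘ₚ π} {π} λ _ → refl))
    (closed p identity)

  k : ℕ
  k = length E

  k≤B : k ≤ B
  k≤B = order-bound unique elems

  opaque
    elt : Fin k → G.Carrier
    elt i = proj₁ (All.lookup elems (∈-lookup i))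

    table-elt : ∀ i → table (proj₁ (elt i)) ≡ List.lookup E i
    table-elt i = proj₂ (All.lookup elems (∈-lookup i))

    ix : G.Carrier → Fin k
    ix (π , p) = Any.index (complete p)

    lookup-ix : ∀ γ → List.lookup E (ix γ) ≡ table (proj₁ γ)
    lookup-ix (π , p) = sym (Any.lookup-index (complete p))

  ix-unique : ∀ γ {i} → List.lookup E i ≡ table (proj₁ γ) → i ≡ ix γ
  ix-unique γ eq = unique-lookup unique (trans eq (sym (lookup-ix γ)))

  ix-cong : ∀ {γ δ} → γ G.≈ δ → ix γ ≡ ix δ
  ix-cong {γ} {δ} eq = ix-unique δ (trans (lookup-ix γ) (table-≈ {π = proj₁ γ} {proj₁ δ} eq))

  ix-elt : ∀ i → ix (elt i) ≡ i
  ix-elt i = sym (ix-unique (elt i) (sym (table-elt i)))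

  elt-ix : ∀ γ → elt (ix γ) G.≈ γ
  elt-ix γ = ≈-table {π = proj₁ (elt (ix γ))} {proj₁ γ} (trans (table-elt (ix γ)) (lookup-ix γ))

  _·_ : Fin k → Fin k → Fin k
  i · j = ix (elt i G.∙ elt j)

  ix-∙ : ∀ γ δ → ix γ · ix δ ≡ ix (γ G.∙ δ)
  ix-∙ γ δ = ix-cong (G.∙-cong {elt (ix γ)} {γ} {elt (ix δ)} {δ} (elt-ix γ) (elt-ix δ))

  hs : List (Fin k × Vec (Fin m) m)
  hs = List.tabulate λ i → ix (ι (gensM i , gen i)) , table (⟦ ψ ⟧ (gensM i , gen i))

  problem : Problem
  problem = record
    { k = k ; m = m ; e₀ = ix G.ε ; _·_ = _·_ ; _⁻¹ = λ i → ix (elt i G.⁻¹)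
    ; ·-assoc     = λ e f g → ix-cong (G.trans {elt (e · f) G.∙ elt g} {(elt e G.∙ elt f) G.∙ elt g}
      {elt e G.∙ elt (f · g)}
        (G.∙-congʳ {elt g} {elt (e · f)} {elt e G.∙ elt f} (elt-ix (elt e G.∙ elt f)))
        (G.trans {(elt e G.∙ elt f) G.∙ elt g} {elt e G.∙ (elt f G.∙ elt g)} {elt e G.∙ elt (f · g)}
          (G.assoc (elt e) (elt f) (elt g))
          (G.∙-congˡ {elt e} {elt f G.∙ elt g} {elt (f · g)}
            (G.sym {elt (f · g)} {elt f G.∙ elt g} (elt-ix (elt f G.∙ elt g))))))
    ; ·-identityˡ = λ e → trans (ix-cong {elt (ix G.ε) G.∙ elt e} {G.ε G.∙ elt e}
      (G.∙-congʳ {elt e} {elt (ix G.ε)} {G.ε} (elt-ix G.ε)))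
      (trans (ix-cong {G.ε G.∙ elt e} {elt e} (G.identityˡ (elt e))) (ix-elt e))
    ; ·-identityʳ = λ e → trans (ix-cong {elt e G.∙ elt (ix G.ε)} {elt e G.∙ G.ε}
      (G.∙-congˡ {elt e} {elt (ix G.ε)} {G.ε} (elt-ix G.ε)))
      (trans (ix-cong {elt e G.∙ G.ε} {elt e} (G.identityʳ (elt e))) (ix-elt e))
    ; ·-inverseˡ  = λ e → trans (ix-cong {elt (ix (elt e G.⁻¹)) G.∙ elt e} {elt e G.⁻¹ G.∙ elt e}
      (G.∙-congʳ {elt e} {elt (ix (elt e G.⁻¹))} {elt e G.⁻¹} (elt-ix (elt e G.⁻¹))))
      (ix-cong {elt e G.⁻¹ G.∙ elt e} {G.ε} (G.inverseˡ (elt e)))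
    ; ·-inverseʳ  = λ e → trans (ix-cong {elt e G.∙ elt (ix (elt e G.⁻¹))} {elt e G.∙ elt e G.⁻¹}
      (G.∙-congˡ {elt e} {elt (ix (elt e G.⁻¹))} {elt e G.⁻¹} (elt-ix (elt e G.⁻¹))))
      (ix-cong {elt e G.∙ elt e G.⁻¹} {G.ε} (G.inverseʳ (elt e)))
    ; given       = hs
    ; given-injective = λ hs∈ → injective (∈-tabulate⁻ hs∈)
    }
    where
    injective : ∀ {h s} → ∃[ i ] (h , s) ≡ (ix (ι (gensM i , gen i)) , table (⟦ ψ ⟧ (gensM i , gen i))) →
                ∀ {p q} → lookup s p ≡ lookup s q → p ≡ q
    injective (i , refl) {p} {q} eq = trans (sym (inverseˡ π {p}))
      (trans (cong (π ⟨$⟩ˡ_) (trans (sym (lookup-table π p)) (trans eq (lookup-table π q)))) (inverseˡ π {q}))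
      where π = ⟦ ψ ⟧ (gensM i , gen i)

-- Solutions and tilings

module _ {A B : Set} {P : A → Set} (f : ∀ {a} → P a → B) where

  reduce-any : ∀ {Q : B → Set} {as} (ps : All P as) {a} → a ∈ as → (∀ p → Q (f {a} p)) → Any Q (All.reduce f ps)
  reduce-any (p ∷ ps) (here refl) q = here (q p)
  reduce-any (p ∷ ps) (there a∈)  q = there (reduce-any ps a∈ q)

  reduce-all : ∀ {Q : B → Set} {as} (ps : All P as) → All (λ a → ∀ p → Q (f {a} p)) as → All Q (All.reduce f ps)
  reduce-all []       []       = []
  reduce-all (p ∷ ps) (q ∷ qs) = q p ∷ reduce-all ps qs

  reduce-allPairs : ∀ {_~_ : A → A → Set} {_≈_ : B → B → Set} → (∀ {a b} p q → a ~ b → f {a} p ≈ f {b} q) →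
                    ∀ {as} (ps : All P as) → AllPairs _~_ as → AllPairs _≈_ (All.reduce f ps)
  reduce-allPairs g []       []         = []
  reduce-allPairs g (p ∷ ps) (~ ∷ pairs) = reduce-all ps (All.map (λ a~b q → g p q a~b) ~) ∷ reduce-allPairs g
    ps pairs

  map-reduce : ∀ {C : Set} (g : B → C) {h : A → C} → (∀ {a} p → g (f {a} p) ≡ h a) →
               ∀ {as} (ps : All P as) → map g (All.reduce f ps) ≡ map h as
  map-reduce g eq []       = refl
  map-reduce g eq (p ∷ ps) = cong₂ _∷_ (eq p) (map-reduce g eq ps)

module Solutions {B} (x : Instance B) where
  open Instance x
  open Elements x
  open Tilings problem
  open Action
  private
    module G = Group G
    module ψ = GroupHomomorphism ψ

  points : List (Fin m)
  points = List.allFin m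

  module _ (L : List Block) (A : Action points (act L)) where

    private
      _▹_ : Fin m → G.Carrier → Fin m
      p ▹ γ = act L p (ix γ)

      ▹-cong : ∀ p {γ δ} → γ G.≈ δ → p ▹ γ ≡ p ▹ δ
      ▹-cong p {γ} {δ} eq = cong (act L p) (ix-cong {γ} {δ} eq)

      ▹-ε : ∀ p → p ▹ G.ε ≡ p
      ▹-ε p = identity A (∈-allFin p)

      ▹-∙ : ∀ p γ δ → p ▹ (γ G.∙ δ) ≡ p ▹ γ ▹ δ
      ▹-∙ p γ δ = trans (cong (act L p) (sym (ix-∙ γ δ))) (compose A (∈-allFin p) (ix γ) (ix δ))

      ▹-inverseʳ : ∀ p γ → p ▹ γ ▹ (γ G.⁻¹) ≡ p
      ▹-inverseʳ p γ = trans (sym (▹-∙ p γ (γ G.⁻¹))) (trans (▹-cong p {γ G.∙ γ G.⁻¹} {G.ε} (G.inverseʳ γ)) (▹-ε p))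

      ▹-inverseˡ : ∀ p γ → p ▹ (γ G.⁻¹) ▹ γ ≡ p
      ▹-inverseˡ p γ = trans (sym (▹-∙ p (γ G.⁻¹) γ)) (trans (▹-cong p {γ G.⁻¹ G.∙ γ} {G.ε} (G.inverseˡ γ)) (▹-ε p))

      infixl 6 _▹_

      φ : Hom G (Sym m)
      φ = record
        { ⟦_⟧ = λ γ → permutation (_▹ γ) (_▹ (γ G.⁻¹)) (λ p → ▹-inverseˡ p γ) (λ p → ▹-inverseʳ p γ)
        ; isGroupHomomorphism = record
          { isMonoidHomomorphism = record
            { isMagmaHomomorphism = record
              { isRelHomomorphism = record { cong = λ {γ} {δ} eq p → ▹-cong p {γ} {δ} eq }
              ; homo = λ γ δ p → ▹-∙ p γ δ
              }
            ; ε-homo = ▹-ε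
            }
          ; ⁻¹-homo = λ _ _ → refl
          }
        }

      -- The action is tied to `ψ` on generators only; the rest is induction on membership. As
      -- equality of elements ignores membership proofs, these may be exchanged by `▹-cong`.
      φ-extends : ∀ {π} (p : π ∈⟨ gensM ⟩) q → q ▹ ι (π , p) ≡ ⟦ ψ ⟧ (π , p) ⟨$⟩ʳ q
      φ-extends (gen i) q = trans (extends A (∈-allFin q) (∈-tabulate⁺ i)) (lookup-table (⟦ ψ ⟧ (gensM i , gen i)) q)
      φ-extends unit q = trans (▹-cong q {ι (idₚ , unit)} {G.ε} (λ _ → refl)) (trans (▹-ε q) (sym (ψ.ε-homo q)))
      φ-extends (mul {π = π} {ρ} p p′) q = begin
        q ▹ ι (π ∘ₚ ρ , mul p p′)                        ≡⟨ ▹-cong q {ι (π ∘ₚ ρ , mul p p′)}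
          {ι (π , p) G.∙ ι (ρ , p′)} (λ _ → refl) ⟩
        q ▹ (ι (π , p) G.∙ ι (ρ , p′))                   ≡⟨ ▹-∙ q (ι (π , p)) (ι (ρ , p′)) ⟩
        q ▹ ι (π , p) ▹ ι (ρ , p′)                       ≡⟨ φ-extends p′ (q ▹ ι (π , p)) ⟩
        ⟦ ψ ⟧ (ρ , p′) ⟨$⟩ʳ (q ▹ ι (π , p))              ≡⟨ cong (⟦ ψ ⟧ (ρ , p′) ⟨$⟩ʳ_) (φ-extends p q) ⟩
        ⟦ ψ ⟧ (ρ , p′) ⟨$⟩ʳ (⟦ ψ ⟧ (π , p) ⟨$⟩ʳ q)       ≡⟨ ψ.homo (π , p) (ρ , p′) q ⟨
        ⟦ ψ ⟧ (π ∘ₚ ρ , mul p p′) ⟨$⟩ʳ q                 ∎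
        where open ≡-Reasoning
      φ-extends (inv {π = π} p) q = begin
        q ▹ ι (flip π , inv p)                           ≡⟨ ▹-cong q {ι (flip π , inv p)} {ι (π , p) G.⁻¹}
          (λ _ → refl) ⟩
        q ▹ (ι (π , p) G.⁻¹)                             ≡⟨ inverseˡ (⟦ ψ ⟧ (π , p)) ⟨
        ⟦ ψ ⟧ (π , p) ⟨$⟩ˡ (⟦ ψ ⟧ (π , p) ⟨$⟩ʳ (q ▹ (ι (π , p) G.⁻¹))) ≡⟨ cong (⟦ ψ ⟧ (π , p) ⟨$⟩ˡ_) (φ-extends p _) ⟨
        ⟦ ψ ⟧ (π , p) ⟨$⟩ˡ (q ▹ (ι (π , p) G.⁻¹) ▹ ι (π , p)) ≡⟨ cong (⟦ ψ ⟧ (π , p) ⟨$⟩ˡ_)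
          (▹-inverseˡ q (ι (π , p))) ⟩
        ⟦ ψ ⟧ (π , p) ⟨$⟩ˡ q                             ≡⟨ ψ.⁻¹-homo (π , p) q ⟨
        ⟦ ψ ⟧ (flip π , inv p) ⟨$⟩ʳ q                    ∎
        where open ≡-Reasoning
      φ-extends (resp {π = π} {ρ} eq p) q = trans (▹-cong q {ι (ρ , resp eq p)} {ι (π , p)} (λ i → sym (eq i)))
        (trans (φ-extends p q) (ψ.⟦⟧-cong {π , p} {ρ , resp eq p} eq q))

    hom : HExt
    hom = φ , λ (π , p) → φ-extends p

  action : HExt → Fin m → Fin k → Fin m
  action (φ , _) p e = ⟦ φ ⟧ (elt e) ⟨$⟩ʳ p

  action-action : ∀ χ → Action points (action χ)
  action-action (φ , ext) = record
    { closed   = λ _ _ → ∈-allFin _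
    ; identity = λ {p} _ → trans (φ.⟦⟧-cong {elt (ix G.ε)} {G.ε} (elt-ix G.ε) p) (φ.ε-homo p)
    ; compose  = λ {p} _ e f → trans (φ.⟦⟧-cong {elt (e · f)} {elt e G.∙ elt f} (elt-ix (elt e G.∙ elt f)) p)
      (φ.homo (elt e) (elt f) p)
    ; extends  = λ {p} _ hs∈ → extends′ p (∈-tabulate⁻ hs∈)
    }
    where
    module φ = GroupHomomorphism φ
    extends′ : ∀ p {h s} → ∃[ i ] (h , s) ≡ (ix (ι (gensM i , gen i)) , table (⟦ ψ ⟧ (gensM i , gen i))) →
               ⟦ φ ⟧ (elt h) ⟨$⟩ʳ p ≡ lookup s p
    extends′ p (i , refl) = trans (φ.⟦⟧-cong {elt (ix γ)} {γ} (elt-ix γ) p)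
      (trans (ext (gensM i , gen i) p) (sym (lookup-table (⟦ ψ ⟧ (gensM i , gen i)) p)))
      where γ = ι (gensM i , gen i)

  all-tilings : List (List Block)
  all-tilings = tilings m points

  tilings-actions : All (λ L → Action points (act L)) all-tilings
  tilings-actions = All.tabulate (tilings-sound m points)

  solutions : List HExt
  solutions = All.reduce (λ {L} A → hom L A) tilings-actions

  points≤m : length points ≤ m
  points≤m = ≤-reflexive (length-tabulate id)

  solutions-complete : IsEnumeration HExt-setoid solutions
  solutions-complete χ@(φ , _) =
    let (L , L∈ , agree) = tilings-complete m points points≤m points≤m (action-action χ)
    in reduce-any (λ {L} A → hom L A) tilings-actions L∈ λ A γ p →
         trans (sym (GroupHomomorphism.⟦⟧-cong φ {elt (ix γ)} {γ} (elt-ix γ) p)) (sym (agree (∈-allFin p) (ix γ)))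

  solutions-unique : Setoid.Unique HExt-setoid solutions
  solutions-unique = reduce-allPairs (λ {L} A → hom L A)
    (λ {L} {M} _ _ differ same → differ λ {p} _ e →
      trans (cong (act L p) (sym (ix-elt e))) (trans (same (elt e) p) (cong (act M p) (ix-elt e))))
    tilings-actions (tilings-separated m points)

  generators : List (Fin k)
  generators = List.tabulate λ i → ix (gensG i , gen i)

  images : List Block → List (List (Fin m))
  images L = map (λ g → map (λ p → act L p g) points) generators

  codeHom-hom : ∀ {L} (A : Action points (act L)) →
                codeHom (proj₁ (hom L A)) ≡ codeList (map (λ ps → codeList (map (codeℕ ∘ toℕ) ps)) (images L))
  codeHom-hom {L} A = sym (cong codeList (begin
    map (λ ps → codeList (map (codeℕ ∘ toℕ) ps)) (images L)             ≡⟨ map-∘ generators ⟨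
    map (λ g → codeList (map (codeℕ ∘ toℕ) (map (λ p → act L p g) points))) generators ≡⟨ map-cong
      (λ g → cong codeList (trans (sym (map-∘ points)) (map-tabulate id _))) generators ⟩
    map (λ g → codeList (List.tabulate λ p → codeℕ (toℕ (act L p g)))) generators ≡⟨ map-tabulate _ _ ⟩
    List.tabulate (λ i → codeList (List.tabulate λ p → codeℕ (toℕ (act L p (ix (gensG i , gen i)))))) ∎))
    where open ≡-Reasoning

  solutions-listed : map (λ (φ , _) → codeHom φ) solutions ≡
                     map (λ L → codeList (map (λ ps → codeList (map (codeℕ ∘ toℕ) ps)) (images L))) all-tilings
  solutions-listed = map-reduce (λ {L} A → hom L A) _ (λ {L} A → codeHom-hom {L} A) tilings-actions

-- The search tree of tilings

size-filter : ∀ {A : Set} {P : A → Set} (P? : ∀ a → Dec (P a)) (c : A → Value) as →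
              size (codeList (map c (filter P? as))) ≤ size (codeList (map c as))
size-filter P? c []       = ≤-refl
size-filter P? c (a ∷ as) with does (P? a)
... | true  = s≤s (+-monoʳ-≤ (size (c a)) (size-filter P? c as))
... | false = ≤-trans (size-filter P? c as) (≤-trans (m≤n+m _ (size (c a))) (n≤1+n _))

size-∈ : ∀ {A : Set} (c : A → Value) {a as} → a ∈ as → size (c a) ≤ size (codeList (map c as))
size-∈ c (here refl) = ≤-trans (m≤m+n _ _) (n≤1+n _)
size-∈ c (there {b} a∈) = ≤-trans (size-∈ c a∈) (≤-trans (m≤n+m _ (size (c b))) (n≤1+n _))

length-vectors : ∀ {A : Set} (xs : List A) k → length (vectors xs k) ≡ length xs ^ k
length-vectors xs zero    = refl
length-vectors xs (suc k) = trans (prepend-length (vectors xs k))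
  (trans (cong (_* length xs) (length-vectors xs k)) (*-comm (length xs ^ k) (length xs)))
  where
  prepend-length : ∀ {j} (vs : List (Vec _ j)) → length (prepend xs vs) ≡ length vs * length xs
  prepend-length []       = refl
  prepend-length (v ∷ vs) = trans (length-++ (map (Vec._∷ v) xs))
    (cong₂ _+_ (length-map (Vec._∷ v) xs) (prepend-length vs))

headOr-++ : ∀ {A : Set} (d : A) xs ys → headOr d (xs ++ ys) ≡ headOr (headOr d ys) xs
headOr-++ d []      ys = refl
headOr-++ d (_ ∷ _) ys = refl

module Search (B : ℕ) where
  open Enumeration (Instance B) public

  open module S (x : Instance B) = Solutions x public
  open module El (x : Instance B) = Elements x using (k; hs; problem; _·_; ix) public
  module P (x : Instance B) = Tilings (problem x)

  private variable
    Γ     : Ctx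
    σ τ υ : Ty

  n m : Instance B → ℕ
  n = Instance.n
  m = Instance.m

  pt el blk ker perm : Ty
  pt   = fin m
  el   = fin k
  blk  = vec k pt
  ker  = vec k el
  perm = vec m pt

  mulTable : ∀ x → Vec (Vec (Fin (k x)) (k x)) (k x)
  mulTable x = Vec.map (λ i → Vec.map (λ j → _·_ x i j) (Vec.allFin (k x))) (Vec.allFin (k x))

  lookup-mulTable : ∀ x i j → lookup (lookup (mulTable x) i) j ≡ _·_ x i j
  lookup-mulTable x i j = begin
    lookup (lookup (mulTable x) i) j                                   ≡⟨ cong (λ v → lookup v j)
      (Vec.lookup-map i _ (Vec.allFin (k x))) ⟩
    lookup (Vec.map (_·_ x (lookup (Vec.allFin (k x)) i)) (Vec.allFin (k x))) j ≡⟨ Vec.lookup-map j _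
      (Vec.allFin (k x)) ⟩
    _·_ x (lookup (Vec.allFin (k x)) i) (lookup (Vec.allFin (k x)) j) ≡⟨ cong₂ (_·_ x) (Vec.lookup-allFin i)
      (Vec.lookup-allFin j) ⟩
    _·_ x i j ∎
    where open ≡-Reasoning

  -- Precomputed data in an arbitrary context, known through equations, so that the subroutines do
  -- not depend on where they are stored.
  record Tables (Γ : Ctx) : Set₁ where
    field
      pts     : Comp Γ (list pt)
      els     : Comp Γ (list el)
      mulT    : Comp Γ (vec k (vec k el))
      unitT   : Comp Γ el
      gensT   : Comp Γ (list el)
      hsT     : Comp Γ (list (el ⊗ₜ perm))
      blocksT : Comp Γ (list blk)
      kersT   : Comp Γ (list ker)
      countsT : Comp Γ (list natₜ)
      pts-den    : ∀ x ρ → den pts x ρ ≡ points x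
      els-den    : ∀ x ρ → den els x ρ ≡ List.allFin (k x)
      mul-den    : ∀ x ρ → den mulT x ρ ≡ mulTable x
      unit-den   : ∀ x ρ → den unitT x ρ ≡ Problem.e₀ (problem x)
      gens-den   : ∀ x ρ → den gensT x ρ ≡ generators x
      hs-den     : ∀ x ρ → den hsT x ρ ≡ hs x
      blocks-den : ∀ x ρ → den blocksT x ρ ≡ P.blocks x
      kers-den   : ∀ x ρ → den kersT x ρ ≡ P.kernels x
      counts-den : ∀ x ρ → den countsT x ρ ≡ upTo (suc (m x))

  open Tables

  ↑ : Tables Γ → Tables (σ ∷ Γ)
  ↑ T = record
    { pts = wk (pts T) ; els = wk (els T) ; mulT = wk (mulT T) ; unitT = wk (unitT T) ; gensT = wk (gensT T)
    ; hsT = wk (hsT T) ; blocksT = wk (blocksT T) ; kersT = wk (kersT T) ; countsT = wk (countsT T)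
    ; pts-den = λ x ρ → pts-den T x _ ; els-den = λ x ρ → els-den T x _ ; mul-den = λ x ρ → mul-den T x _
    ; unit-den = λ x ρ → unit-den T x _ ; gens-den = λ x ρ → gens-den T x _ ; hs-den = λ x ρ → hs-den T x _
    ; blocks-den = λ x ρ → blocks-den T x _ ; kers-den = λ x ρ → kers-den T x _ ; counts-den = λ x ρ →
      counts-den T x _
    }

  _·⟨_⟩_ : Comp Γ el → Tables Γ → Comp Γ el → Comp Γ el
  t ·⟨ T ⟩ u = override (lookupT (lookupT (mulT T) t) u) (λ x ρ → _·_ x (den t x ρ) (den u x ρ))
    λ x ρ → trans (cong (λ M → lookup (lookup M (den t x ρ)) (den u x ρ)) (mul-den T x ρ))
      (lookup-mulTable x (den t x ρ) (den u x ρ))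

  ∀el : {P : Property (el ∷ Γ)} → Tables Γ → Decides (el ∷ Γ) P → Decides Γ (λ x ρ → ∀ e → P x (e , ρ))
  ∀el T = ∀D (els T) (els-den T)

  validD : (T : Tables Γ) (R : Comp Γ (list pt)) (a : Comp Γ blk) → Decides Γ
    (λ x ρ → P.Valid x (den R x ρ) (den a x ρ))
  validD {Γ} T R a = mapD
    (λ x ρ (p , q , r) → P.valid p q (subst (All _) (hs-den T x ρ) r))
    (λ x ρ (P.valid p q r) → p , q , subst (All _) (sym (hs-den T x ρ)) r)
    (within ×D consistent ×D equivariant)
    where
    within : Decides Γ (λ x ρ → ∀ e → lookup (den a x ρ) e ∈ den R x ρ)
    within = ∀el T (∃D (wk R) (finD (lookupT (wk (wk a)) v1) v0))
    consistent : Decides Γ (λ x ρ → ∀ e f → lookup (den a x ρ) e ≡ lookup (den a x ρ) f →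
                                     ∀ g → lookup (den a x ρ) (_·_ x e g) ≡ lookup (den a x ρ) (_·_ x f g))
    consistent = ∀el T (∀el (↑ T) (finD (lookupT (wk (wk a)) v1) (lookupT (wk (wk a)) v0) →D
      ∀el (↑ (↑ T)) (finD (lookupT (wk (wk (wk a))) (v2 ·⟨ ↑ (↑ (↑ T)) ⟩ v0))
        (lookupT (wk (wk (wk a))) (v1 ·⟨ ↑ (↑ (↑ T)) ⟩ v0)))))
    equivariant : Decides Γ
      (λ x ρ → All (λ (h , s) → ∀ e → lookup (den a x ρ) (_·_ x e h) ≡ lookup s (lookup (den a x ρ) e))
      (den (hsT T) x ρ))
    equivariant = allD (hsT T)
      (∀el (↑ T) (finD (lookupT (wk (wk a)) (v0 ·⟨ ↑ (↑ T) ⟩ fstT v1)) (lookupT (sndT v1) (lookupT (wk (wk a)) v0))))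

  sameKernelD : (T : Tables Γ) (a : Comp Γ blk) (t : Comp Γ ker) → Decides Γ
    (λ x ρ → P.SameKernel x (den a x ρ) (den t x ρ))
  sameKernelD T a t = ∀el T (∀el (↑ T) ((A →D K) ×D (K →D A)))
    where
    A = finD (lookupT (wk (wk a)) v1) (lookupT (wk (wk a)) v0)
    K = finD (lookupT (wk (wk t)) v1) (lookupT (wk (wk t)) v0)

  minusT : Tables Γ → Comp Γ (list pt) → Comp Γ blk → Comp Γ (list pt)
  minusT T R a = override (filterT R (∀el (↑ T) (¬D (finD (lookupT (wk (wk a)) v0) v1))) λ x ρ → P.outside? x
    (den a x (proj₂ ρ)) (proj₁ ρ))
    (λ x ρ → P._∖_ x (den R x ρ) (den a x ρ)) λ x ρ → sym (P.∖-filter x (den R x ρ) (den a x ρ))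

  removeT : Tables Γ → Comp Γ ker → Comp Γ (list pt) → Comp Γ (list pt)
  removeT {Γ} T t R = override (caseT fits R (minusT (↑ (↑ (↑ T))) (wk (wk (wk R))) v1))
    (λ x ρ → P.remove x (den t x ρ) (den R x ρ)) eq
    where
    fits : Comp Γ (list blk)
    fits = override (filterT (blocksT T) (validD (↑ T) (wk R) v0 ×D sameKernelD (↑ T) v0 (wk t))
        λ x (a , ρ) → P.valid? x (den R x ρ) a ×-dec P.sameKernel? x a (den t x ρ))
      (λ x ρ → filter (λ a → P.valid? x (den R x ρ) a ×-dec P.sameKernel? x a (den t x ρ)) (P.blocks x))
      λ x ρ → cong (filter _) (blocks-den T x ρ)
    eq : ∀ x ρ → den (caseT fits R (minusT (↑ (↑ (↑ T))) (wk (wk (wk R))) v1)) x ρ ≡ P.removeFirst x (den R x ρ)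
      (den fits x ρ)
    eq x ρ with den fits x ρ
    ... | []    = refl
    ... | _ ∷ _ = refl

  size-∖ : ∀ x R a → size (code (list pt) x (P._∖_ x R a)) ≤ size (code (list pt) x R)
  size-∖ x R a = subst (λ S → size (code (list pt) x S) ≤ size (code (list pt) x R)) (sym (P.∖-filter x R a))
    (size-filter (P.outside? x a) (code pt x) R)

  -- Supplies the condition under which `iterT` may repeat the removal.
  size-remove : ∀ x t R → size (code (list pt) x (P.remove x t R)) ≤ size (code (list pt) x R)
  size-remove x t R with filter (λ a → P.valid? x R a ×-dec P.sameKernel? x a t) (P.blocks x)
  ... | []    = ≤-refl
  ... | a ∷ _ = size-∖ x R a

  removalsT : Tables Γ → Comp Γ ker → Comp Γ (list pt) → Comp Γ (list (list pt))
  removalsT T t R = override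
    (mapT (countsT T) (iterT (removeT (↑ (↑ T)) (wk (wk t)) v0) (λ x ρ S → size-remove x (den t x (proj₂ ρ)) S)
    v0 (wk R)))
    (λ x ρ → P.removals x (den t x ρ) (den R x ρ)) λ x ρ → cong (map _) (counts-den T x ρ)

  -- There are k^k kernels with k ≤ `B`; the base `suc B` is nonzero, so powers are monotone in the
  -- exponent. Depending on `B` alone, the bound allows the pass to be unrolled.
  kernels-bound : ℕ
  kernels-bound = suc B ^ suc B

  kernels≤ : ∀ x → length (P.kernels x) ≤ kernels-bound
  kernels≤ x = ≤-trans (≤-reflexive (trans (length-vectors (List.allFin (k x)) (k x))
    (cong (_^ k x) (length-tabulate id))))
    (≤-trans (^-monoˡ-≤ (k x) (m≤n⇒m≤1+n (Elements.k≤B x))) (^-monoʳ-≤ (suc B) (m≤n⇒m≤1+n (Elements.k≤B x))))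

  reachStep : ∀ x → List (El ker x) × List (List (El pt x)) → List (El ker x) × List (List (El pt x))
  reachStep x ([]     , S) = [] , S
  reachStep x (t ∷ ts , S) = ts , concatMap (P.removals x t) S

  repeatedly-reach : ∀ x c ts S → length ts ≤ c → repeatedly c (reachStep x) (ts , S) ≡ ([] , P.reach x ts S)
  repeatedly-reach x c       []       S le       = repeatedly-fixed c refl
  repeatedly-reach x (suc c) (t ∷ ts) S (s≤s le) = repeatedly-reach x c ts (concatMap (P.removals x t) S) le

  extendsD : Tables Γ → (R : Comp Γ (list pt)) → Decides Γ (λ x ρ → P.Extends x (den R x ρ))
  extendsD {Γ} T R = mapD (λ x ρ → subst (Any _) (eq x ρ)) (λ x ρ → subst (Any _) (sym (eq x ρ)))
    (∃D reached (nullD v0))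
    where
    round : Comp (list ker ⊗ₜ list (list pt) ∷ Γ) (list ker ⊗ₜ list (list pt))
    round = override (caseT (fstT v0) v0 (pairT v0 (forT (sndT v3) (removalsT (↑ (↑ (↑ (↑ (↑ T))))) v2 v0))))
      (λ x (s , ρ) → reachStep x s) λ { x (([] , S) , ρ) → refl ; x ((_ ∷ _ , S) , ρ) → refl }
    reached : Comp Γ (list (list pt))
    reached = sndT (repeatT kernels-bound round (pairT (kersT T) (R ∷ₜ []ₜ)))
    eq : ∀ x ρ → den reached x ρ ≡ P.reach x (P.kernels x) (den R x ρ ∷ [])
    eq x ρ = cong proj₂ (trans (cong (λ ts → repeatedly kernels-bound (reachStep x) (ts , den R x ρ ∷ []))
      (kers-den T x ρ))
      (repeatedly-reach x kernels-bound (P.kernels x) (den R x ρ ∷ []) (kernels≤ x)))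

  choiceD : (T : Tables Γ) (p : Comp Γ pt) (R : Comp Γ (list pt)) (a : Comp Γ blk) →
            Decides Γ (λ x ρ → P.Choice x (den p x ρ) (den R x ρ) (den a x ρ))
  choiceD T p R a = mapD
    (λ x ρ (v , eq , ext) → v , trans (cong (lookup (den a x ρ)) (sym (unit-den T x ρ))) eq , ext)
    (λ x ρ (v , eq , ext) → v , trans (cong (lookup (den a x ρ)) (unit-den T x ρ)) eq , ext)
    (validD T R a ×D finD (lookupT a (unitT T)) p ×D extendsD T (minusT T R a))

  choicesT : Tables Γ → Comp Γ pt → Comp Γ (list pt) → Comp Γ (list blk)
  choicesT T p R = override (filterT (blocksT T) (choiceD (↑ T) (wk p) (wk R) v0) λ x (a , ρ) → P.choice? x
    (den p x ρ) (den R x ρ) a)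
    (λ x ρ → P.choices x (den p x ρ) (den R x ρ)) λ x ρ → cong (filter _) (blocks-den T x ρ)

  -- Each block falls back on the later ones and finally on `p`. So the result is the head of the
  -- concatenated hits, with default `p`.
  actT : Tables Γ → Comp Γ (list blk) → Comp Γ pt → Comp Γ el → Comp Γ pt
  actT {Γ} T L p f = override (caseT hits p v1) (λ x ρ → P.act x (den L x ρ) (den p x ρ) (den f x ρ))
    λ x ρ → trans (case-eq x ρ) (hits-eq x (den L x ρ) (den p x ρ) (den f x ρ))
    where
    hitsOf : ∀ x → El pt x → El el x → El blk x → List (El pt x)
    hitsOf x p f a = map (λ e → lookup a (_·_ x e f)) (filter (λ e → lookup a e Fin.≟ p) (List.allFin (k x)))
    hits : Comp Γ (list pt)
    hits = override (forT L (mapT (filterT (wk (els T)) (finD (lookupT v1 v0) (wk (wk p))) λ x (e , a , ρ) →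
      lookup a e Fin.≟ den p x ρ)
        (lookupT v1 (v0 ·⟨ ↑ (↑ T) ⟩ wk (wk f)))))
      (λ x ρ → concatMap (hitsOf x (den p x ρ) (den f x ρ)) (den L x ρ))
      λ x ρ → concatMap-cong
        (λ a → cong (λ es → map (λ e → lookup a (_·_ x e (den f x ρ)))
        (filter (λ e → lookup a e Fin.≟ den p x ρ) es)) (els-den T x ρ)) (den L x ρ)
    case-eq : ∀ x ρ → den (caseT hits p v1) x ρ ≡ headOr (den p x ρ) (den hits x ρ)
    case-eq x ρ with den hits x ρ
    ... | []    = refl
    ... | _ ∷ _ = refl
    hits-eq : ∀ x L p f → headOr p (concatMap (hitsOf x p f) L) ≡ P.act x L p f
    hits-eq x []      p f = refl
    hits-eq x (a ∷ L) p f = trans (headOr-++ p (hitsOf x p f a) (concatMap (hitsOf x p f) L))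
      (cong (λ d → headOr d (hitsOf x p f a)) (hits-eq x L p f))

  -- A node of the search tree: the points still to be covered and the blocks
  -- chosen so far.
  st : Ty
  st = list pt ⊗ₜ list blk

  leafT : Comp (st ∷ Γ) boolₜ
  leafT = nullT (fstT v0)

  kidsOf : ∀ x → El st x → List (El st x)
  kidsOf x ([]    , L) = []
  kidsOf x (p ∷ R , L) = map (λ a → P._∖_ x (p ∷ R) a , L ++ a ∷ []) (P.choices x p (p ∷ R))

  kidsT : Tables Γ → Comp (st ∷ Γ) (list st)
  kidsT T = override (caseT (fstT v0) []ₜ (mapT (choicesT (↑ (↑ (↑ (↑ T)))) v1 v2)
    (pairT (minusT (↑ (↑ (↑ (↑ (↑ T))))) v3 v0) (sndT (wk v3) ++ₜ (v0 ∷ₜ []ₜ)))))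
    (λ x (s , ρ) → kidsOf x s) λ { x (([] , L) , ρ) → refl ; x ((_ ∷ _ , L) , ρ) → refl }

  renderT : Tables Γ → Comp (st ∷ Γ) (list (list pt))
  renderT T = override (mapT (gensT (↑ T)) (mapT (pts (↑ (↑ T))) (actT (↑ (↑ (↑ T))) (sndT v2) v0 v1)))
    (λ x ((R , L) , ρ) → images x L)
    λ x ((R , L) , ρ) → trans (cong (map _) (gens-den T x ρ))
      (map-cong (λ g → cong (map (λ p → P.act x L p g)) (pts-den T x ρ)) (generators x))

  -- Below the root `choices` keeps every state extendable, so only the root is tested separately.
  -- If the test fails the forest is empty.
  init : ∀ x → List (El st x)
  init x = if does (P.extends? x (points x)) then (points x , []) ∷ [] else []

  initT : Tables Γ → Comp Γ (list st)
  initT T = override (iteT (test E) (pairT (pts T) []ₜ ∷ₜ []ₜ) []ₜ) (λ x ρ → init x) λ x ρ → trans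
    (cong (λ b → if b then (den (pts T) x ρ , []) ∷ [] else [])
      (det (reflects E x ρ) (proof (P.extends? x (den (pts T) x ρ)))))
    (cong (λ R → if does (P.extends? x R) then (R , []) ∷ [] else []) (pts-den T x ρ))
    where E = extendsD T (pts T)

  leaves : ∀ x → List (El st x)
  leaves x = map ([] ,_) (all-tilings x)

  -- With N the size of the context: the remaining points take N, at most N blocks take 1 + N each
  -- with their cells, and the 2 is for the pair and the final `nil`.
  state-size : Poly
  state-size = con 2 ⊕ (X ⊕ X ⊗ (con 1 ⊕ X))

  module _ {Γ} (T : Tables Γ) (x : Instance B) (ρ : Args Γ x)
           (pts≤ : size (code (list pt) x (points x)) ≤ sizes Γ x ρ)
           (blocks≤ : size (code (list blk) x (P.blocks x)) ≤ sizes Γ x ρ) where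

    private
      N Z : ℕ
      N = sizes Γ x ρ
      Z = state-size at N

      Nodeₛ : ℕ → El st x → List (El st x) → Set
      Nodeₛ = Node leafT (kidsT T) (renderT T) Z x ρ

      Nodesₛ : ℕ → List (El st x) → List (El st x) → Set
      Nodesₛ = Nodes leafT (kidsT T) (renderT T) Z x ρ

      below : List (El blk x) → List (List (El blk x)) → List (El st x)
      below L = map λ M → [] , L ++ M

      m≤N : m x ≤ N
      m≤N = ≤-trans (≤-reflexive (sym (length-tabulate id))) (≤-trans (length≤size (points x)) pts≤)
        where
        length≤size : ∀ (ps : List (El pt x)) → length ps ≤ size (code (list pt) x ps)
        length≤size []       = z≤n
        length≤size (p ∷ ps) = s≤s (≤-trans (length≤size ps) (m≤n+m _ (size (code pt x p))))

      small-state : ∀ {R L h} → size (code (list pt) x R) ≤ N → size (code (list blk) x L) + h * suc N ≤ suc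
        (N * suc N) →
                    size (code st x (R , L)) ≤ Z
      small-state {R} {L} {h} R≤ L≤ = s≤s (≤-trans (+-mono-≤ R≤ (≤-trans (m≤m+n _ (h * suc N)) L≤))
        (≤-reflexive (+-suc N _)))

      snoc-size : ∀ {h a} L → a ∈ P.blocks x → size (code (list blk) x L) + suc h * suc N ≤ suc (N * suc N) →
                  size (code (list blk) x (L ++ a ∷ [])) + h * suc N ≤ suc (N * suc N)
      snoc-size {h} {a} L a∈ = ≤-trans
        (≤-trans (+-monoˡ-≤ (h * suc N)
        (≤-trans (snoc L) (+-monoʳ-≤ _ (s≤s (≤-trans (size-∈ (code blk x) a∈) blocks≤)))))
        (≤-reflexive (+-assoc (size (code (list blk) x L)) (suc N) (h * suc N))))
        where
        snoc : ∀ L → size (code (list blk) x (L ++ a ∷ [])) ≤ size (code (list blk) x L) + suc (size (code blk x a))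
        snoc []      = s≤s (≤-reflexive (+-comm _ 1))
        snoc (b ∷ L) = s≤s (≤-trans (+-monoʳ-≤ (size (code blk x b)) (snoc L))
          (≤-reflexive (sym (+-assoc (size (code blk x b)) _ _))))

    -- The last hypothesis is a size budget: each of the at most `h` blocks still to come may add
    -- `suc N`. The height bound `g` is separate from the fuel `h`, so that `root` can use the
    -- polynomial bound `N`.
    node : ∀ h {g} R L → h ≤ g → length R ≤ h → length R ≤ m x → P.Extends x R → size (code (list pt) x R) ≤ N →
           size (code (list blk) x L) + h * suc N ≤ suc (N * suc N) → Nodeₛ g (R , L) (below L (P.tilings x h R))
    node h [] L h≤g R≤h R≤m ext R≤ L≤ = subst (λ M → Nodeₛ _ ([] , L) (([] , M) ∷ [])) (sym (++-identityʳ L))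
      (tip (small-state {[]} {L} {h} R≤ L≤) refl)
    node (suc h) {suc g} (p ∷ R) L (s≤s h≤g) R≤h R≤m ext R≤ L≤ = build (P.choices x p (p ∷ R)) refl
      where
      child : El blk x → El st x
      child a = P._∖_ x (p ∷ R) a , L ++ a ∷ []
      children : ∀ as → All (P.Choice x p (p ∷ R)) as → All (_∈ P.blocks x) as →
                 Nodesₛ g (map child as)
                   (below L (concatMap (λ a → map (a ∷_) (P.tilings x h (P._∖_ x (p ∷ R) a))) as))
      children []       []                        []         = []
      children (a ∷ as) ((_ , eq , ext′) ∷ cs) (a∈ ∷ ∈s) = subst (Nodesₛ g _) leaves-eq
        (node h (P._∖_ x (p ∷ R) a) (L ++ a ∷ []) h≤g (P.shorter x h eq R≤h)
          (≤-trans (P.length-∖-≤ x (p ∷ R) a) R≤m) ext′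
          (≤-trans (size-∖ x (p ∷ R) a) R≤) (snoc-size {h} L a∈ L≤) ∷ children as cs ∈s)
        where
        ts = P.tilings x h (P._∖_ x (p ∷ R) a)
        us = concatMap (λ a → map (a ∷_) (P.tilings x h (P._∖_ x (p ∷ R) a))) as
        leaves-eq : below (L ++ a ∷ []) ts ++ below L us ≡ below L (map (a ∷_) ts ++ us)
        leaves-eq = trans (cong (_++ below L us)
          (trans (map-cong (λ M → cong ([] ,_) (++-assoc L (a ∷ []) M)) ts) (map-∘ ts)))
          (sym (map-++ (λ M → [] , L ++ M) (map (a ∷_) ts) us))
      build : ∀ as → P.choices x p (p ∷ R) ≡ as → Nodeₛ (suc g) (p ∷ R , L) (below L (P.tilings x (suc h) (p ∷ R)))
      build []       eq = contradiction eq (P.choices-nonempty x R≤m ext)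
      build (a ∷ as) eq = branch (small-state {p ∷ R} {L} {suc h} R≤ L≤) refl (cong (map child) eq)
        (subst (λ bs → Nodesₛ g (map child bs) (below L (P.tilings x (suc h) (p ∷ R)))) eq
          (children (P.choices x p (p ∷ R)) (All.tabulate λ a∈ → proj₂ (P.choice-∈ x a∈))
            (All.tabulate λ a∈ → proj₁ (P.choice-∈ x a∈))))

    root : Nodesₛ N (init x) (leaves x)
    root = from (P.extends? x (points x))
      where
      from : ∀ d → Nodesₛ N (if does d then (points x , []) ∷ [] else []) (leaves x)
      from (yes ext) = subst (Nodesₛ N _) (++-identityʳ (leaves x))
        (node (m x) (points x) [] m≤N (points≤m x) (points≤m x) ext pts≤ (s≤s (*-monoˡ-≤ (suc N) m≤N)) ∷ [])
      from (no ¬ext) = subst (Nodesₛ N []) (cong (map ([] ,_))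
        (sym (P.tilings-empty x (m x) (points x) λ A → ¬ext (P.Extends-complete x (points≤m x) A)))) []

  searchTilings : (T : Tables Γ) →
    (∀ x ρ → size (code (list pt) x (points x)) ≤ sizes Γ x ρ) →
      (∀ x ρ → size (code (list blk) x (P.blocks x)) ≤ sizes Γ x ρ) →
    Enumerator Γ (λ x ρ → map (λ s → code (list (list pt)) x (images x (proj₂ s))) (leaves x))
  searchTilings T pts≤ blocks≤ = searchE leafT (kidsT T) (renderT T) (initT T) state-size X (λ x ρ → leaves x)
    λ x ρ → root T x ρ (pts≤ x ρ) (blocks≤ x ρ)

-- From the input to the group table

toList-tabulate : ∀ {A : Set} {k} (f : Fin k → A) → Vec.toList (Vec.tabulate f) ≡ List.tabulate f
toList-tabulate {k = zero}  f = refl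
toList-tabulate {k = suc k} f = cong (f zero ∷_) (toList-tabulate (f ∘ suc))

lookup-fromList : ∀ {A : Set} (xs : List A) i → lookup (Vec.fromList xs) i ≡ List.lookup xs i
lookup-fromList (x ∷ xs) zero    = refl
lookup-fromList (x ∷ xs) (suc i) = lookup-fromList xs i

size-codeList : ∀ b as → All (λ a → size a ≤ b) as → size (codeList as) ≤ suc (length as * suc b)
size-codeList b []       []       = ≤-refl
size-codeList b (a ∷ as) (p ∷ ps) = s≤s (≤-trans (+-mono-≤ p (size-codeList b as ps)) (≤-reflexive (+-suc b _)))

size-codeℕ-≤ : ∀ {j l} → j ≤ l → size (codeℕ j) ≤ suc (l + l)
size-codeℕ-≤ z≤n       = s≤s z≤n
size-codeℕ-≤ (s≤s j≤l) = s≤s (s≤s (≤-trans (size-codeℕ-≤ j≤l) (≤-reflexive (sym (+-suc _ _)))))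

size-codePerm : ∀ {k N} → k ≤ N → (π : Permutation′ k) → size (codePerm π) ≤ suc (N * suc (suc (N + N)))
size-codePerm {k} {N} k≤N π = ≤-trans (size-codeList (suc (N + N)) _
  (All.tabulate⁺ λ i → size-codeℕ-≤ (≤-trans (<⇒≤ (Fin.toℕ<n (π ⟨$⟩ʳ i))) k≤N)))
  (s≤s (*-monoˡ-≤ (suc (suc (N + N))) (≤-trans (≤-reflexive (length-tabulate (λ i → codeℕ (toℕ (π ⟨$⟩ʳ i))))) k≤N)))

-- In N = n + m: an entry takes at most 2N + 1, a permutation has at most N entries, a generator
-- list at most 2N permutations, an instance 5 parts. Each list cell adds 1.
perm-size perms-size instance-size : Poly
perm-size     = con 1 ⊕ X ⊗ (con 2 ⊕ X ⊕ X)
perms-size    = con 1 ⊕ (X ⊕ X) ⊗ (con 1 ⊕ perm-size)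
instance-size = con 1 ⊕ con 5 ⊗ (con 1 ⊕ (con 1 ⊕ X ⊕ X ⊕ perms-size))

size-codePerms : ∀ {k l N} → k ≤ N → l ≤ N + N → (S : Fin l → Permutation′ k) → size (codePerms S) ≤ perms-size at N
size-codePerms {k} {l} {N} k≤N l≤N S = ≤-trans (size-codeList (perm-size at N) _
  (All.tabulate⁺ λ i → size-codePerm k≤N (S i)))
  (s≤s (*-monoˡ-≤ (suc (perm-size at N)) (≤-trans (≤-reflexive (length-tabulate (λ i → codePerm (S i)))) l≤N)))

size-codeInstance : ∀ {n m} (J : HomExtSym n m) → size (codeInstance J) ≤ instance-size at (n + m)
size-codeInstance {n} {m} J = size-codeList _ _
  (num (m≤m+n n m) ∷ num (m≤n+m m n) ∷ perms (size-codePerms (m≤m+n n m) (double J.#G≤2n) J.gensG) ∷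
   perms (size-codePerms (m≤m+n n m) (double J.#M≤2n) J.gensM) ∷ perms
     (size-codePerms (m≤n+m m n) (double J.#M≤2n) λ i → ⟦ J.ψ ⟧ (J.gensM i , gen i)) ∷ [])
  where
  module J = HomExtSym J
  N = n + m
  num : ∀ {j} → j ≤ N → size (codeℕ j) ≤ (con 1 ⊕ X ⊕ X ⊕ perms-size) at N
  num j≤ = ≤-trans (size-codeℕ-≤ j≤) (m≤m+n _ (perms-size at N))
  perms : ∀ {s} → s ≤ perms-size at N → s ≤ (con 1 ⊕ X ⊕ X ⊕ perms-size) at N
  perms le = ≤-trans le (m≤n+m _ (suc (N + N)))
  double : ∀ {j} → j ≤ 2 * n → j ≤ N + N
  double le = ≤-trans le (+-mono-≤ (m≤m+n n m) (≤-trans (≤-reflexive (+-identityʳ n)) (m≤m+n n m)))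

module Preprocessing (B : ℕ) where
  open Search B public

  private variable
    Γ     : Ctx
    σ τ υ : Ty

  #G #M : Instance B → ℕ
  #G x = HomExtSym.#G (Instance.instance′ x)
  #M x = HomExtSym.#M (Instance.instance′ x)

  permₙ : Ty
  permₙ = vec n (fin n)

  input : Ty
  input = record { El = λ _ → ⊤ ; code = λ x _ → codeInstance (Instance.instance′ x) }

  gensG gensM : ∀ x → Fin _ → Permutation′ (n x)
  gensG x = HomExtSym.gensG (Instance.instance′ x)
  gensM x = HomExtSym.gensM (Instance.instance′ x)

  imagesM : ∀ x → Fin (#M x) → Permutation′ (m x)
  imagesM x i = ⟦ HomExtSym.ψ (Instance.instance′ x) ⟧ (gensM x i , gen i)

  code-perm : ∀ (d : Instance B → ℕ) x (π : Permutation′ (d x)) → codePerm π ≡ code (vec d (fin d)) x (table π)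
  code-perm d x π = cong codeList
    (sym (trans (cong (map (codeℕ ∘ toℕ)) (toList-tabulate (π ⟨$⟩ʳ_))) (map-tabulate (π ⟨$⟩ʳ_) (codeℕ ∘ toℕ))))

  code-perms : ∀ (d l : Instance B → ℕ) x (S : Fin (l x) → Permutation′ (d x)) →
               codePerms S ≡ code (vec l (vec d (fin d))) x (Vec.tabulate (table ∘ S))
  code-perms d l x S = cong codeList (trans (tabulate-cong (λ i → code-perm d x (S i)))
    (sym (trans (cong (map (code (vec d (fin d)) x)) (toList-tabulate (table ∘ S)))
      (map-tabulate (table ∘ S) (code (vec d (fin d)) x)))))

  -- Parsing is mere reading: the code of an instance is that of a nested tuple whose last component
  -- is `nil`.
  parsed : Comp (input ∷ []) (natₜ ⊗ₜ natₜ ⊗ₜ vec #G permₙ ⊗ₜ vec #M permₙ ⊗ₜ vec #M perm ⊗ₜ oneₜ)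
  parsed = recode v0 (λ x _ → n x , m x , Vec.tabulate (table ∘ gensG x) , Vec.tabulate (table ∘ gensM x) ,
    Vec.tabulate (table ∘ imagesM x) , tt)
    λ x _ → cong (λ v → cons (codeℕ (n x)) (cons (codeℕ (m x)) v)) (cong₂ cons (code-perms n #G x (gensG x))
      (cong₂ cons (code-perms n #M x (gensM x)) (cong (λ v → cons v nil) (code-perms m #M x (imagesM x)))))

  nC mC : Comp (input ∷ []) natₜ
  nC = fstT parsed
  mC = fstT (sndT parsed)

  gensGC : Comp (input ∷ []) (vec #G permₙ)
  gensGC = fstT (sndT (sndT parsed))

  gensMC : Comp (input ∷ []) (vec #M permₙ)
  gensMC = fstT (sndT (sndT (sndT parsed)))

  imagesC : Comp (input ∷ []) (vec #M perm)
  imagesC = fstT (sndT (sndT (sndT (sndT parsed))))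

  identityC : Comp (input ∷ []) permₙ
  identityC = recode (allFinT {k = n} nC λ _ _ → refl) (λ x _ → table idₚ)
    λ x _ → cong (code (list (fin n)) x) (sym (toList-tabulate id))

  composeT : Comp Γ permₙ → Comp Γ permₙ → Comp Γ permₙ
  composeT t u = mapVecT t (lookupT (wk u) v0)

  growT : Comp Γ (list permₙ) → Comp (list permₙ ∷ Γ) (list permₙ)
  growT {Γ} gens = override (caseT cands v0 (v1 ∷ₜ v3)) (λ x (E , ρ) → Closure.grow (den gens x ρ) E) eq
    where
    cands : Comp (list permₙ ∷ Γ) (list permₙ)
    cands = forT v0 (filterT (mapT (wk (wk gens)) (composeT v1 v0)) (¬D (∃D v2 (vecD v1 v0)))
      λ x (v , e , E , ρ) → Closure.new? E v)
    eq : ∀ x ρ → den (caseT cands v0 (v1 ∷ₜ v3)) x ρ ≡ Closure.addFirst (proj₁ ρ) (den cands x ρ)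
    eq x ρ with den cands x ρ
    ... | []    = refl
    ... | _ ∷ _ = refl

  elementsC : Comp (input ∷ []) (vec k permₙ)
  elementsC = recode (repeatT B (growT (toListT gensGC)) (identityC ∷ₜ []ₜ)) (λ x _ → Vec.fromList (Elements.E x))
    λ x _ → cong (code (list permₙ) x) (trans
      (cong (λ gens → repeatedly B (Closure.grow gens) (table idₚ ∷ [])) (toList-tabulate (table ∘ gensG x)))
      (sym (Vec.toList∘fromList (Elements.E x))))

  Carrier : Instance B → Set
  Carrier x = Group.Carrier (HomExtSym.G (Instance.instance′ x))

  -- The program searches for the table `v`, while `γ` exists in the proof only. The search has
  -- exactly one hit because `E` has no repetitions.
  indexT : (elts : Comp Γ (vec k permₙ)) → (∀ x ρ → den elts x ρ ≡ Vec.fromList (Elements.E x)) →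
           (v : Comp Γ permₙ) (γ : ∀ x → Args Γ x → Carrier x) → (∀ x ρ → den v x ρ ≡ table (proj₁ (γ x ρ))) →
             Comp Γ el
  indexT elts elts-eq v γ v-eq = headT
    (filterT (indicesT elts) (vecD (lookupT (wk elts) v0) (wk v)) λ x (i , ρ) → Vec.≡-dec Fin._≟_
      (lookup (den elts x ρ) i) (den v x ρ))
    (λ x ρ → ix x (γ x ρ)) λ x ρ → filter-singleton (λ i → Vec.≡-dec Fin._≟_ (lookup (den elts x ρ) i) (den v x ρ))
      (trans (lookup-elts x ρ (ix x (γ x ρ))) (trans (Elements.lookup-ix x (γ x ρ)) (sym (v-eq x ρ))))
      λ {j} eq → Elements.ix-unique x (γ x ρ) (trans (sym (lookup-elts x ρ j)) (trans eq (v-eq x ρ)))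
    where
    lookup-elts : ∀ x ρ i → lookup (den elts x ρ) i ≡ List.lookup (Elements.E x) i
    lookup-elts x ρ i = trans (cong (λ v → lookup v i) (elts-eq x ρ)) (lookup-fromList (Elements.E x) i)

  lookup-elements : ∀ (x : Instance B) i → lookup (Vec.fromList (Elements.E x)) i ≡ table (proj₁ (Elements.elt x i))
  lookup-elements x i = trans (lookup-fromList (Elements.E x) i) (sym (Elements.table-elt x i))

  elsC : Comp (input ∷ []) (list el)
  elsC = indicesT elementsC

  elsVecC : Comp (input ∷ []) (vec k el)
  elsVecC = recode elsC (λ x _ → Vec.allFin (k x)) λ x _ → cong (code (list el) x) (sym (toList-tabulate id))

  mulC : Comp (input ∷ []) (vec k (vec k el))
  mulC = mapVecT elsVecC (mapVecT (wk elsVecC) (indexT (wk (wk elementsC)) (λ _ _ → refl)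
    (composeT (lookupT (wk (wk elementsC)) v1) (lookupT (wk (wk elementsC)) v0))
    (λ x (j , i , _) → Group._∙_ (HomExtSym.G (Instance.instance′ x)) (Elements.elt x i) (Elements.elt x j))
    λ x (j , i , _) → trans (cong₂ _⊙_ (lookup-elements x i) (lookup-elements x j))
      (sym (table-∘ (proj₁ (Elements.elt x i)) (proj₁ (Elements.elt x j))))))

  unitC : Comp (input ∷ []) el
  unitC = indexT elementsC (λ _ _ → refl) identityC (λ x _ → Group.ε (HomExtSym.G (Instance.instance′ x)))
    λ _ _ → refl

  gensC : Comp (input ∷ []) (list el)
  gensC = override (mapT (indicesT gensGC) (indexT (wk elementsC) (λ _ _ → refl) (lookupT (wk gensGC) v0)
      (λ x (i , _) → gensG x i , gen i) λ x (i , _) → Vec.lookup∘tabulate (table ∘ gensG x) i))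
    (λ x _ → generators x) λ x _ → map-tabulate id _

  hsC : Comp (input ∷ []) (list (el ⊗ₜ perm))
  hsC = override (mapT (indicesT gensMC) (pairT (indexT (wk elementsC) (λ _ _ → refl) (lookupT (wk gensMC) v0)
        (λ x (i , _) → HomExtSym.ι (Instance.instance′ x) (gensM x i , gen i)) λ x (i , _) → Vec.lookup∘tabulate
          (table ∘ gensM x) i)
      (lookupT (wk imagesC) v0)))
    (λ x _ → hs x) λ x _ → trans (map-tabulate id _) (tabulate-cong λ i → cong
      (ix x (HomExtSym.ι (Instance.instance′ x) (gensM x i , gen i)) ,_) (Vec.lookup∘tabulate (table ∘ imagesM x) i))

  ptsC : Comp (input ∷ []) (list pt)
  ptsC = allFinT mC λ _ _ → refl

  orderC : Comp (input ∷ []) natₜ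
  orderC = lenT (toListT elementsC)

  blocksC : Comp (input ∷ []) (list blk)
  blocksC = vectorsT B ptsC orderC (λ x _ → Vec.length-toList (Vec.fromList (Elements.E x))) Elements.k≤B

  kersC : Comp (input ∷ []) (list ker)
  kersC = vectorsT B elsC orderC (λ x _ → Vec.length-toList (Vec.fromList (Elements.E x))) Elements.k≤B

  countsC : Comp (input ∷ []) (list natₜ)
  countsC = upToT (sucT mC)

  constant : (t : Comp Γ τ) (f : ∀ x → El τ x) → (∀ x ρ → den t x ρ ≡ f x) → Comp Γ (the τ f)
  constant {τ = τ} t f eq = recode t (λ _ _ → tt) λ x ρ → cong (code τ x) (eq x ρ)

  -- Every table is a function of the instance, so `the` records its value in the type and the
  -- equations of `tables` hold by `refl`.
  Δ : Ctx
  Δ = the (list pt) points ∷ the (list blk) P.blocks ∷ the (list el) (λ x → List.allFin (k x)) ∷ the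
    (vec k (vec k el)) mulTable ∷
      the el (λ x → Problem.e₀ (problem x)) ∷ the (list el) generators ∷ the (list (el ⊗ₜ perm)) hs ∷ the
        (list ker) P.kernels ∷
      the (list natₜ) (λ x → upTo (suc (m x))) ∷ input ∷ []

  tables : Tables Δ
  tables = record
    { pts = theT v0 ; blocksT = theT v1 ; els = theT v2 ; mulT = theT v3 ; unitT = theT (wk v3) ; gensT = theT
      (wk (wk v3))
    ; hsT = theT (wk (wk (wk v3))) ; kersT = theT (wk (wk (wk (wk v3)))) ; countsT = theT (wk (wk (wk (wk (wk v3)))))
    ; pts-den = λ _ _ → refl ; els-den = λ _ _ → refl ; mul-den = λ _ _ → refl ; unit-den = λ _ _ → refl ;
      gens-den = λ _ _ → refl
    ; hs-den = λ _ _ → refl ; blocks-den = λ _ _ → refl ; kers-den = λ _ _ → refl ; counts-den = λ _ _ → refl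
    }

  opaque
    search : Enumerator Δ (λ x ρ → map (λ s → code (list (list pt)) x (images x (proj₂ s))) (leaves x))
    search = searchTilings tables (λ x ρ → m≤m+n _ _) λ x ρ → ≤-trans (m≤m+n _ _)
      (m≤n+m _ (size (code (list pt) x (points x))))

    -- Each table is computed once from the input alone, hence the weakenings. All this work falls
    -- into the gap before the first output.
    enumerator : Enumerator (input ∷ []) (λ x ρ → map (λ s → code (list (list pt)) x (images x (proj₂ s))) (leaves x))
    enumerator =
      letE (constant countsC (λ x → upTo (suc (m x))) λ _ _ → refl) (
      letE (wk (constant kersC P.kernels λ _ _ → refl)) (
      letE (wk (wk (constant hsC hs λ _ _ → refl))) (
      letE (wk (wk (wk (constant gensC generators λ _ _ → refl)))) (
      letE (wk (wk (wk (wk (constant unitC (λ x → Problem.e₀ (problem x)) λ _ _ → refl))))) (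
      letE (wk (wk (wk (wk (wk (constant mulC mulTable λ _ _ → refl)))))) (
      letE (wk (wk (wk (wk (wk (wk (constant elsC (λ x → List.allFin (k x)) λ _ _ → refl))))))) (
      letE (wk (wk (wk (wk (wk (wk (wk (constant blocksC P.blocks λ _ _ → refl)))))))) (
      letE (wk (wk (wk (wk (wk (wk (wk (wk (constant ptsC points λ _ _ → refl))))))))) search))))))))

theorem1p21 : (B : ℕ) → EfficientlyEnumerable (λ I → OrderAtMost B (HomExtSym.G I))
theorem1p21 B = prog (zero , tt) , proj₁ majorant , proj₁ (proj₂ majorant) , enumerates
  where
  open Preprocessing B using (enumerator; module Enumerator; all-tilings; solutions; solutions-complete;
    solutions-unique; solutions-listed)
  open Enumerator enumerator

  total : Poly
  -- The size of a context with one entry is the size of that entry plus 0.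
  total = bound ⊚ (instance-size ⊕ con 0)

  majorant : ∃[ c ] ∃[ e ] (∀ N → total at N ≤ c * suc N ^ e)
  majorant = at-majorant total

  enumerates : ∀ {n m} (J : HomExtSym n m) → OrderAtMost B (HomExtSym.G J) →
               Enumerates (prog (zero , tt)) J (proj₁ majorant * (1 + n + m) ^ proj₁ (proj₂ majorant))
  enumerates {n} {m} J order =
    let (t , run , outs , cheap) = runs x _ (zero , tt) {codeInstance J Vec.∷ Vec.[]} (refl , tt) in record
    { trace     = t
    ; run       = run
    ; solutions = solutions x
    ; complete  = solutions-complete x
    ; unique    = solutions-unique x
    ; listed    = trans outs (trans (sym (map-∘ (all-tilings x))) (sym (solutions-listed x)))
    ; cheap     = All.map (λ le → ≤-trans le (≤-trans (at-mono bound (+-monoˡ-≤ 0 (size-codeInstance J)))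
      (proj₂ (proj₂ majorant) (n + m)))) (cheap 0)
    }
    where
    x : Instance B
    x = record { instance′ = J ; order = order }
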